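{- For $t\geq 1$ let $m_t$ be the maximum order of the canonical group over all face 2-coloured spherical triangulations whose underlying graphs are simple and which have $t$ faces of each colour. Then $$\limsup_{t\rightarrow\infty}(m_t)^{1/t}<6^{1/5}.$$
   Context: A face 2-coloured spherical triangulation is a triangulation of the sphere whose faces are properly coloured black and white (faces sharing an edge have different colours). Let $V$ be its vertex set and let $\mathcal{A}_W$ be the abelian group generated by $V$ subject to $r+c+s=0$ for each white face with vertices $r,c,s$. Then $\mathcal{A}_W\cong\mathbb{Z}\oplus\mathbb{Z}\oplus\mathcal{C}$ for a finite abelian group $\mathcal{C}$, called the canonical group of the triangulation. -}

module Defs where

open import Data.Nat using (ℕ; zero; suc; _≤_)
open import Data.Fin using (Fin; zero; suc; _≟_)
open import Data.Integer using (ℤ; +_; _+_; _*_; _-_)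
open import Data.Product using (Σ; _×_; _,_; ∃)
open import Data.Sum using (_⊎_)
open import Relation.Binary.PropositionalEquality using (_≡_; _≢_)
open import Relation.Binary.Construct.Closure.ReflexiveTransitive using (Star)
open import Relation.Nullary using (¬_; does)
open import Data.Bool using (if_then_else_)

Face : ℕ → Set
Face n = Fin n × Fin n × Fin n

_∈F_ : ∀ {n} → Fin n → Face n → Set
v ∈F (a , b , c) = v ≡ a ⊎ v ≡ b ⊎ v ≡ c

DistinctFace : ∀ {n} → Face n → Set
DistinctFace (a , b , c) = a ≢ b × b ≢ c × a ≢ c

record Triangulation (t : ℕ) : Set where
  field
    n      : ℕ
    white  : Fin t → Face n
    black  : Fin t → Face n
    white-distinct : ∀ i → DistinctFace (white i)
    black-distinct : ∀ i → DistinctFace (black i)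
    covered : ∀ v → (Σ (Fin t) λ i → v ∈F white i) ⊎ (Σ (Fin t) λ i → v ∈F black i)
    -- simple graph, every edge in exactly two faces, proper face 2-colouring:
    -- a pair of distinct vertices spanning an edge lies in exactly one white
    -- face and exactly one black face
    edge-wb : ∀ u v → u ≢ v → (Σ (Fin t) λ i → u ∈F white i × v ∈F white i)
                            → (Σ (Fin t) λ j → u ∈F black j × v ∈F black j)
    edge-bw : ∀ u v → u ≢ v → (Σ (Fin t) λ j → u ∈F black j × v ∈F black j)
                            → (Σ (Fin t) λ i → u ∈F white i × v ∈F white i)
    white-unique : ∀ u v i i′ → u ≢ v → u ∈F white i → v ∈F white i
                   → u ∈F white i′ → v ∈F white i′ → i ≡ i′
    black-unique : ∀ u v j j′ → u ≢ v → u ∈F black j → v ∈F black j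
                   → u ∈F black j′ → v ∈F black j′ → j ≡ j′

  InFace2 : Fin n → Fin n → Set
  InFace2 u v = (Σ (Fin t) λ i → u ∈F white i × v ∈F white i)
              ⊎ (Σ (Fin t) λ i → u ∈F black i × v ∈F black i)

  InFace3 : Fin n → Fin n → Fin n → Set
  InFace3 u v w = (Σ (Fin t) λ i → u ∈F white i × v ∈F white i × w ∈F white i)
                ⊎ (Σ (Fin t) λ i → u ∈F black i × v ∈F black i × w ∈F black i)

  Adj : Fin n → Fin n → Set
  Adj u v = u ≢ v × InFace2 u v

  LinkAdj : Fin n → Fin n → Fin n → Set
  LinkAdj x u w = x ≢ u × x ≢ w × u ≢ w × InFace3 x u w

  field
    connected : ∀ u v → Star Adj u v
    -- the link of every vertex is connected (closed surface condition)
    link-connected : ∀ x u w → Adj x u → Adj x w → Star (LinkAdj x) u w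
    -- Euler characteristic 2:  V - E + F = n - 3t + 2t = 2
    euler : n ≡ t Data.Nat.+ 2

-- The group A_W = ℤ^V / ⟨ r + c + s : white faces {r,c,s} ⟩ and the
-- order of its torsion subgroup (the canonical group C).

sumFin : (k : ℕ) → (Fin k → ℤ) → ℤ
sumFin zero    f = + 0
sumFin (suc k) f = f zero + sumFin k (λ i → f (suc i))

ind : ∀ {n} → Fin n → Fin n → ℤ
ind v a = if does (v ≟ a) then + 1 else + 0

occ : ∀ {n} → Fin n → Face n → ℤ
occ v (a , b , c) = ind v a + ind v b + ind v c

module _ {t : ℕ} (T : Triangulation t) where
  open Triangulation T

  Vector : Set
  Vector = Fin n → ℤ

  InRelations : Vector → Set
  InRelations x = Σ (Fin t → ℤ) λ c → ∀ v → x v ≡ sumFin t (λ i → c i * occ v (white i))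

  _∼W_ : Vector → Vector → Set
  x ∼W y = InRelations (λ v → x v - y v)

  Torsion : Vector → Set
  Torsion x = Σ ℕ λ k → 1 ≤ k × InRelations (λ v → + k * x v)

  -- the canonical group C (= torsion subgroup of A_W ≅ ℤ ⊕ ℤ ⊕ C) has order m:
  -- there are m pairwise distinct torsion elements exhausting the torsion subgroup
  CanonicalOrder : ℕ → Set
  CanonicalOrder m =
    Σ (Fin m → Vector) λ g →
      (∀ i → Torsion (g i)) ×
      (∀ i j → ¬ (i ≡ j) → ¬ (g i ∼W g j)) ×
      (∀ x → Torsion x → Σ (Fin m) λ i → x ∼W g i)

{-# OPTIONS --safe #-}
module Submission where

-- The vertices are 3-coloured: mod 2, any two vertices lie on equally many white
-- and black faces, so the n = t + 2 incidence vectors span an isotropic subspace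
-- of 𝔽₂²ᵗ, whose dimension is at most t; two independent dependencies give the
-- colours.  Call the colours R, C, S.  For a black face with R-vertex v, the white
-- face across its C-S edge has R-vertex u; these arcs v → u form a digraph in
-- which the arcs through a C-vertex ("hub") make directed circuits, and in A_W
-- the out-neighbours of v sum to deg(v)·v.  Rotor routing expresses every torsion
-- class by a choice of one outgoing arc at each vertex but the root, and whenever
-- all arcs of a hub are chosen, advancing them together keeps the class.  So the
-- canonical group has at most as many elements as there are choices without a full
-- hub.  The events "c is full" are negatively correlated, so this number is at most
--   ∏_v deg(v) · ∏_c (1 − ∏_{v ~ c} 1/deg(v)),
-- the second product being over hubs c away from the root and from high degrees.
-- With (1 − 1/p)²⁶ ≤ p/71 it separates over the vertices, and the product of the
-- bounds for the three cyclic choices of (R, C) gives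
-- m⁷⁸ · 71ⁿ ≤ 14ⁿ · 17000³ᵗ, hence m ≤ (10/7)ᵗ, while (10/7)⁵ < 6.

open import Defs
open import Data.Nat using (ℕ; _≤_; _<_; _*_; _^_)
open import Data.Product using (Σ; _×_)
open import Algebra.Bundles using (AbelianGroup; CommutativeMonoid; CommutativeRing)
open import Data.Bool using (Bool; true; false; _∧_; _xor_; not; if_then_else_) renaming (_≟_ to _≟ᵇ_)
open import Data.Bool.Properties using (xor-∧-commutativeRing; ∧-zeroʳ; ∧-identityʳ; ∧-idem; ∧-assoc; ∧-comm; ∧-distribˡ-xor; xor-assoc; xor-same; ¬-not)
open import Data.Empty using (⊥)
open import Data.Fin using (Fin; zero; suc; _≟_; toℕ; fromℕ<; punchIn; splitAt; _↑ˡ_; _↑ʳ_)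
open import Data.Fin.Patterns
open import Data.Fin.Properties using (all?; any?; injective⇒≤; pigeonhole; splitAt-↑ˡ; splitAt-↑ʳ; toℕ-fromℕ<)
open import Data.Integer using (ℤ; +_; -[1+_]; 0ℤ; 1ℤ) renaming (_+_ to _+ᶻ_; _*_ to _*ᶻ_; _-_ to _-ᶻ_; -_ to -ᶻ_; _≤_ to _≤ᶻ_)
import Data.Integer as ℤ
import Data.Integer.Properties as ℤ
open import Data.Integer.Tactic.RingSolver renaming (solve-∀ to solve-∀ᶻ)
open import Data.List using (List; []; _∷_; _++_; filter; allFin; length; tabulate; cartesianProductWith; cartesianProduct)
import Data.List as List
import Data.List.Properties as List
open import Data.List.Membership.Propositional using (_∈_; find)
open import Data.List.Membership.Propositional.Properties using (∈-allFin; ∈-lookup; ∈-filter⁺; ∈-filter⁻; ∈-cartesianProductWith⁺; ∈-cartesianProductWith⁻; ∈-cartesianProduct⁺)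
open import Data.List.Relation.Unary.All using (All; []; _∷_)
import Data.List.Relation.Unary.All as All
import Data.List.Relation.Unary.All.Properties as All
open import Data.List.Relation.Unary.AllPairs using (AllPairs; []; _∷_)
open import Data.List.Relation.Unary.Any using (here; there; index)
open import Data.List.Relation.Unary.Any.Properties using (lookup-index)
open import Data.List.Relation.Unary.Unique.Propositional using (Unique)
open import Data.List.Relation.Unary.Unique.Propositional.Properties using (allFin⁺; filter⁺; cartesianProductWith⁺)
open import Data.Nat using (zero; suc; _+_; _∸_; _≤′_; ≤′-refl; ≤′-step; z≤n; s≤s; NonZero; _≤?_; _<?_; ≢-nonZero; >-nonZero)
import Data.Nat.Properties as ℕ
open import Data.Nat.Tactic.RingSolver using (solve-∀)
open import Data.Product using (_,_; proj₁; proj₂; ∃-syntax)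
open import Data.Sum using (_⊎_; inj₁; inj₂; [_,_]′)
import Data.Sum as Sum
open import Data.Vec using (Vec; []; _∷_; lookup; _[_]≔_)
import Data.Vec as Vec
open import Data.Vec.Functional using (insertAt)
open import Data.Vec.Functional.Properties using (insertAt-lookup; insertAt-punchIn)
open import Data.Vec.Properties using (lookup∘tabulate; lookup∘updateAt; lookup∘updateAt′; []≔-idempotent; []≔-lookup)
open import Function using (_∘_; id; case_of_)
open import Level using (0ℓ)
open import Relation.Binary.Construct.Closure.ReflexiveTransitive using (Star; _◅_) renaming (ε to stop)
open import Relation.Binary.PropositionalEquality hiding (setoid; isEquivalence)
open import Relation.Nullary using (¬_; Dec; yes; no; contradiction; does)
open import Relation.Nullary.Decidable using (_⊎-dec_; _×-dec_; _→-dec_; ¬?; dec-true; dec-false; decidable-stable; from-yes)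
open import Relation.Unary using (Decidable)

-- Sums over lists in a commutative monoid

-- Counting choices alone is too weak. The average degree is near 3, and the product of the degrees
-- is only bounded by 3^(t/3), while 3^(1/3) ≈ 1.442 exceeds 6^(1/5) ≈ 1.431; the gain must come
-- from the hubs. If all degrees are 3, the vertices around a hub have 27 joint choices, 26 of them
-- not full, which gives (3 · 26/27)^(1/3) ≈ 1.424. The constants are fitted to this case: the
-- exponent 26 puts the extremum of the hub estimate at p = 27, and 14 · 17000^d nearly touches
-- d^(26+d) at d = 3 and d = 4. Routing needs nonnegative chips and a place where they vanish. So
-- one vertex of colour R (the root) and one hub are killed in A_W. Two homomorphisms to ℤ show that
-- the torsion subgroup embeds in this quotient, where every class is a nonnegative sum of
-- R-vertices. Routing stops because strong connectivity yields a function that is strictly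
-- superharmonic off the root.

module ListSum {c ℓ} (M : CommutativeMonoid c ℓ) where
  open CommutativeMonoid M renaming (refl to ≈-refl; sym to ≈-sym; trans to ≈-trans)
  open import Algebra.Properties.CommutativeSemigroup commutativeSemigroup using (interchange)
  open import Relation.Binary.Reasoning.Setoid setoid

  ∑ : ∀ {A : Set} → List A → (A → Carrier) → Carrier
  ∑ []       g = ε
  ∑ (x ∷ xs) g = g x ∙ ∑ xs g

  ∑-cong : ∀ {A : Set} (l : List A) {f g : A → Carrier} →
           (∀ x → x ∈ l → f x ≈ g x) → ∑ l f ≈ ∑ l g
  ∑-cong []      eq = ≈-refl
  ∑-cong (x ∷ l) eq = ∙-cong (eq x (here refl)) (∑-cong l (λ y y∈l → eq y (there y∈l)))

  ∑-++ : ∀ {A : Set} (l k : List A) (g : A → Carrier) → ∑ (l ++ k) g ≈ ∑ l g ∙ ∑ k g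
  ∑-++ []      k g = ≈-sym (identityˡ _)
  ∑-++ (x ∷ l) k g = ≈-trans (∙-congˡ (∑-++ l k g)) (≈-sym (assoc _ _ _))

  ∑-∙ : ∀ {A : Set} (l : List A) (f g : A → Carrier) →
        ∑ l (λ x → f x ∙ g x) ≈ ∑ l f ∙ ∑ l g
  ∑-∙ []      f g = ≈-sym (identityˡ _)
  ∑-∙ (x ∷ l) f g = ≈-trans (∙-congˡ (∑-∙ l f g)) (interchange _ _ _ _)

  ∑-ε : ∀ {A : Set} (l : List A) → ∑ l (λ _ → ε) ≈ ε
  ∑-ε []      = ≈-refl
  ∑-ε (x ∷ l) = ≈-trans (identityˡ _) (∑-ε l)

  ∑-swap : ∀ {A B : Set} (l : List A) (k : List B) (f : A → B → Carrier) →
           ∑ l (λ x → ∑ k (f x)) ≈ ∑ k (λ y → ∑ l (λ x → f x y))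
  ∑-swap []      k f = ≈-sym (∑-ε k)
  ∑-swap (x ∷ l) k f = ≈-trans (∙-congˡ (∑-swap l k f)) (≈-sym (∑-∙ k (f x) _))

  ∑-filter : ∀ {A : Set} {P : A → Set} (P? : Decidable P) (l : List A) (g : A → Carrier) →
             ∑ (filter P? l) g ≈ ∑ l (λ x → if does (P? x) then g x else ε)
  ∑-filter P? []      g = ≈-refl
  ∑-filter P? (x ∷ l) g with does (P? x)
  ... | true  = ∙-congˡ (∑-filter P? l g)
  ... | false = ≈-trans (∑-filter P? l g) (≈-sym (identityˡ _))

  ∑-none : ∀ {n} (k : Fin n) (l : List (Fin n)) (g : Fin n → Carrier) → (∀ x → x ∈ l → k ≢ x) →
           ∑ l (λ x → if does (k ≟ x) then g x else ε) ≈ ε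
  ∑-none k l g k∉l = ≈-trans (∑-cong l λ x x∈l → reflexive (cong (if_then g x else ε) (dec-false (k ≟ x) (k∉l x x∈l)))) (∑-ε l)

  ∑-single : ∀ {n} {k : Fin n} {l : List (Fin n)} → Unique l → k ∈ l → (g : Fin n → Carrier) →
             ∑ l (λ x → if does (k ≟ x) then g x else ε) ≈ g k
  ∑-single {k = k} {x ∷ l} (x∉l ∷ u) k∈ g with k ≟ x
  ... | yes refl = ≈-trans (∙-congˡ (∑-none k l g λ y y∈l → All.lookup x∉l y∈l)) (identityʳ _)
  ∑-single (x∉l ∷ u) (here k≡x)  g | no k≢x = contradiction k≡x k≢x
  ∑-single (x∉l ∷ u) (there k∈l) g | no k≢x = ≈-trans (identityˡ _) (∑-single u k∈l g)

  ∑-point : ∀ {n} (k : Fin n) (g : Fin n → Carrier) →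
            ∑ (allFin n) (λ x → if does (k ≟ x) then g x else ε) ≈ g k
  ∑-point {n} k = ∑-single (allFin⁺ n) (∈-allFin k)

  ∑-fibres : ∀ {t n} (f : Fin t → Fin n) (l : List (Fin t)) (g : Fin t → Carrier) →
             ∑ l g ≈ ∑ (allFin n) (λ v → ∑ (filter (λ j → f j ≟ v) l) g)
  ∑-fibres {n = n} f l g = begin
    ∑ l g
      ≈⟨ ∑-cong l (λ j _ → ∑-point (f j) (λ _ → g j)) ⟨
    ∑ l (λ j → ∑ (allFin n) (λ v → if does (f j ≟ v) then g j else ε))
      ≈⟨ ∑-swap l (allFin n) _ ⟩
    ∑ (allFin n) (λ v → ∑ l (λ j → if does (f j ≟ v) then g j else ε))
      ≈⟨ ∑-cong (allFin n) (λ v _ → ∑-filter (λ j → f j ≟ v) l g) ⟨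
    ∑ (allFin n) (λ v → ∑ (filter (λ j → f j ≟ v) l) g) ∎

  -- Both sides are one double sum over the graph of `σ`, which `σ⁻¹` describes as well; no
  -- permutation of lists is needed.
  ∑-bijection : ∀ {t} (σ σ⁻¹ : Fin t → Fin t) → (∀ i → σ⁻¹ (σ i) ≡ i) → (∀ i → σ (σ⁻¹ i) ≡ i) →
                (g : Fin t → Carrier) → ∑ (allFin t) (g ∘ σ) ≈ ∑ (allFin t) g
  ∑-bijection {t} σ σ⁻¹ invˡ invʳ g = begin
    ∑ (allFin t) (g ∘ σ)
      ≈⟨ ∑-cong (allFin t) (λ j _ → ∑-point (σ j) g) ⟨
    ∑ (allFin t) (λ j → ∑ (allFin t) (λ i → if does (σ j ≟ i) then g i else ε))
      ≈⟨ ∑-swap (allFin t) (allFin t) _ ⟩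
    ∑ (allFin t) (λ i → ∑ (allFin t) (λ j → if does (σ j ≟ i) then g i else ε))
      ≈⟨ ∑-cong (allFin t) (λ i _ → ∑-cong (allFin t) (λ j _ → reflexive (cong (if_then g i else ε) (adjoint j i)))) ⟩
    ∑ (allFin t) (λ i → ∑ (allFin t) (λ j → if does (σ⁻¹ i ≟ j) then g i else ε))
      ≈⟨ ∑-cong (allFin t) (λ i _ → ∑-point (σ⁻¹ i) (λ _ → g i)) ⟩
    ∑ (allFin t) g ∎
    where
    adjoint : ∀ j i → does (σ j ≟ i) ≡ does (σ⁻¹ i ≟ j)
    adjoint j i with σ j ≟ i | σ⁻¹ i ≟ j
    ... | yes _    | yes _    = refl
    ... | no _     | no _     = refl
    ... | yes refl | no ≢j  = contradiction (invˡ j) ≢j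
    ... | no σj≢   | yes refl = contradiction (invʳ i) σj≢

  -- Serves twice: with `τ` on the arcs of one hub, and with the crossings `α` to pass from the
  -- black faces at a vertex to the white ones.
  ∑-fibre-bijection : ∀ {t n} (σ σ⁻¹ : Fin t → Fin t) → (∀ i → σ⁻¹ (σ i) ≡ i) → (∀ i → σ (σ⁻¹ i) ≡ i) →
    (a b : Fin t → Fin n) → (∀ j → b (σ j) ≡ a j) → (g : Fin t → Carrier) (v : Fin n) →
    ∑ (filter (λ j → a j ≟ v) (allFin t)) (g ∘ σ) ≈ ∑ (filter (λ i → b i ≟ v) (allFin t)) g
  ∑-fibre-bijection {t} σ σ⁻¹ invˡ invʳ a b bσ≡a g v = begin
    ∑ (filter (λ j → a j ≟ v) (allFin t)) (g ∘ σ)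
      ≈⟨ ∑-filter (λ j → a j ≟ v) (allFin t) (g ∘ σ) ⟩
    ∑ (allFin t) (λ j → if does (a j ≟ v) then g (σ j) else ε)
      ≈⟨ ∑-cong (allFin t) (λ j _ → reflexive (cong (λ w → if does (w ≟ v) then g (σ j) else ε) (bσ≡a j))) ⟨
    ∑ (allFin t) (λ j → if does (b (σ j) ≟ v) then g (σ j) else ε)
      ≈⟨ ∑-bijection σ σ⁻¹ invˡ invʳ (λ i → if does (b i ≟ v) then g i else ε) ⟩
    ∑ (allFin t) (λ i → if does (b i ≟ v) then g i else ε)
      ≈⟨ ∑-filter (λ i → b i ≟ v) (allFin t) g ⟨
    ∑ (filter (λ i → b i ≟ v) (allFin t)) g ∎

-- Isotropic vectors over 𝔽₂

module 𝔽₂ = CommutativeRing xor-∧-commutativeRing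
open import Algebra.Properties.CommutativeMonoid.Sum 𝔽₂.+-commutativeMonoid
open import Algebra.Properties.Semiring.Sum 𝔽₂.semiring using (*-distribˡ-sum; *-distribʳ-sum)

xor-cancel : ∀ a b → a xor b ≡ false → b ≡ a
xor-cancel false false _ = refl
xor-cancel true  true  _ = refl

sum-false : ∀ {n} {f : Fin n → Bool} → (∀ i → f i ≡ false) → sum f ≡ false
sum-false {n} f≡ = trans (sum-cong-≗ f≡) (sum-replicate-zero n)

-- Independent vectors in the left kernel of the matrix `U`, so `a` is a lower bound for its
-- nullity.
record Dependencies {n N : ℕ} (U : Fin n → Fin N → Bool) (a : ℕ) : Set where
  field
    rows        : Fin a → Fin n → Bool
    annihilates : ∀ s x → sum (λ i → rows s i ∧ U i x) ≡ false
    independent : (λ′ : Fin a → Bool) → (∀ i → sum (λ s → λ′ s ∧ rows s i) ≡ false) → ∀ s → λ′ s ≡ false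

sum-δ : ∀ {n} (f : Fin n → Bool) i → sum (λ s → f s ∧ does (s ≟ i)) ≡ f i
sum-δ {suc n} f zero = trans (cong₂ _xor_ (∧-identityʳ (f zero)) (sum-false (∧-zeroʳ ∘ f ∘ suc))) (𝔽₂.+-identityʳ _)
sum-δ f (suc i) = cong₂ _xor_ (∧-zeroʳ (f zero)) (sum-δ (f ∘ suc) i)

allDependencies : ∀ {n} (U : Fin n → Fin 0 → Bool) → Dependencies U n
allDependencies U = record
  { rows = λ s i → does (s ≟ i)
  ; annihilates = λ _ ()
  ; independent = λ λ′ eq s → trans (sym (sum-δ λ′ s)) (eq s)
  }

Orthogonal : ∀ {n k N} → (Fin n → Fin N → Bool) → (Fin k → Fin N → Bool) → Set
Orthogonal U W = ∀ i j → sum (λ x → U i x ∧ W j x) ≡ false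

-- This is rank U + rank W ≤ N, the dimension count for orthogonal row spaces, written with
-- nullities.
DependencyBound : ∀ {n k N} → (Fin n → Fin N → Bool) → (Fin k → Fin N → Bool) → Set
DependencyBound {n} {k} {N} U W = ∃[ a ] ∃[ b ] Dependencies U a × Dependencies W b × n + k ≤ a + b + N

Orthogonal-sym : ∀ {n k N} {U : Fin n → Fin N → Bool} {W : Fin k → Fin N → Bool} → Orthogonal U W → Orthogonal W U
Orthogonal-sym {U = U} {W} U⊥W j i = trans (sum-cong-≗ (λ x → ∧-comm (W j x) (U i x))) (U⊥W i j)

DependencyBound-sym : ∀ {n k N} {U : Fin n → Fin N → Bool} {W : Fin k → Fin N → Bool} → DependencyBound U W → DependencyBound W U
DependencyBound-sym {n} {k} {N} (a , b , D , E , le) =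
  b , a , E , D , subst₂ _≤_ (ℕ.+-comm n k) (cong (_+ N) (ℕ.+-comm a b)) le

-- Gaussian elimination in the first column: row `p` and that column go, and both sides of the bound
-- lose one. `W` loses only the column, which orthogonality to row `p` recovers from the other
-- columns.
pivotStep : ∀ {n k N} (U : Fin (suc n) → Fin (suc N) → Bool) (W : Fin k → Fin (suc N) → Bool) p → U p zero ≡ true →
  Orthogonal U W →
  (∀ (U′ : Fin n → Fin N → Bool) (W′ : Fin k → Fin N → Bool) → Orthogonal U′ W′ → DependencyBound U′ W′) →
  DependencyBound U W
pivotStep {n} {k} {N} U W p Up₀ U⊥W ih with ih U′ W′ orth
  where
  U′ : Fin n → Fin N → Bool
  U′ i x = U (punchIn p i) (suc x) xor (U (punchIn p i) zero ∧ U p (suc x))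
  W′ : Fin k → Fin N → Bool
  W′ j x = W j (suc x)
  tails : ∀ i j → sum (λ x → U i (suc x) ∧ W j (suc x)) ≡ U i zero ∧ W j zero
  tails i j = xor-cancel (U i zero ∧ W j zero) _ (U⊥W i j)
  orth : Orthogonal U′ W′
  orth i j = begin
    sum (λ x → (u (suc x) xor (u zero ∧ U p (suc x))) ∧ W j (suc x))
      ≡⟨ sum-cong-≗ (λ x → trans (𝔽₂.distribʳ (W j (suc x)) (u (suc x)) (u zero ∧ U p (suc x)))
                                 (cong ((u (suc x) ∧ W j (suc x)) xor_) (∧-assoc (u zero) _ _))) ⟩
    sum (λ x → (u (suc x) ∧ W j (suc x)) xor (u zero ∧ (U p (suc x) ∧ W j (suc x))))
      ≡⟨ ∑-distrib-+ (λ x → u (suc x) ∧ W j (suc x)) _ ⟩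
    sum (λ x → u (suc x) ∧ W j (suc x)) xor sum (λ x → u zero ∧ (U p (suc x) ∧ W j (suc x)))
      ≡⟨ cong₂ _xor_ (tails (punchIn p i) j)
           (trans (sym (*-distribˡ-sum (u zero) (λ x → U p (suc x) ∧ W j (suc x))))
                  (cong (u zero ∧_) (trans (tails p j) (cong (_∧ W j zero) Up₀)))) ⟩
    (u zero ∧ W j zero) xor (u zero ∧ W j zero)
      ≡⟨ xor-same (u zero ∧ W j zero) ⟩
    false ∎
    where
    open ≡-Reasoning
    u = U (punchIn p i)
... | a , b , D , E , le = a , b , D′ , E′ , subst (suc (n + k) ≤_) (sym (ℕ.+-suc (a + b) N)) (s≤s le)
  where
  open ≡-Reasoning
  module D = Dependencies D
  module E = Dependencies E
  -- The multiple of the pivot row that turns a dependency of the reduced rows into one of the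
  -- original rows.
  coeff : Fin a → Bool
  coeff s = sum (λ i → D.rows s i ∧ U (punchIn p i) zero)
  rows : Fin a → Fin (suc n) → Bool
  rows s = insertAt (D.rows s) p (coeff s)
  expand : ∀ s x → sum (λ i → rows s i ∧ U i x) ≡ (coeff s ∧ U p x) xor sum (λ i → D.rows s i ∧ U (punchIn p i) x)
  expand s x = trans (sum-remove {i = p} (λ i → rows s i ∧ U i x))
    (cong₂ _xor_ (cong (_∧ U p x) (insertAt-lookup (D.rows s) p (coeff s)))
                 (sum-cong-≗ λ i → cong (_∧ U (punchIn p i) x) (insertAt-punchIn (D.rows s) p (coeff s) i)))
  rest : ∀ s x → sum (λ i → D.rows s i ∧ U (punchIn p i) (suc x)) ≡ coeff s ∧ U p (suc x)
  rest s x = sym (xor-cancel _ _ (begin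
    sum (λ i → D.rows s i ∧ U (punchIn p i) (suc x)) xor (coeff s ∧ U p (suc x))
      ≡⟨ cong (sum (λ i → D.rows s i ∧ U (punchIn p i) (suc x)) xor_) (*-distribʳ-sum (U p (suc x)) (λ i → D.rows s i ∧ U (punchIn p i) zero)) ⟩
    sum (λ i → D.rows s i ∧ U (punchIn p i) (suc x)) xor sum (λ i → (D.rows s i ∧ U (punchIn p i) zero) ∧ U p (suc x))
      ≡⟨ ∑-distrib-+ (λ i → D.rows s i ∧ U (punchIn p i) (suc x)) _ ⟨
    sum (λ i → (D.rows s i ∧ U (punchIn p i) (suc x)) xor ((D.rows s i ∧ U (punchIn p i) zero) ∧ U p (suc x)))
      ≡⟨ sum-cong-≗ (λ i → trans (cong ((D.rows s i ∧ U (punchIn p i) (suc x)) xor_) (∧-assoc (D.rows s i) _ _))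
                                 (sym (𝔽₂.distribˡ (D.rows s i) _ _))) ⟩
    sum (λ i → D.rows s i ∧ (U (punchIn p i) (suc x) xor (U (punchIn p i) zero ∧ U p (suc x))))
      ≡⟨ D.annihilates s x ⟩
    false ∎))
  D′ : Dependencies U a
  D′ = record
    { rows = rows
    ; annihilates = λ where
        s zero → trans (expand s zero)
          (trans (cong (λ b → (coeff s ∧ b) xor coeff s) Up₀)
          (trans (cong (_xor coeff s) (∧-identityʳ (coeff s))) (xor-same (coeff s))))
        s (suc x) → trans (expand s (suc x)) (trans (cong ((coeff s ∧ U p (suc x)) xor_) (rest s x)) (xor-same (coeff s ∧ U p (suc x))))
    ; independent = λ λ′ eq → D.independent λ′ λ i →
        trans (sum-cong-≗ λ s → cong (λ′ s ∧_) (sym (insertAt-punchIn (D.rows s) p (coeff s) i))) (eq (punchIn p i))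
    }
  firstEntry : ∀ j → W j zero ≡ sum (λ x → U p (suc x) ∧ W j (suc x))
  firstEntry j = sym (xor-cancel (W j zero) _ (trans (cong (λ b → (b ∧ W j zero) xor sum (λ x → U p (suc x) ∧ W j (suc x))) (sym Up₀)) (U⊥W p j)))
  E′ : Dependencies W b
  E′ = record
    { rows = E.rows
    ; annihilates = λ where
        s zero → begin
          sum (λ j → E.rows s j ∧ W j zero)
            ≡⟨ sum-cong-≗ (λ j → trans (cong (E.rows s j ∧_) (firstEntry j)) (*-distribˡ-sum (E.rows s j) (λ x → U p (suc x) ∧ W j (suc x)))) ⟩
          sum (λ j → sum (λ x → E.rows s j ∧ (U p (suc x) ∧ W j (suc x))))
            ≡⟨ ∑-comm (λ j x → E.rows s j ∧ (U p (suc x) ∧ W j (suc x))) ⟩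
          sum (λ x → sum (λ j → E.rows s j ∧ (U p (suc x) ∧ W j (suc x))))
            ≡⟨ sum-false (λ x → trans (sum-cong-≗ (λ j → ∧-exchange (E.rows s j) (U p (suc x)) (W j (suc x))))
                 (trans (sym (*-distribˡ-sum (U p (suc x)) (λ j → E.rows s j ∧ W j (suc x))))
                 (trans (cong (U p (suc x) ∧_) (E.annihilates s x)) (∧-zeroʳ _)))) ⟩
          false ∎
        s (suc x) → E.annihilates s x
    ; independent = E.independent
    }
    where
    ∧-exchange : ∀ a b c → a ∧ (b ∧ c) ≡ b ∧ (a ∧ c)
    ∧-exchange a b c = trans (sym (∧-assoc a b c)) (trans (cong (_∧ c) (∧-comm a b)) (∧-assoc b a c))

dropFirst : ∀ {n N a} {U : Fin n → Fin (suc N) → Bool} → (∀ i → U i zero ≡ false) →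
            Dependencies (λ i x → U i (suc x)) a → Dependencies U a
dropFirst {U = U} U₀ D = record
  { rows = rows
  ; annihilates = λ where
      s zero    → sum-false (λ i → trans (cong (rows s i ∧_) (U₀ i)) (∧-zeroʳ _))
      s (suc x) → annihilates s x
  ; independent = independent
  }
  where open Dependencies D

-- If neither matrix has a pivot in the first column, that column is zero and is dropped; the bound
-- then has one to spare.
dependencyBound : ∀ {n k N} (U : Fin n → Fin N → Bool) (W : Fin k → Fin N → Bool) → Orthogonal U W → DependencyBound U W
dependencyBound {n} {k} {zero} U W _ = n , k , allDependencies U , allDependencies W , ℕ.m≤m+n _ _
dependencyBound {n} {k} {suc N} U W U⊥W with any? (λ i → U i zero ≟ᵇ true) | any? (λ j → W j zero ≟ᵇ true)
dependencyBound {suc n} {k} {suc N} U W U⊥W | yes (p , Up) | _ = pivotStep U W p Up U⊥W dependencyBound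
dependencyBound {n} {suc k} {suc N} U W U⊥W | no _ | yes (p , Wp) =
  DependencyBound-sym {U = W} {W = U} (pivotStep W U p Wp (Orthogonal-sym {U = U} {W = W} U⊥W) dependencyBound)
dependencyBound {n} {k} {suc N} U W U⊥W | no ¬U | no ¬W =
  let a , b , D , E , le = dependencyBound (λ i x → U i (suc x)) (λ j x → W j (suc x))
        (λ i j → trans (cong (λ b → (b ∧ W j zero) xor sum (λ x → U i (suc x) ∧ W j (suc x))) (sym (U₀ i))) (U⊥W i j))
  in a , b , dropFirst U₀ D , dropFirst W₀ E , ℕ.≤-trans le (ℕ.+-monoʳ-≤ (a + b) (ℕ.n≤1+n N))
  where
  U₀ : ∀ i → U i zero ≡ false
  U₀ i = ¬-not (λ eq → ¬U (i , eq))
  W₀ : ∀ j → W j zero ≡ false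
  W₀ j = ¬-not (λ eq → ¬W (j , eq))

-- Spherical triangulations are 3-colourable

module Nat∑ = ListSum ℕ.+-0-commutativeMonoid
open Nat∑ using () renaming (∑ to ∑ℕ)

_∈F?_ : ∀ {n} (v : Fin n) (F : Face n) → Dec (v ∈F F)
v ∈F? (a , b , c) = (v ≟ a) ⊎-dec ((v ≟ b) ⊎-dec (v ≟ c))

bit : Bool → ℕ
bit b = if b then 1 else 0

odd : ℕ → Bool
odd zero    = false
odd (suc m) = not (odd m)

sum-odd : ∀ {A : Set} (g : A → Bool) {n} (f : Fin n → A) → sum (g ∘ f) ≡ odd (∑ℕ (tabulate f) (bit ∘ g))
sum-odd g {zero}  f = refl
sum-odd g {suc n} f with g (f zero)
... | true  = cong not (sum-odd g (f ∘ suc))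
... | false = sum-odd g (f ∘ suc)

sum-splitAt : ∀ m {n} (f : Fin m ⊎ Fin n → Bool) → sum (f ∘ splitAt m) ≡ sum (f ∘ inj₁) xor sum (f ∘ inj₂)
sum-splitAt zero    f = refl
sum-splitAt (suc m) f = begin
  f (inj₁ zero) xor sum (f ∘ Sum.map suc id ∘ splitAt m)
    ≡⟨ cong (f (inj₁ zero) xor_) (sum-splitAt m (f ∘ Sum.map suc id)) ⟩
  f (inj₁ zero) xor (sum (f ∘ inj₁ ∘ suc) xor sum (f ∘ inj₂))
    ≡⟨ xor-assoc (f (inj₁ zero)) _ _ ⟨
  sum (f ∘ inj₁) xor sum (f ∘ inj₂) ∎
  where open ≡-Reasoning

count : ∀ {t} → (Fin t → Bool) → ℕ
count {t} f = ∑ℕ (allFin t) (bit ∘ f)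

count-one : ∀ {t} (f : Fin t → Bool) i → f i ≡ true → (∀ i′ → f i′ ≡ true → i ≡ i′) → count f ≡ 1
count-one {t} f i fi uniq = trans (Nat∑.∑-cong (allFin t) (λ x _ → pointwise x)) (Nat∑.∑-point i (λ _ → 1))
  where
  pointwise : ∀ x → bit (f x) ≡ (if does (i ≟ x) then 1 else 0)
  pointwise x with i ≟ x | f x in fx
  ... | yes refl | true  = refl
  ... | yes refl | false = contradiction (trans (sym fx) fi) λ ()
  ... | no i≢x   | true  = contradiction (uniq x fx) i≢x
  ... | no _     | false = refl

count-none : ∀ {t} (f : Fin t → Bool) → (∀ i → f i ≡ false) → count f ≡ 0
count-none {t} f none = trans (Nat∑.∑-cong (allFin t) (λ x _ → cong bit (none x))) (Nat∑.∑-ε (allFin t))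

module FaceSum {c ℓ} (M : CommutativeMonoid c ℓ) where
  open CommutativeMonoid M using (Carrier; _∙_; _≈_; ∙-congˡ; comm; commutativeSemigroup) renaming (refl to ≈-refl)
  open import Algebra.Properties.CommutativeSemigroup commutativeSemigroup

  faceSum : ∀ {n} → (Fin n → Carrier) → Face n → Carrier
  faceSum φ (a , b , c) = φ a ∙ (φ b ∙ φ c)

  -- A `Face` is an ordered triple; this frees sums over it from the order. It is used over 𝔽₂ for
  -- parity and over ℤ for the relations.
  faceSum-permute : ∀ {n} (φ : Fin n → Carrier) (F : Face n) {u v w} → u ≢ v → v ≢ w → u ≢ w →
                    u ∈F F → v ∈F F → w ∈F F → faceSum φ F ≈ φ u ∙ (φ v ∙ φ w)
  faceSum-permute φ (a , b , c) u≢v v≢w u≢w = λ where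
    (inj₁ refl) (inj₁ refl) _ → contradiction refl u≢v
    (inj₂ (inj₁ refl)) (inj₂ (inj₁ refl)) _ → contradiction refl u≢v
    (inj₂ (inj₂ refl)) (inj₂ (inj₂ refl)) _ → contradiction refl u≢v
    (inj₁ refl) _ (inj₁ refl) → contradiction refl u≢w
    (inj₂ (inj₁ refl)) _ (inj₂ (inj₁ refl)) → contradiction refl u≢w
    (inj₂ (inj₂ refl)) _ (inj₂ (inj₂ refl)) → contradiction refl u≢w
    _ (inj₁ refl) (inj₁ refl) → contradiction refl v≢w
    _ (inj₂ (inj₁ refl)) (inj₂ (inj₁ refl)) → contradiction refl v≢w
    _ (inj₂ (inj₂ refl)) (inj₂ (inj₂ refl)) → contradiction refl v≢w
    (inj₁ refl) (inj₂ (inj₁ refl)) (inj₂ (inj₂ refl)) → ≈-refl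
    (inj₁ refl) (inj₂ (inj₂ refl)) (inj₂ (inj₁ refl)) → ∙-congˡ (comm (φ b) (φ c))
    (inj₂ (inj₁ refl)) (inj₁ refl) (inj₂ (inj₂ refl)) → x∙yz≈y∙xz (φ a) (φ b) (φ c)
    (inj₂ (inj₁ refl)) (inj₂ (inj₂ refl)) (inj₁ refl) → x∙yz≈y∙zx (φ a) (φ b) (φ c)
    (inj₂ (inj₂ refl)) (inj₁ refl) (inj₂ (inj₁ refl)) → x∙yz≈z∙xy (φ a) (φ b) (φ c)
    (inj₂ (inj₂ refl)) (inj₂ (inj₁ refl)) (inj₁ refl) → x∙yz≈z∙yx (φ a) (φ b) (φ c)

open FaceSum 𝔽₂.+-commutativeMonoid

∈F-xor : ∀ {n} (F : Face n) → DistinctFace F → ∀ v →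
         does (v ∈F? F) ≡ does (v ≟ proj₁ F) xor (does (v ≟ proj₁ (proj₂ F)) xor does (v ≟ proj₂ (proj₂ F)))
∈F-xor (a , b , c) (a≢b , b≢c , a≢c) v with v ≟ a | v ≟ b | v ≟ c
... | yes refl | yes refl | _        = contradiction refl a≢b
... | yes refl | no _     | yes refl = contradiction refl a≢c
... | yes refl | no _     | no _     = refl
... | no _     | yes refl | yes refl = contradiction refl b≢c
... | no _     | yes refl | no _     = refl
... | no _     | no _     | yes refl = refl
... | no _     | no _     | no _     = refl

sum-face : ∀ {n} (φ : Fin n → Bool) (F : Face n) → DistinctFace F → sum (λ v → φ v ∧ does (v ∈F? F)) ≡ faceSum φ F
sum-face {n} φ F@(a , b , c) F-distinct = begin
  sum (λ v → φ v ∧ does (v ∈F? F))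
    ≡⟨ sum-cong-≗ (λ v → trans (cong (φ v ∧_) (∈F-xor F F-distinct v))
         (trans (∧-distribˡ-xor (φ v) (does (v ≟ a)) _) (cong ((φ v ∧ does (v ≟ a)) xor_) (∧-distribˡ-xor (φ v) (does (v ≟ b)) _)))) ⟩
  sum (λ v → (φ v ∧ does (v ≟ a)) xor ((φ v ∧ does (v ≟ b)) xor (φ v ∧ does (v ≟ c))))
    ≡⟨ trans (∑-distrib-+ (λ v → φ v ∧ does (v ≟ a)) _)
             (cong (sum (λ v → φ v ∧ does (v ≟ a)) xor_) (∑-distrib-+ (λ v → φ v ∧ does (v ≟ b)) _)) ⟩
  sum (λ v → φ v ∧ does (v ≟ a)) xor (sum (λ v → φ v ∧ does (v ≟ b)) xor sum (λ v → φ v ∧ does (v ≟ c)))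
    ≡⟨ cong₂ _xor_ (sum-δ φ a) (cong₂ _xor_ (sum-δ φ b) (sum-δ φ c)) ⟩
  faceSum φ F ∎
  where open ≡-Reasoning

≟-sym : ∀ {n} (u v : Fin n) → does (u ≟ v) ≡ does (v ≟ u)
≟-sym u v with u ≟ v | v ≟ u
... | yes _    | yes _    = refl
... | no _     | no _     = refl
... | yes refl | no ≢     = contradiction refl ≢
... | no ≢     | yes refl = contradiction refl ≢

otherVertices : ∀ {n} (F : Face n) → DistinctFace F → ∀ v → v ∈F F →
                ∑ℕ (allFin n) (λ u → if does (u ≟ v) then 0 else bit (does (u ∈F? F))) ≡ 2
otherVertices {n} F@(a , b , c) (a≢b , b≢c , a≢c) v v∈F = go v∈F
  where
  flag : Fin n → Fin n → ℕ
  flag u x = if does (u ≟ x) then 1 else 0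
  two : ∀ x y → (∀ u → (if does (u ≟ v) then 0 else bit (does (u ∈F? F))) ≡ flag u x + flag u y) →
        ∑ℕ (allFin n) (λ u → if does (u ≟ v) then 0 else bit (does (u ∈F? F))) ≡ 2
  two x y eq = trans (Nat∑.∑-cong (allFin n) (λ u _ → trans (eq u)
      (cong₂ (λ p q → (if p then 1 else 0) + (if q then 1 else 0)) (≟-sym u x) (≟-sym u y))))
    (trans (Nat∑.∑-∙ (allFin n) _ _) (cong₂ _+_ (Nat∑.∑-point x (λ _ → 1)) (Nat∑.∑-point y (λ _ → 1))))
  vertexA : ∀ u → (if does (u ≟ a) then 0 else bit (does (u ∈F? F))) ≡ flag u b + flag u c
  vertexA u with u ≟ a | u ≟ b | u ≟ c
  ... | yes refl | yes refl | _        = contradiction refl a≢b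
  ... | yes refl | _        | yes refl = contradiction refl a≢c
  ... | _        | yes refl | yes refl = contradiction refl b≢c
  ... | yes _    | no _     | no _     = refl
  ... | no _     | yes _    | no _     = refl
  ... | no _     | no _     | yes _    = refl
  ... | no _     | no _     | no _     = refl
  vertexB : ∀ u → (if does (u ≟ b) then 0 else bit (does (u ∈F? F))) ≡ flag u a + flag u c
  vertexB u with u ≟ a | u ≟ b | u ≟ c
  ... | yes refl | yes refl | _        = contradiction refl a≢b
  ... | yes refl | _        | yes refl = contradiction refl a≢c
  ... | _        | yes refl | yes refl = contradiction refl b≢c
  ... | yes _    | no _     | no _     = refl
  ... | no _     | yes _    | no _     = refl
  ... | no _     | no _     | yes _    = refl
  ... | no _     | no _     | no _     = refl
  vertexC : ∀ u → (if does (u ≟ c) then 0 else bit (does (u ∈F? F))) ≡ flag u a + flag u b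
  vertexC u with u ≟ a | u ≟ b | u ≟ c
  ... | yes refl | yes refl | _        = contradiction refl a≢b
  ... | yes refl | _        | yes refl = contradiction refl a≢c
  ... | _        | yes refl | yes refl = contradiction refl b≢c
  ... | yes _    | no _     | no _     = refl
  ... | no _     | yes _    | no _     = refl
  ... | no _     | no _     | yes _    = refl
  ... | no _     | no _     | no _     = refl
  go : v ∈F F → ∑ℕ (allFin n) (λ u → if does (u ≟ v) then 0 else bit (does (u ∈F? F))) ≡ 2
  go (inj₁ refl)        = two b c vertexA
  go (inj₂ (inj₁ refl)) = two a c vertexB
  go (inj₂ (inj₂ refl)) = two a b vertexC

otherVertex : ∀ {n} (F : Face n) → DistinctFace F → ∀ {v} → v ∈F F → ∃[ u ] u ∈F F × v ≢ u
otherVertex (a , b , c) (a≢b , b≢c , a≢c) (inj₁ refl)        = b , inj₂ (inj₁ refl) , a≢b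
otherVertex (a , b , c) (a≢b , b≢c , a≢c) (inj₂ (inj₁ refl)) = c , inj₂ (inj₂ refl) , b≢c
otherVertex (a , b , c) (a≢b , b≢c , a≢c) (inj₂ (inj₂ refl)) = a , inj₁ refl , ≢-sym a≢c

module Spherical {t : ℕ} (T : Triangulation t) where
  open Triangulation T

  inWhite inBlack : Fin n → Fin t → Bool
  inWhite v i = does (v ∈F? white i)
  inBlack v j = does (v ∈F? black j)

  ∈-does : ∀ {v : Fin n} {F} → does (v ∈F? F) ≡ true → v ∈F F
  ∈-does {v} {F} eq = fromDoes (v ∈F? F) eq
    where
    fromDoes : ∀ {P : Set} (P? : Dec P) → does P? ≡ true → P
    fromDoes (yes p) _ = p

  ∧-true : ∀ {a b} → a ∧ b ≡ true → a ≡ true × b ≡ true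
  ∧-true {true} {true} _ = refl , refl

  -- Uniqueness makes either count at most 1, and `edge-wb` and `edge-bw` make them vanish together.
  edgeCount : ∀ u v → u ≢ v → count (λ i → inWhite u i ∧ inWhite v i) ≡ count (λ j → inBlack u j ∧ inBlack v j)
  edgeCount u v u≢v with any? (λ i → (inWhite u i ∧ inWhite v i) ≟ᵇ true)
  ... | yes (i , eq) = trans
        (count-one _ i eq λ i′ eq′ → let p , q = ∧-true eq ; p′ , q′ = ∧-true eq′
          in white-unique u v i i′ u≢v (∈-does p) (∈-does q) (∈-does p′) (∈-does q′))
        (sym (count-one _ j (cong₂ _∧_ (dec-true (u ∈F? black j) u∈j) (dec-true (v ∈F? black j) v∈j)) λ j′ eq′ → let p′ , q′ = ∧-true eq′
          in black-unique u v j j′ u≢v u∈j v∈j (∈-does p′) (∈-does q′)))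
    where
    onBlack = edge-wb u v u≢v (i , ∈-does (proj₁ (∧-true eq)) , ∈-does (proj₂ (∧-true eq)))
    j = proj₁ onBlack
    u∈j = proj₁ (proj₂ onBlack)
    v∈j = proj₂ (proj₂ onBlack)
  ... | no none = trans (count-none _ λ i → ¬-not (λ eq → none (i , eq)))
        (sym (count-none _ λ j → ¬-not (λ eq → let p , q = ∧-true eq ; i , u∈i , v∈i = edge-bw u v u≢v (j , ∈-does p , ∈-does q)
          in none (i , cong₂ _∧_ (dec-true (u ∈F? white i) u∈i) (dec-true (v ∈F? white i) v∈i)))))

  -- Double counting of pairs of a face at `v` and one of its two other vertices.
  handshake : (F : Fin t → Face n) → (∀ i → DistinctFace (F i)) → ∀ v →
    ∑ℕ (allFin n) (λ u → if does (u ≟ v) then 0 else count (λ i → does (u ∈F? F i) ∧ does (v ∈F? F i)))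
      ≡ count (λ i → does (v ∈F? F i)) + count (λ i → does (v ∈F? F i))
  handshake F F-distinct v = begin
    ∑ℕ (allFin n) (λ u → if does (u ≟ v) then 0 else count (λ i → does (u ∈F? F i) ∧ does (v ∈F? F i)))
      ≡⟨ Nat∑.∑-cong (allFin n) (λ u _ → pull (does (u ≟ v)) (λ i → bit (does (u ∈F? F i) ∧ does (v ∈F? F i)))) ⟩
    ∑ℕ (allFin n) (λ u → ∑ℕ (allFin t) (λ i → if does (u ≟ v) then 0 else bit (does (u ∈F? F i) ∧ does (v ∈F? F i))))
      ≡⟨ Nat∑.∑-swap (allFin n) (allFin t) _ ⟩
    ∑ℕ (allFin t) (λ i → ∑ℕ (allFin n) (λ u → if does (u ≟ v) then 0 else bit (does (u ∈F? F i) ∧ does (v ∈F? F i))))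
      ≡⟨ Nat∑.∑-cong (allFin t) (λ i _ → perFace i) ⟩
    ∑ℕ (allFin t) (λ i → bit (does (v ∈F? F i)) + bit (does (v ∈F? F i)))
      ≡⟨ Nat∑.∑-∙ (allFin t) _ _ ⟩
    count (λ i → does (v ∈F? F i)) + count (λ i → does (v ∈F? F i)) ∎
    where
    open ≡-Reasoning
    pull : ∀ b (g : Fin t → ℕ) → (if b then 0 else ∑ℕ (allFin t) g) ≡ ∑ℕ (allFin t) (λ i → if b then 0 else g i)
    pull true  g = sym (Nat∑.∑-ε (allFin t))
    pull false g = refl
    zeroes : ∀ b → (if b then 0 else 0) ≡ 0
    zeroes true  = refl
    zeroes false = refl
    perFace : ∀ i → ∑ℕ (allFin n) (λ u → if does (u ≟ v) then 0 else bit (does (u ∈F? F i) ∧ does (v ∈F? F i)))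
                    ≡ bit (does (v ∈F? F i)) + bit (does (v ∈F? F i))
    perFace i = byCases (does (v ∈F? F i)) ∈-does
      where
      byCases : ∀ b → (b ≡ true → v ∈F F i) →
                ∑ℕ (allFin n) (λ u → if does (u ≟ v) then 0 else bit (does (u ∈F? F i) ∧ b)) ≡ bit b + bit b
      byCases true  v∈F = trans (Nat∑.∑-cong (allFin n) (λ u _ → cong (λ b → if does (u ≟ v) then 0 else bit b) (𝔽₂.*-identityʳ (does (u ∈F? F i)))))
                            (otherVertices (F i) (F-distinct i) v (v∈F refl))
      byCases false _   = trans (Nat∑.∑-cong (allFin n) (λ u _ → trans (cong (λ b → if does (u ≟ v) then 0 else bit b) (∧-zeroʳ (does (u ∈F? F i)))) (zeroes (does (u ≟ v)))))
                            (Nat∑.∑-ε (allFin n))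

  half : ∀ {a b} → a + a ≡ b + b → a ≡ b
  half {a} {b} eq = ℕ.*-cancelˡ-≡ a b 2 (trans (cong (λ y → a + y) (ℕ.+-identityʳ a)) (trans eq (sym (cong (λ y → b + y) (ℕ.+-identityʳ b)))))

  degreeCount : ∀ v → count (inWhite v) ≡ count (inBlack v)
  degreeCount v = half (trans (sym (handshake white white-distinct v)) (trans
    (Nat∑.∑-cong (allFin n) (λ u _ → pairs u)) (handshake black black-distinct v)))
    where
    pairs : ∀ u → (if does (u ≟ v) then 0 else count (λ i → inWhite u i ∧ inWhite v i)) ≡ (if does (u ≟ v) then 0 else count (λ j → inBlack u j ∧ inBlack v j))
    pairs u with u ≟ v
    ... | yes _  = refl
    ... | no u≢v = edgeCount u v u≢v

  commonFaces : ∀ u v → count (λ i → inWhite u i ∧ inWhite v i) ≡ count (λ j → inBlack u j ∧ inBlack v j)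
  commonFaces u v with u ≟ v
  ... | no u≢v   = edgeCount u v u≢v
  ... | yes refl = trans (Nat∑.∑-cong (allFin t) (λ i _ → cong bit (∧-idem (inWhite u i))))
                     (trans (degreeCount u) (sym (Nat∑.∑-cong (allFin t) (λ i _ → cong bit (∧-idem (inBlack u i))))))
    where open import Data.Bool.Properties using (∧-idem)

  incidence : Fin n → Fin (t + t) → Bool
  incidence v x = [ inWhite v , inBlack v ]′ (splitAt t x)

  -- Two vertices share as many white faces as black ones, so mod 2 the
  -- incidence vectors of the vertices span a totally isotropic subspace.
  isotropic : Orthogonal incidence incidence
  isotropic u v = begin
    sum (λ x → incidence u x ∧ incidence v x)
      ≡⟨ sum-splitAt t (λ y → [ inWhite u , inBlack u ]′ y ∧ [ inWhite v , inBlack v ]′ y) ⟩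
    sum (λ i → inWhite u i ∧ inWhite v i) xor sum (λ j → inBlack u j ∧ inBlack v j)
      ≡⟨ cong₂ _xor_ (sum-odd (λ i → inWhite u i ∧ inWhite v i) id) (sum-odd (λ i → inBlack u i ∧ inBlack v i) id) ⟩
    odd (count (λ i → inWhite u i ∧ inWhite v i)) xor odd (count (λ j → inBlack u j ∧ inBlack v j))
      ≡⟨ cong (λ m → odd m xor odd (count (λ j → inBlack u j ∧ inBlack v j))) (commonFaces u v) ⟩
    odd (count (λ j → inBlack u j ∧ inBlack v j)) xor odd (count (λ j → inBlack u j ∧ inBlack v j))
      ≡⟨ xor-same (odd (count (λ j → inBlack u j ∧ inBlack v j))) ⟩
    false ∎
    where open ≡-Reasoning

  -- These labellings are the left kernel of `incidence`: every face has zero or two labels `true`.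
  Even : (Fin n → Bool) → Set
  Even φ = (∀ i → faceSum φ (white i) ≡ false) × (∀ j → faceSum φ (black j) ≡ false)

  -- Euler's formula enters here: 2n = 2t + 4, so the two nullities add up to at least 4 and one of
  -- them is at least 2.
  twoDependencies : ∃[ a ] Dependencies incidence (2 + a)
  twoDependencies with dependencyBound incidence incidence isotropic
  ... | a , b , D , E , le = choose D E (ℕ.+-cancelʳ-≤ (t + t) 4 (a + b) (subst (_≤ a + b + (t + t)) 2n≡ le))
    where
    2n≡ : n + n ≡ 4 + (t + t)
    2n≡ = trans (cong (λ k → k + k) (trans euler (ℕ.+-comm t 2))) (cong (λ y → 2 + y) (trans (ℕ.+-suc t (suc t)) (cong suc (ℕ.+-suc t t))))
    choose : ∀ {a b} → Dependencies incidence a → Dependencies incidence b → 4 ≤ a + b → ∃[ a ] Dependencies incidence (2 + a)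
    choose {suc (suc a)} D _ _ = a , D
    choose {0} {suc (suc b)} _ E _ = b , E
    choose {1} {suc (suc b)} _ E _ = b , E
    choose {0} {1} _ _ (s≤s ())
    choose {1} {0} _ _ (s≤s ())
    choose {1} {1} _ _ (s≤s (s≤s ()))

  vanishesNearby : ∀ {φ} → Even φ → ∀ {u v w} → u ≢ v → u ≢ w → v ≢ w → InFace3 u v w → φ u ≡ false → φ v ≡ false → φ w ≡ false
  vanishesNearby {φ} (evenW , evenB) {u} {v} {w} u≢v u≢w v≢w in3 φu φv =
    trans (sym (cong₂ (λ a b → a xor (b xor φ w)) φu φv)) (total in3)
    where
    total : InFace3 u v w → φ u xor (φ v xor φ w) ≡ false
    total (inj₁ (i , u∈ , v∈ , w∈)) = trans (sym (faceSum-permute φ (white i) u≢v v≢w u≢w u∈ v∈ w∈)) (evenW i)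
    total (inj₂ (j , u∈ , v∈ , w∈)) = trans (sym (faceSum-permute φ (black j) u≢v v≢w u≢w u∈ v∈ w∈)) (evenB j)

  Adj-sym : ∀ {u v} → Adj u v → Adj v u
  Adj-sym (u≢v , inj₁ (i , u∈ , v∈)) = ≢-sym u≢v , inj₁ (i , v∈ , u∈)
  Adj-sym (u≢v , inj₂ (j , u∈ , v∈)) = ≢-sym u≢v , inj₂ (j , v∈ , u∈)

  -- Link connectivity carries a property of edges around a vertex, symmetry hands it to the other
  -- end, and connectivity of the graph does the rest.
  spreadEdges : (Q : Fin n → Fin n → Set) → (∀ {u v} → Q u v → Q v u) →
                (∀ {x u w} → LinkAdj x u w → Q x u → Q x w) →
                ∀ {u v} → Adj u v → Q u v → ∀ {x y} → Adj x y → Q x y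
  spreadEdges Q Q-sym step {u} {v} uv Quv {x} {y} xy = along (connected u x) (v , uv , Quv) xy
    where
    around : ∀ {x u w} → Star (LinkAdj x) u w → Q x u → Q x w
    around stop     q = q
    around (l ◅ ls) q = around ls (step l q)
    along : ∀ {u x} → Star Adj u x → (∃[ v ] Adj u v × Q u v) → ∀ {y} → Adj x y → Q x y
    along stop (v , uv , q) xy = around (link-connected _ _ _ uv xy) q
    along (uw ◅ s) (v , uv , q) xy = along s (_ , Adj-sym uw , Q-sym (around (link-connected _ _ _ uv uw) q)) xy

  hasNeighbour : ∀ v → ∃[ u ] Adj v u
  hasNeighbour v with covered v
  ... | inj₁ (i , v∈) = let u , u∈ , v≢u = otherVertex (white i) (white-distinct i) v∈ in u , v≢u , inj₁ (i , v∈ , u∈)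
  ... | inj₂ (j , v∈) = let u , u∈ , v≢u = otherVertex (black j) (black-distinct j) v∈ in u , v≢u , inj₂ (j , v∈ , u∈)

  -- An even labelling is determined by its values on one edge, since on every face two labels force
  -- the third.
  vanishesEverywhere : ∀ {φ} → Even φ → ∀ {u v} → Adj u v → φ u ≡ false → φ v ≡ false → ∀ x → φ x ≡ false
  vanishesEverywhere {φ} even uv φu φv x = proj₁ (spreadEdges (λ u v → φ u ≡ false × φ v ≡ false) (λ (p , q) → q , p)
    (λ (x≢u , x≢w , u≢w , in3) (φx , φu) → φx , vanishesNearby even x≢u x≢w u≢w in3 φx φu) uv (φu , φv) (proj₂ (hasNeighbour x)))

  -- By `vanishesEverywhere`, no nonzero combination of two independent even labellings is zero at
  -- both ends of an edge. So the value pairs at the two ends form an invertible matrix: they are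
  -- nonzero and different. The three nonzero vectors of 𝔽₂² are the colours.
  colouring : Σ (Fin n → Fin 3) λ κ → ∀ {u v} → Adj u v → κ u ≢ κ v
  colouring with twoDependencies
  ... | a , D = (λ v → colour (φ₁ v) (φ₂ v)) , proper
    where
    open Dependencies D
    φ₁ φ₂ φ₃ : Fin n → Bool
    φ₁ = rows 0F
    φ₂ = rows 1F
    φ₃ v = φ₁ v xor φ₂ v
    even : ∀ s → Even (rows s)
    even s = (λ i → trans (sym (sum-face (rows s) (white i) (white-distinct i)))
                (trans (sym (sum-cong-≗ (λ v → cong (λ y → rows s v ∧ [ inWhite v , inBlack v ]′ y) (splitAt-↑ˡ t i t)))) (annihilates s (i ↑ˡ t))))
           , (λ j → trans (sym (sum-face (rows s) (black j) (black-distinct j)))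
                (trans (sym (sum-cong-≗ (λ v → cong (λ y → rows s v ∧ [ inWhite v , inBlack v ]′ y) (splitAt-↑ʳ t t j)))) (annihilates s (t ↑ʳ j))))
    faceSum-xor : ∀ F → faceSum φ₃ F ≡ faceSum φ₁ F xor faceSum φ₂ F
    faceSum-xor (x , y , z) = trans (cong ((φ₁ x xor φ₂ x) xor_) (interchange (φ₁ y) (φ₂ y) (φ₁ z) (φ₂ z))) (interchange (φ₁ x) (φ₂ x) _ _)
      where open import Algebra.Properties.CommutativeSemigroup (CommutativeMonoid.commutativeSemigroup 𝔽₂.+-commutativeMonoid) using (interchange)
    even₃ : Even φ₃
    even₃ = (λ i → trans (faceSum-xor (white i)) (cong₂ _xor_ (proj₁ (even 0F) i) (proj₁ (even 1F) i)))
          , (λ j → trans (faceSum-xor (black j)) (cong₂ _xor_ (proj₂ (even 0F) j) (proj₂ (even 1F) j)))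
    unit : Bool → Bool → Fin (2 + a) → Bool
    unit p q 0F = p
    unit p q 1F = q
    unit p q (suc (suc _)) = false
    combination : ∀ p q v → sum (λ s → unit p q s ∧ rows s v) ≡ (p ∧ φ₁ v) xor (q ∧ φ₂ v)
    combination p q v = cong ((p ∧ φ₁ v) xor_) (trans (cong ((q ∧ φ₂ v) xor_) (sum-false {a} (λ _ → refl))) (𝔽₂.+-identityʳ _))
    nonzero : ∀ p q {s} → unit p q s ≡ true → ¬ (∀ v → (p ∧ φ₁ v) xor (q ∧ φ₂ v) ≡ false)
    nonzero p q {s} us zeroes = contradiction (trans (sym us) (independent (unit p q) (λ v → trans (combination p q v) (zeroes v)) s)) λ ()
    colour : Bool → Bool → Fin 3
    colour true  false = 0F
    colour false true  = 1F
    colour true  true  = 2F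
    -- A default; this pair never occurs at an end of an edge.
    colour false false = 0F
    proper : ∀ {u v} → Adj u v → colour (φ₁ u) (φ₂ u) ≢ colour (φ₁ v) (φ₂ v)
    proper {u} {v} uv = table _ _ _ _
      (λ p q → nonzero true false {0F} refl (λ x → trans (𝔽₂.+-identityʳ (φ₁ x)) (vanishesEverywhere (even 0F) uv p q x)))
      (λ p q → nonzero false true {1F} refl (vanishesEverywhere (even 1F) uv p q))
      (λ p q → nonzero true true {0F} refl (vanishesEverywhere even₃ uv p q))
      where
      table : ∀ x y x′ y′ → (x ≡ false → x′ ≡ false → ⊥) → (y ≡ false → y′ ≡ false → ⊥) →
              (x xor y ≡ false → x′ xor y′ ≡ false → ⊥) → colour x y ≢ colour x′ y′
      table true  true  true  true  _ _ h _ = h refl refl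
      table true  true  true  false _ _ _ ()
      table true  true  false true  _ _ _ ()
      table true  true  false false _ _ h _ = h refl refl
      table true  false true  true  _ _ _ ()
      table true  false true  false _ h _ _ = h refl refl
      table true  false false true  _ _ _ ()
      table true  false false false _ h _ _ = h refl refl
      table false true  true  true  _ _ _ ()
      table false true  true  false _ _ _ ()
      table false true  false true  h _ _ _ = h refl refl
      table false true  false false h _ _ _ = h refl refl
      table false false true  true  _ _ h _ = h refl refl
      table false false true  false _ h _ _ = h refl refl
      table false false false true  h _ _ _ = h refl refl
      table false false false false h _ _ _ = h refl refl

-- The two faces at an edge of a 3-coloured triangulation

-- w k i and b k j are the vertices of colour k; α k sends a black face to the
-- white face sharing its edge opposite colour k.
record Trade (t n : ℕ) : Set₁ where
  field
    white    : Fin t → Face n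
    w b      : Fin 3 → Fin t → Fin n
    w∈       : ∀ k i → w k i ∈F white i
    κ        : Fin n → Fin 3
    κ-w      : ∀ k i → κ (w k i) ≡ k
    κ-b      : ∀ k j → κ (b k j) ≡ k
    w-unique : ∀ {k l i i′} → k ≢ l → w k i ≡ w k i′ → w l i ≡ w l i′ → i ≡ i′
    b-unique : ∀ {k l j j′} → k ≢ l → b k j ≡ b k j′ → b l j ≡ b l j′ → j ≡ j′
    α α⁻¹    : Fin 3 → Fin t → Fin t
    α-edge   : ∀ {k l} → k ≢ l → ∀ j → w l (α k j) ≡ b l j
    α⁻¹-edge : ∀ {k l} → k ≢ l → ∀ i → b l (α⁻¹ k i) ≡ w l i
    cover    : ∀ v → ∃[ j ] b (κ v) j ≡ v
    -- Two white faces count as neighbours when they share edges with a common black face.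
    connected : (P : Fin t → Set) → (∀ j k l → P (α k j) → P (α l j)) → ∀ {i i′} → P i → P i′

next : Fin 3 → Fin 3
next 0F = 1F
next 1F = 2F
next 2F = 0F

next≢ : ∀ k → k ≢ next k
next≢ = from-yes (all? λ k → ¬? (k ≟ next k))

next²≢ : ∀ k → k ≢ next (next k)
next²≢ = from-yes (all? λ k → ¬? (k ≟ next (next k)))

nextCases : ∀ {k l} → k ≢ l → l ≡ next k ⊎ l ≡ next (next k)
nextCases {k} {l} = from-yes (all? λ k → all? λ l → ¬? (k ≟ l) →-dec ((l ≟ next k) ⊎-dec (l ≟ next (next k)))) k l

lastColour : ∀ (x y z k : Fin 3) → x ≢ y → y ≢ z → x ≢ z → x ≢ k → y ≢ k → z ≡ k
lastColour = from-yes (all? λ (x : Fin 3) → all? λ (y : Fin 3) → all? λ (z : Fin 3) → all? λ (k : Fin 3) →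
  ¬? (x ≟ y) →-dec (¬? (y ≟ z) →-dec (¬? (x ≟ z) →-dec (¬? (x ≟ k) →-dec (¬? (y ≟ k) →-dec (z ≟ k))))))

third : (p q : Fin 3) → p ≢ q → Σ (Fin 3) λ k → k ≢ p × k ≢ q
third = from-yes (all? λ (p : Fin 3) → all? λ (q : Fin 3) → ¬? (p ≟ q) →-dec any? λ (k : Fin 3) → ¬? (k ≟ p) ×-dec ¬? (k ≟ q))

module Pick {n : ℕ} (κ : Fin n → Fin 3) where

  Rainbow : Face n → Set
  Rainbow (a , b , c) = κ a ≢ κ b × κ b ≢ κ c × κ a ≢ κ c

  pick : ∀ k F → Rainbow F → ∃[ v ] v ∈F F × κ v ≡ k
  pick k (a , b , c) (a≢b , b≢c , a≢c) with κ a ≟ k | κ b ≟ k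
  ... | yes eq | _      = a , inj₁ refl , eq
  ... | no _   | yes eq = b , inj₂ (inj₁ refl) , eq
  ... | no a≢  | no b≢  = c , inj₂ (inj₂ refl) , lastColour (κ a) (κ b) (κ c) k a≢b b≢c a≢c a≢ b≢

  κ-injective : ∀ F → Rainbow F → ∀ {u v} → u ∈F F → v ∈F F → κ u ≡ κ v → u ≡ v
  κ-injective F (a≢b , b≢c , a≢c) (inj₁ refl) (inj₁ refl) eq = refl
  κ-injective F (a≢b , b≢c , a≢c) (inj₁ refl) (inj₂ (inj₁ refl)) eq = contradiction eq a≢b
  κ-injective F (a≢b , b≢c , a≢c) (inj₁ refl) (inj₂ (inj₂ refl)) eq = contradiction eq a≢c
  κ-injective F (a≢b , b≢c , a≢c) (inj₂ (inj₁ refl)) (inj₁ refl) eq = contradiction (sym eq) a≢b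
  κ-injective F (a≢b , b≢c , a≢c) (inj₂ (inj₁ refl)) (inj₂ (inj₁ refl)) eq = refl
  κ-injective F (a≢b , b≢c , a≢c) (inj₂ (inj₁ refl)) (inj₂ (inj₂ refl)) eq = contradiction eq b≢c
  κ-injective F (a≢b , b≢c , a≢c) (inj₂ (inj₂ refl)) (inj₁ refl) eq = contradiction (sym eq) a≢c
  κ-injective F (a≢b , b≢c , a≢c) (inj₂ (inj₂ refl)) (inj₂ (inj₁ refl)) eq = contradiction (sym eq) b≢c
  κ-injective F (a≢b , b≢c , a≢c) (inj₂ (inj₂ refl)) (inj₂ (inj₂ refl)) eq = refl

module FromColouring {t : ℕ} (T : Triangulation t) (κ : Fin (Triangulation.n T) → Fin 3)
  (κ-proper : ∀ {u v} → Triangulation.Adj T u v → κ u ≢ κ v) where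

  open Triangulation T
  open Spherical T using (spreadEdges; hasNeighbour)
  open Pick κ

  private
    white-rainbow : ∀ i → Rainbow (white i)
    white-rainbow i = let (a≢b , b≢c , a≢c) = white-distinct i
                          A = inj₁ refl; B = inj₂ (inj₁ refl); C = inj₂ (inj₂ refl) in
      κ-proper (a≢b , inj₁ (i , A , B)) , κ-proper (b≢c , inj₁ (i , B , C)) , κ-proper (a≢c , inj₁ (i , A , C))

    black-rainbow : ∀ j → Rainbow (black j)
    black-rainbow j = let (a≢b , b≢c , a≢c) = black-distinct j
                          A = inj₁ refl; B = inj₂ (inj₁ refl); C = inj₂ (inj₂ refl) in
      κ-proper (a≢b , inj₂ (j , A , B)) , κ-proper (b≢c , inj₂ (j , B , C)) , κ-proper (a≢c , inj₂ (j , A , C))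

  w : Fin 3 → Fin t → Fin n
  w k i = proj₁ (pick k (white i) (white-rainbow i))

  b : Fin 3 → Fin t → Fin n
  b k j = proj₁ (pick k (black j) (black-rainbow j))

  w∈ : ∀ k i → w k i ∈F white i
  w∈ k i = proj₁ (proj₂ (pick k (white i) (white-rainbow i)))

  b∈ : ∀ k j → b k j ∈F black j
  b∈ k j = proj₁ (proj₂ (pick k (black j) (black-rainbow j)))

  private
    κ-w : ∀ k i → κ (w k i) ≡ k
    κ-w k i = proj₂ (proj₂ (pick k (white i) (white-rainbow i)))

    κ-b : ∀ k j → κ (b k j) ≡ k
    κ-b k j = proj₂ (proj₂ (pick k (black j) (black-rainbow j)))

    w-only : ∀ {v i} → v ∈F white i → w (κ v) i ≡ v
    w-only {v} {i} v∈ = κ-injective (white i) (white-rainbow i) (w∈ (κ v) i) v∈ (κ-w (κ v) i)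

    b-only : ∀ {v j} → v ∈F black j → b (κ v) j ≡ v
    b-only {v} {j} v∈ = κ-injective (black j) (black-rainbow j) (b∈ (κ v) j) v∈ (κ-b (κ v) j)

    w-distinct : ∀ {k l} → k ≢ l → ∀ i → w k i ≢ w l i
    w-distinct k≢l i eq = k≢l (trans (sym (κ-w _ i)) (trans (cong κ eq) (κ-w _ i)))

    b-distinct : ∀ {k l} → k ≢ l → ∀ i → b k i ≢ b l i
    b-distinct k≢l i eq = k≢l (trans (sym (κ-b _ i)) (trans (cong κ eq) (κ-b _ i)))

    next≢next² : ∀ k → next k ≢ next (next k)
    next≢next² k = next≢ (next k)

    across : ∀ k j → Σ (Fin t) λ i → b (next k) j ∈F white i × b (next (next k)) j ∈F white i
    across k j = edge-bw _ _ (b-distinct (next≢next² k) j) (j , b∈ _ j , b∈ _ j)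

    across⁻¹ : ∀ k i → Σ (Fin t) λ j → w (next k) i ∈F black j × w (next (next k)) i ∈F black j
    across⁻¹ k i = edge-wb _ _ (w-distinct (next≢next² k) i) (i , w∈ _ i , w∈ _ i)

    α-edge : ∀ {k l} → k ≢ l → ∀ j → w l (proj₁ (across k j)) ≡ b l j
    α-edge {k} {l} k≢l j with nextCases k≢l
    ... | inj₁ refl = trans (cong (λ m → w m (proj₁ (across k j))) (sym (κ-b l j))) (w-only (proj₁ (proj₂ (across k j))))
    ... | inj₂ refl = trans (cong (λ m → w m (proj₁ (across k j))) (sym (κ-b l j))) (w-only (proj₂ (proj₂ (across k j))))

    α⁻¹-edge : ∀ {k l} → k ≢ l → ∀ i → b l (proj₁ (across⁻¹ k i)) ≡ w l i
    α⁻¹-edge {k} {l} k≢l i with nextCases k≢l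
    ... | inj₁ refl = trans (cong (λ m → b m (proj₁ (across⁻¹ k i))) (sym (κ-w l i))) (b-only (proj₁ (proj₂ (across⁻¹ k i))))
    ... | inj₂ refl = trans (cong (λ m → b m (proj₁ (across⁻¹ k i))) (sym (κ-w l i))) (b-only (proj₂ (proj₂ (across⁻¹ k i))))

    α : Fin 3 → Fin t → Fin t
    α k j = proj₁ (across k j)

    -- The ends of an edge miss exactly one colour, and `α` of that colour crosses the edge.
    white-of-edge : ∀ {u v j i} → u ≢ v → u ∈F black j → v ∈F black j → u ∈F white i → v ∈F white i → ∃[ k ] i ≡ α k j
    white-of-edge {u} {v} {j} {i} u≢v u∈j v∈j u∈i v∈i = k ,
      white-unique u v i (α k j) u≢v u∈i v∈i
        (subst (_∈F white (α k j)) (trans (α-edge k≢u j) (b-only u∈j)) (w∈ _ _))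
        (subst (_∈F white (α k j)) (trans (α-edge k≢v j) (b-only v∈j)) (w∈ _ _))
      where
      missing = third (κ u) (κ v) (λ eq → u≢v (κ-injective (black j) (black-rainbow j) u∈j v∈j eq))
      k = proj₁ missing
      k≢u = proj₁ (proj₂ missing)
      k≢v = proj₂ (proj₂ missing)

    faces-connected : (P : Fin t → Set) → (∀ j k l → P (α k j) → P (α l j)) → ∀ {i i′} → P i → P i′
    faces-connected P step {i} {i′} Pi =
      spreadEdges Q (λ q i u∈ v∈ → q i v∈ u∈) around (edge i) (λ i″ u∈ v∈ → subst P (white-unique _ _ _ _ (w-distinct {0F} {1F} (λ ()) i) (w∈ 0F i) (w∈ 1F i) u∈ v∈) Pi)
        (edge i′) i′ (w∈ 0F i′) (w∈ 1F i′)
      where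
      -- The property is moved to edges. Around a vertex, two edges of a white face carry that same
      -- face, and two edges of a black face `j` carry white faces of the form `α k j` and `α l j`.
      Q : Fin n → Fin n → Set
      Q u v = ∀ i → u ∈F white i → v ∈F white i → P i
      edge : ∀ i → Adj (w 0F i) (w 1F i)
      edge i = w-distinct {0F} {1F} (λ ()) i , inj₁ (i , w∈ 0F i , w∈ 1F i)
      around : ∀ {x u v} → LinkAdj x u v → Q x u → Q x v
      around (x≢u , x≢v , u≢v , inj₁ (i , x∈ , u∈ , v∈)) q i″ x∈″ v∈″ =
        subst P (white-unique _ _ _ _ x≢v x∈ v∈ x∈″ v∈″) (q i x∈ u∈)
      around {x} {u} {v} (x≢u , x≢v , u≢v , inj₂ (j , x∈ , u∈ , v∈)) q i″ x∈″ v∈″ =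
        let i , x∈i , u∈i = edge-bw x u x≢u (j , x∈ , u∈)
            k , i≡ = white-of-edge x≢u x∈ u∈ x∈i u∈i
            l , i″≡ = white-of-edge x≢v x∈ v∈ x∈″ v∈″
        in subst P (sym i″≡) (step j k l (subst P i≡ (q i x∈i u∈i)))

    onBlack : ∀ v → ∃[ j ] v ∈F black j
    onBlack v with hasNeighbour v
    ... | u , v≢u , inj₁ e = let j , v∈ , _ = edge-wb v u v≢u e in j , v∈
    ... | u , v≢u , inj₂ (j , v∈ , _) = j , v∈

  trade : Trade t n
  trade = record
    { white = white ; w = w ; b = b ; w∈ = w∈ ; κ = κ ; κ-w = κ-w ; κ-b = κ-b
    ; w-unique = λ {k} {l} {i} {i′} k≢l p q → white-unique (w k i) (w l i) i i′ (w-distinct k≢l i) (w∈ k i) (w∈ l i)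
        (subst (_∈F white i′) (sym p) (w∈ k i′)) (subst (_∈F white i′) (sym q) (w∈ l i′))
    ; b-unique = λ {k} {l} {j} {j′} k≢l p q → black-unique (b k j) (b l j) j j′ (b-distinct k≢l j) (b∈ k j) (b∈ l j)
        (subst (_∈F black j′) (sym p) (b∈ k j′)) (subst (_∈F black j′) (sym q) (b∈ l j′))
    ; α = α ; α⁻¹ = λ k i → proj₁ (across⁻¹ k i) ; α-edge = α-edge ; α⁻¹-edge = α⁻¹-edge
    ; cover = λ v → let j , v∈ = onBlack v in j , b-only v∈
    ; connected = faces-connected
    }

tradeOf : ∀ {t} (T : Triangulation t) → Trade t (Triangulation.n T)
tradeOf T = FromColouring.trade T (proj₁ (Spherical.colouring T)) (proj₂ (Spherical.colouring T))

-- Digraphs whose arcs circulate around hubs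

module Int∑ = ListSum ℤ.+-0-commutativeMonoid

∑ᶻ-mono : ∀ {A : Set} (l : List A) {f g : A → ℤ} → (∀ x → x ∈ l → f x ≤ᶻ g x) → Int∑.∑ l f ≤ᶻ Int∑.∑ l g
∑ᶻ-mono []      f≤g = ℤ.≤-refl
∑ᶻ-mono (x ∷ l) f≤g = ℤ.+-mono-≤ (f≤g x (here refl)) (∑ᶻ-mono l (λ y y∈ → f≤g y (there y∈)))

∑ᶻ-nonneg : ∀ {A : Set} (l : List A) {f : A → ℤ} → (∀ x → x ∈ l → 0ℤ ≤ᶻ f x) → 0ℤ ≤ᶻ Int∑.∑ l f
∑ᶻ-nonneg l {f} 0≤f = subst (_≤ᶻ Int∑.∑ l f) (Int∑.∑-ε l) (∑ᶻ-mono l 0≤f)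

∑ᶻ-term : ∀ {A : Set} {l : List A} {f : A → ℤ} {j} → j ∈ l → (∀ x → x ∈ l → 0ℤ ≤ᶻ f x) → f j ≤ᶻ Int∑.∑ l f
∑ᶻ-term {l = x ∷ l} {f} (here refl) 0≤f =
  subst (_≤ᶻ f x +ᶻ Int∑.∑ l f) (ℤ.+-identityʳ (f x)) (ℤ.+-monoʳ-≤ (f x) (∑ᶻ-nonneg l (λ y y∈ → 0≤f y (there y∈))))
∑ᶻ-term {l = x ∷ l} {f} {j} (there j∈) 0≤f =
  subst (_≤ᶻ f x +ᶻ Int∑.∑ l f) (ℤ.+-identityˡ (f j)) (ℤ.+-mono-≤ (0≤f x (here refl)) (∑ᶻ-term j∈ (λ y y∈ → 0≤f y (there y∈))))

∑ᶻ-const : ∀ {A : Set} (l : List A) (c : ℤ) → Int∑.∑ l (λ _ → c) ≡ + length l *ᶻ c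
∑ᶻ-const []      c = sym (ℤ.*-zeroˡ c)
∑ᶻ-const (x ∷ l) c = trans (cong (c +ᶻ_) (∑ᶻ-const l c)) (sym (ℤ.suc-* (+ length l) c))

∑ᶻ-* : ∀ {A : Set} (l : List A) (c : ℤ) (f : A → ℤ) → Int∑.∑ l (λ x → c *ᶻ f x) ≡ c *ᶻ Int∑.∑ l f
∑ᶻ-* []      c f = sym (ℤ.*-zeroʳ c)
∑ᶻ-* (x ∷ l) c f = trans (cong (c *ᶻ f x +ᶻ_) (∑ᶻ-* l c f)) (sym (ℤ.*-distribˡ-+ c (f x) _))

-- Only differences of potentials matter; adding the sum of all absolute values, plus one, makes
-- them positive.
shiftToℕ : ∀ {k} (F : Fin k → ℤ) → ∃[ F̂ ] ∃[ C ] (∀ x → + (F̂ x) ≡ F x +ᶻ C × 1 ≤ F̂ x)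
shiftToℕ {k} F = (λ x → suc ℤ.∣ F x +ᶻ B ∣) , B +ᶻ 1ℤ , λ x →
  trans (cong (1ℤ +ᶻ_) (ℤ.0≤i⇒+∣i∣≡i (nonneg x))) (arith (F x) B) , s≤s z≤n
  where
  B : ℤ
  B = Int∑.∑ (allFin k) (λ x → + ℤ.∣ F x ∣)
  arith : ∀ a b → 1ℤ +ᶻ (a +ᶻ b) ≡ a +ᶻ (b +ᶻ 1ℤ)
  arith = solve-∀ᶻ
  cancel : ∀ a → 0ℤ ≤ᶻ a +ᶻ + ℤ.∣ a ∣
  cancel (+ a) = ℤ.+≤+ z≤n
  cancel (ℤ.-[1+ a ]) = ℤ.≤-reflexive (sym (ℤ.+-inverseˡ (+ suc a)))
  nonneg : ∀ x → 0ℤ ≤ᶻ F x +ᶻ B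
  nonneg x = ℤ.≤-trans (cancel (F x)) (ℤ.+-monoʳ-≤ (F x) (∑ᶻ-term (∈-allFin x) (λ _ _ → ℤ.+≤+ z≤n)))

module Orbits {t : ℕ} (τ τ⁻¹ : Fin t → Fin t) (τ⁻¹∘τ : ∀ j → τ⁻¹ (τ j) ≡ j) where

  power : ℕ → Fin t → Fin t
  power zero    j = j
  power (suc k) j = τ (power k j)

  power-cancel : ∀ k d {j} → power k j ≡ power (k + d) j → j ≡ power d j
  power-cancel zero    d eq = eq
  power-cancel (suc k) d eq = power-cancel k d (trans (sym (τ⁻¹∘τ _)) (trans (cong τ⁻¹ eq) (τ⁻¹∘τ _)))

  -- Some positive power of a permutation of a finite set fixes `j`, so further steps from `τ j`
  -- lead back to `j`.
  closed-backwards : (Q : Fin t → Set) → (∀ j → Q j → Q (τ j)) → ∀ j → Q (τ j) → Q j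
  closed-backwards Q step j q with pigeonhole (ℕ.n<1+n t) (λ i → power (toℕ i) j)
  ... | i , i′ , i<i′ , eq = subst Q (sym (power-cancel (toℕ i) (suc d) (trans eq (cong (λ k → power k j) i′≡)))) (forward d)
    where
    d = toℕ i′ ∸ suc (toℕ i)
    i′≡ : toℕ i′ ≡ toℕ i + suc d
    i′≡ = trans (sym (ℕ.m+[n∸m]≡n i<i′)) (sym (ℕ.+-suc (toℕ i) d))
    forward : ∀ d → Q (power (suc d) j)
    forward zero    = q
    forward (suc d) = step _ (forward d)

before : ∀ {t} → List (Fin t) → Fin t → List (Fin t)
before []      j = []
before (x ∷ l) j with x ≟ j
... | yes _ = []
... | no _  = x ∷ before l j

before-head : ∀ {t} (x : Fin t) l → before (x ∷ l) x ≡ []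
before-head x l with x ≟ x
... | yes _  = refl
... | no x≢x = contradiction refl x≢x

before-tail : ∀ {t} {x j : Fin t} l → x ≢ j → before (x ∷ l) j ≡ x ∷ before l j
before-tail {x = x} {j} l x≢j with x ≟ j
... | yes x≡j = contradiction x≡j x≢j
... | no _    = refl

successor? : ∀ {t} {j : Fin t} (l : List (Fin t)) → Unique l → j ∈ l →
             (∃[ k ] k ∈ l × before l k ≡ before l j ++ j ∷ []) ⊎ l ≡ before l j ++ j ∷ []
successor? {j = j} (x ∷ l) (x∉ ∷ u) j∈ with x ≟ j
successor? (x ∷ [])    (x∉ ∷ u) j∈ | yes refl = inj₂ refl
successor? (x ∷ y ∷ l) (x∉ ∷ u) j∈ | yes refl =
  inj₁ (y , there (here refl) , trans (before-tail (y ∷ l) (All.lookup x∉ (here refl))) (cong (x ∷_) (before-head y l)))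
successor? (x ∷ l) (x∉ ∷ u) (here eq)  | no x≢j = contradiction (sym eq) x≢j
successor? (x ∷ l) (x∉ ∷ u) (there j∈) | no x≢j with successor? l u j∈
... | inj₁ (k , k∈ , eq) = inj₁ (k , there k∈ , trans (before-tail l (All.lookup x∉ k∈)) (cong (x ∷_) eq))
... | inj₂ eq = inj₂ (cong (x ∷_) eq)

-- The second alternative is the wrap from the last element to the first: the prefix starts afresh
-- just when it would become the whole list.
cyclicSuccessor : ∀ {t} {j : Fin t} (l : List (Fin t)) → Unique l → j ∈ l →
  ∃[ k ] k ∈ l × (before l k ≡ before l j ++ j ∷ [] ⊎ (before l k ≡ [] × l ≡ before l j ++ j ∷ []))
cyclicSuccessor (x ∷ l) u j∈ with successor? (x ∷ l) u j∈
... | inj₁ (k , k∈ , eq) = k , k∈ , inj₁ eq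
... | inj₂ eq = x , here refl , inj₂ (before-head x l , eq)

-- `τ` follows the circuit around a hub: `τ j` leaves the head of `j` on the same hub. By `simple` a
-- hub uses a vertex at most once, so its arcs sit on different rotors. `connected` is weak
-- connectivity.
record HubDigraph (t n : ℕ) : Set₁ where
  field
    tail head hub : Fin t → Fin n
    τ τ⁻¹         : Fin t → Fin t
    τ⁻¹∘τ         : ∀ j → τ⁻¹ (τ j) ≡ j
    τ∘τ⁻¹         : ∀ j → τ (τ⁻¹ j) ≡ j
    tail-τ        : ∀ j → tail (τ j) ≡ head j
    hub-τ         : ∀ j → hub (τ j) ≡ hub j
    simple        : ∀ {j j′} → tail j ≡ tail j′ → hub j ≡ hub j′ → j ≡ j′
    connected     : (P : Fin n → Set) → (∀ j → P (tail j) → P (head j)) → (∀ j → P (head j) → P (tail j)) →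
                    ∀ {i j} → P (tail i) → P (tail j)

  arcsAt arcsOn : Fin n → List (Fin t)
  arcsAt v = filter (λ j → tail j ≟ v) (allFin t)
  arcsOn c = filter (λ j → hub j ≟ c) (allFin t)

  ∈-arcsAt : ∀ j → j ∈ arcsAt (tail j)
  ∈-arcsAt j = ∈-filter⁺ (λ j′ → tail j′ ≟ tail j) (∈-allFin j) refl

  arcsAt-tail : ∀ {v j} → j ∈ arcsAt v → tail j ≡ v
  arcsAt-tail {v} j∈ = proj₂ (∈-filter⁻ (λ j′ → tail j′ ≟ v) {xs = allFin t} j∈)

  ∈-arcsOn : ∀ j → j ∈ arcsOn (hub j)
  ∈-arcsOn j = ∈-filter⁺ (λ j′ → hub j′ ≟ hub j) (∈-allFin j) refl

  arcsOn-hub : ∀ {c j} → j ∈ arcsOn c → hub j ≡ c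
  arcsOn-hub {c} j∈ = proj₂ (∈-filter⁻ (λ j′ → hub j′ ≟ c) {xs = allFin t} j∈)

  arcsAt-unique : ∀ v → Unique (arcsAt v)
  arcsAt-unique v = filter⁺ (λ j → tail j ≟ v) (allFin⁺ t)

  arcsOn-unique : ∀ v → Unique (arcsOn v)
  arcsOn-unique v = filter⁺ (λ j → hub j ≟ v) (allFin⁺ t)

  -- `τ` permutes the arcs, so a set of tails closed along arcs is closed against them too: weak
  -- connectivity becomes strong.
  reachForwards : (P : Fin n → Set) → (∀ j → P (tail j) → P (head j)) → ∀ {i j} → P (tail i) → P (tail j)
  reachForwards P step = connected P step λ j → closed-backwards (P ∘ tail) (λ i p → subst P (sym (tail-τ i)) (step i p)) j ∘ subst P (sym (tail-τ j))
    where open Orbits τ τ⁻¹ τ⁻¹∘τ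

  reachBackwards : (P : Fin n → Set) → (∀ j → P (head j) → P (tail j)) → ∀ {i j} → P (tail i) → P (tail j)
  reachBackwards P step = connected P forwards step
    where
    open Orbits τ⁻¹ τ τ∘τ⁻¹
    back : ∀ i → P (tail i) → P (tail (τ⁻¹ i))
    back i p = step (τ⁻¹ i) (subst P (trans (cong tail (sym (τ∘τ⁻¹ i))) (tail-τ (τ⁻¹ i))) p)
    forwards : ∀ j → P (tail j) → P (head j)
    forwards j p = subst P (tail-τ j) (closed-backwards (P ∘ tail) back (τ j) (subst (P ∘ tail) (sym (τ⁻¹∘τ j)) p))

  module Potential (root : Fin n) where

    -- The Laplacian of the digraph, taken over outgoing arcs.
    L : (Fin n → ℤ) → Fin n → ℤ
    L g v = Int∑.∑ (arcsAt v) (λ j → g (tail j) -ᶻ g (head j))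

    Superharmonic : (Fin n → ℤ) → Set
    Superharmonic g = ∀ {v} → v ≢ root → 0ℤ ≤ᶻ L g v

    StrictAt : Fin n → Set
    StrictAt v = ∃[ g ] Superharmonic g × (v ≢ root → 1ℤ ≤ᶻ L g v)

    δ : Fin n → Fin n → ℤ
    δ u x = if does (x ≟ u) then 1ℤ else 0ℤ

    L-* : ∀ c g v → L (λ x → c *ᶻ g x) v ≡ c *ᶻ L g v
    L-* c g v = trans (Int∑.∑-cong (arcsAt v) (λ j _ → arith c (g (tail j)) (g (head j)))) (∑ᶻ-* (arcsAt v) c _)
      where
      arith : ∀ c x y → c *ᶻ x -ᶻ c *ᶻ y ≡ c *ᶻ (x -ᶻ y)
      arith = solve-∀ᶻ

    L-+ : ∀ f g v → L (λ x → f x +ᶻ g x) v ≡ L f v +ᶻ L g v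
    L-+ f g v = trans (Int∑.∑-cong (arcsAt v) (λ j _ → arith (f (tail j)) (g (tail j)) (f (head j)) (g (head j)))) (Int∑.∑-∙ (arcsAt v) _ _)
      where
      arith : ∀ a b c d → (a +ᶻ b) -ᶻ (c +ᶻ d) ≡ (a -ᶻ c) +ᶻ (b -ᶻ d)
      arith = solve-∀ᶻ

    *-nonneg : ∀ k {x} → 0ℤ ≤ᶻ x → 0ℤ ≤ᶻ + k *ᶻ x
    *-nonneg k {x} 0≤x = subst (_≤ᶻ + k *ᶻ x) (ℤ.*-zeroʳ (+ k)) (ℤ.*-monoˡ-≤-nonNeg (+ k) 0≤x)

    -- Firing the head u once after scaling by its degree: u keeps a
    -- nonnegative value and every vertex with an arc to u gains.
    strictAt-tail : ∀ j → StrictAt (head j) → StrictAt (tail j)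
    strictAt-tail j (g , sup , strict) with tail j ≟ head j
    ... | yes eq = g , sup , λ tail≢ → subst (λ v → 1ℤ ≤ᶻ L g v) (sym eq) (strict (tail≢ ∘ trans eq))
    ... | no tail≢head = g′ , sup′ , strict′
      where
      u = head j
      d = length (arcsAt u)
      g′ : Fin n → ℤ
      g′ x = + d *ᶻ g x +ᶻ -ᶻ δ u x
      L′ : ∀ v → L g′ v ≡ + d *ᶻ L g v +ᶻ L (λ x → -ᶻ δ u x) v
      L′ v = trans (L-+ (λ x → + d *ᶻ g x) (λ x → -ᶻ δ u x) v) (cong (_+ᶻ L (λ x → -ᶻ δ u x) v) (L-* (+ d) g v))
      δ≤1 : ∀ x → δ u x ≤ᶻ 1ℤ
      δ≤1 x with does (x ≟ u)
      ... | true  = ℤ.≤-refl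
      ... | false = ℤ.+≤+ z≤n
      0≤δ : ∀ x → 0ℤ ≤ᶻ δ u x
      0≤δ x with does (x ≟ u)
      ... | true  = ℤ.+≤+ z≤n
      ... | false = ℤ.≤-refl
      δ-off : ∀ {x} → x ≢ u → δ u x ≡ 0ℤ
      δ-off {x} x≢u with x ≟ u
      ... | yes x≡u = contradiction x≡u x≢u
      ... | no _    = refl
      δ-on : δ u u ≡ 1ℤ
      δ-on with u ≟ u
      ... | yes _  = refl
      ... | no u≢u = contradiction refl u≢u
      term-off : ∀ {v i} → v ≢ u → i ∈ arcsAt v → (-ᶻ δ u (tail i)) -ᶻ (-ᶻ δ u (head i)) ≡ δ u (head i)
      term-off {i = i} v≢u i∈ = trans (cong (λ a → (-ᶻ a) -ᶻ (-ᶻ δ u (head i))) (δ-off (λ eq → v≢u (trans (sym (arcsAt-tail i∈)) eq)))) (arith (δ u (head i)))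
        where
        arith : ∀ x → (-ᶻ 0ℤ) -ᶻ (-ᶻ x) ≡ x
        arith = solve-∀ᶻ
      gain : ∀ {v} → v ≢ u → 0ℤ ≤ᶻ L (λ x → -ᶻ δ u x) v
      gain {v} v≢u = ∑ᶻ-nonneg (arcsAt v) λ i i∈ → subst (0ℤ ≤ᶻ_) (sym (term-off v≢u i∈)) (0≤δ (head i))
      loss : -ᶻ (+ d) ≤ᶻ L (λ x → -ᶻ δ u x) u
      loss = subst (_≤ᶻ L (λ x → -ᶻ δ u x) u) (trans (∑ᶻ-const (arcsAt u) (-ᶻ 1ℤ)) (arith (+ d)))
        (∑ᶻ-mono (arcsAt u) λ i i∈ → ℤ.≤-trans
          (subst (-ᶻ 1ℤ ≤ᶻ_) (sym (ℤ.+-identityʳ _)) (ℤ.neg-mono-≤ (δ≤1 (tail i))))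
          (ℤ.+-monoʳ-≤ (-ᶻ δ u (tail i)) (subst (0ℤ ≤ᶻ_) (sym (ℤ.neg-involutive _)) (0≤δ (head i)))))
        where
        arith : ∀ x → x *ᶻ (-ᶻ 1ℤ) ≡ -ᶻ x
        arith = solve-∀ᶻ
      sup′ : Superharmonic g′
      sup′ {v} v≢root with v ≟ u
      ... | no v≢u = subst (0ℤ ≤ᶻ_) (sym (L′ v)) (ℤ.+-mono-≤ (*-nonneg d (sup v≢root)) (gain v≢u))
      ... | yes refl = subst₂ _≤ᶻ_ (ℤ.+-inverseʳ (+ d)) (sym (L′ v))
              (ℤ.+-mono-≤ (subst (_≤ᶻ + d *ᶻ L g u) (ℤ.*-identityʳ (+ d)) (ℤ.*-monoˡ-≤-nonNeg (+ d) (strict v≢root))) loss)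
      strict′ : tail j ≢ root → 1ℤ ≤ᶻ L g′ (tail j)
      strict′ tail≢root = subst (1ℤ ≤ᶻ_) (sym (L′ (tail j)))
        (ℤ.+-mono-≤ (*-nonneg d (sup tail≢root))
          (subst (_≤ᶻ L (λ x → -ᶻ δ u x) (tail j)) (trans (term-off tail≢head (∈-arcsAt j)) δ-on)
            (∑ᶻ-term (∈-arcsAt j) λ i i∈ → subst (0ℤ ≤ᶻ_) (sym (term-off tail≢head i∈)) (0≤δ (head i)))))

    -- A sum of superharmonic functions is strict wherever one summand is.
    strictlySuperharmonic : (∀ j → StrictAt (tail j)) → ∃[ g ] (∀ j → tail j ≢ root → 1ℤ ≤ᶻ L g (tail j))
    strictlySuperharmonic strict = let g , _ , h = go (allFin t) in g , λ j → h j (∈-allFin j)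
      where
      go : ∀ l → ∃[ g ] Superharmonic g × (∀ j → j ∈ l → tail j ≢ root → 1ℤ ≤ᶻ L g (tail j))
      go [] = (λ _ → 0ℤ) , (λ {v} _ → ∑ᶻ-nonneg (arcsAt v) (λ _ _ → ℤ.≤-refl)) , λ _ ()
      go (i ∷ l) = let f , f-sup , f-strict = strict i
                       g , g-sup , g-strict = go l in
        (λ x → f x +ᶻ g x)
        , (λ {v} v≢ → subst (0ℤ ≤ᶻ_) (sym (L-+ f g v)) (ℤ.+-mono-≤ (f-sup v≢) (g-sup v≢)))
        , λ where
            j (here refl) j≢ → subst (1ℤ ≤ᶻ_) (sym (L-+ f g (tail j))) (ℤ.+-mono-≤ (f-strict j≢) (g-sup j≢))
            j (there j∈)  j≢ → subst (1ℤ ≤ᶻ_) (sym (L-+ f g (tail j))) (ℤ.+-mono-≤ (f-sup j≢) (g-strict j j∈ j≢))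

-- Rotor routing

module Update {c ℓ} (M : CommutativeMonoid c ℓ) where
  open CommutativeMonoid M renaming (refl to ≈-refl; sym to ≈-sym; trans to ≈-trans)
  open ListSum M
  open import Algebra.Properties.CommutativeSemigroup commutativeSemigroup

  -- The form without inverses covers energies in ℕ as well as classes in a group.
  ∑-change : ∀ {A : Set} {l : List A} {u} (F G : A → Carrier) → Unique l → u ∈ l → (∀ v → u ≢ v → F v ≈ G v) →
             ∑ l F ∙ G u ≈ ∑ l G ∙ F u
  ∑-change {l = v ∷ l} F G (v∉ ∷ uniq) (here refl) off =
    ≈-trans (xy∙z≈zy∙x (F v) _ (G v)) (∙-congʳ (∙-congˡ (∑-cong l (λ w w∈ → off w (All.lookup v∉ w∈)))))
  ∑-change {l = v ∷ l} {u} F G (v∉ ∷ uniq) (there u∈) off = ≈-trans (assoc _ _ _)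
    (≈-trans (∙-cong (off v (λ u≡v → All.lookup v∉ u∈ (sym u≡v))) (∑-change F G uniq u∈ off)) (≈-sym (assoc _ _ _)))

  ∑-update : ∀ {n} {A : Set} (φ : A → Carrier) (f : Vec A n) u k →
             ∑ (allFin n) (λ v → φ (lookup (f [ u ]≔ k) v)) ∙ φ (lookup f u) ≈ ∑ (allFin n) (λ v → φ (lookup f v)) ∙ φ k
  ∑-update {n} φ f u k = ≈-trans (∑-change _ (λ v → φ (lookup f v)) (allFin⁺ n) (∈-allFin u)
      (λ v u≢v → reflexive (cong φ (lookup∘updateAt′ v u (u≢v ∘ sym) f))))
    (∙-congˡ (reflexive (cong φ (lookup∘updateAt u f))))

Trivial : ∀ {c ℓ} (𝔾 : AbelianGroup c ℓ) → AbelianGroup.Carrier 𝔾 → Set ℓ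
Trivial 𝔾 x = x ≈ ε
  where open AbelianGroup 𝔾

orElse : ∀ {A : Set} → List A → A → List A
orElse []        i = i ∷ []
orElse l@(_ ∷ _) i = l

orElse-nonempty : ∀ {A : Set} {l : List A} {i j} → j ∈ l → orElse l i ≡ l
orElse-nonempty {l = _ ∷ _} _ = refl

module Rotors {t n : ℕ} (D : HubDigraph t n) (i₀ : Fin t) where
  open HubDigraph D

  root : Fin n
  root = tail i₀
  open Potential root

  -- The root and the vertices without arcs, among them all vertices of other colours, get the dummy
  -- `i₀`. A rotor is then a total vector, and these vertices contribute the factor 1 to the count.
  choices : Fin n → List (Fin t)
  choices v with v ≟ root
  ... | yes _ = i₀ ∷ []
  ... | no _  = orElse (arcsAt v) i₀

  choices-active : ∀ j → tail j ≢ root → choices (tail j) ≡ arcsAt (tail j)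
  choices-active j tail≢ with tail j ≟ root
  ... | yes eq = contradiction eq tail≢
  ... | no _   = orElse-nonempty (∈-arcsAt j)

  choices-nonempty : ∀ v → ∃[ j ] j ∈ choices v
  choices-nonempty v with v ≟ root
  ... | yes _ = i₀ , here refl
  ... | no _ with arcsAt v
  ...   | []    = i₀ , here refl
  ...   | j ∷ _ = j , here refl

  Rotor : Set
  Rotor = Vec (Fin t) n

  Admissible : Rotor → Set
  Admissible f = ∀ v → lookup f v ∈ choices v

  Unrooted : Fin n → Set
  Unrooted c = All (λ j → tail j ≢ root) (arcsOn c)

  Full : Rotor → Fin n → Set
  Full f c = All (λ j → lookup f (tail j) ≡ j) (arcsOn c)

  private
    successor : ∀ j → _
    successor j = cyclicSuccessor (arcsAt (tail j)) (arcsAt-unique (tail j)) (∈-arcsAt j)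

  turn : Fin t → Fin t
  turn j = proj₁ (successor j)

  turn-tail : ∀ j → tail (turn j) ≡ tail j
  turn-tail j = arcsAt-tail (proj₁ (proj₂ (successor j)))

  module Prefix {c ℓ} (M : CommutativeMonoid c ℓ) (φ : Fin t → CommutativeMonoid.Carrier M) where
    open CommutativeMonoid M renaming (refl to ≈-refl; sym to ≈-sym; trans to ≈-trans)
    open ListSum M

    prefix : Fin t → Carrier
    prefix j = ∑ (before (arcsAt (tail j)) j) φ

    prefix-snoc : ∀ j → ∑ (before (arcsAt (tail j)) j ++ j ∷ []) φ ≈ prefix j ∙ φ j
    prefix-snoc j = ≈-trans (∑-++ (before (arcsAt (tail j)) j) (j ∷ []) φ) (∙-congˡ (identityʳ _))

    -- At the wrap the prefix falls back to ε and forgets the sum of `φ` over all arcs at the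
    -- vertex. This is harmless for classes, where that sum is trivial, and for energies, where it
    -- is nonnegative.
    prefix-turn : ∀ j → prefix (turn j) ≈ prefix j ∙ φ j ⊎ (prefix (turn j) ≡ ε × ∑ (arcsAt (tail j)) φ ≈ prefix j ∙ φ j)
    prefix-turn j with proj₂ (proj₂ (successor j))
    ... | inj₁ eq = inj₁ (≈-trans (reflexive (cong (λ v → ∑ (before (arcsAt v) (turn j)) φ) (turn-tail j)))
            (≈-trans (reflexive (cong (λ l → ∑ l φ) eq)) (prefix-snoc j)))
    ... | inj₂ (eq , all) = inj₂ (trans (cong (λ v → ∑ (before (arcsAt v) (turn j)) φ) (turn-tail j)) (cong (λ l → ∑ l φ) eq)
            , ≈-trans (reflexive (cong (λ l → ∑ l φ) all)) (prefix-snoc j))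

  -- A termination measure: a chip on `v` weighs `ĥ v`, a rotor pointing along `j` weighs `p̂ j`,
  -- and moving a chip along its rotor's arc before turning the rotor loses at least 1. `ĥ≥1` makes
  -- the absorption of a chip at the root a loss as well.
  record Energy : Set where
    field
      ĥ     : Fin n → ℕ
      p̂     : Fin t → ℕ
      ĥ≥1   : ∀ v → 1 ≤ ĥ v
      decay : ∀ j → tail j ≢ root → ĥ (head j) + p̂ (turn j) + 1 ≤ ĥ (tail j) + p̂ j

  private
    toEnergy : (g : Fin n → ℤ) → (∀ j → tail j ≢ root → 1ℤ ≤ᶻ L g (tail j)) → Energy
    toEnergy g strict = record { ĥ = ĥ ; p̂ = p̂ ; ĥ≥1 = λ v → proj₂ (ĥ≡ v) ; decay = decay }
     where
      h : Fin n → ℤ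
      -- Since `t` is at least every degree, the drops of `h` over a full turn add up to enough to
      -- pay 1 for each arc.
      h v = + t *ᶻ g v
      drop : Fin t → ℤ
      drop j = (h (tail j) -ᶻ h (head j)) +ᶻ -ᶻ 1ℤ
      open Prefix ℤ.+-0-commutativeMonoid drop
      total : ∀ j → tail j ≢ root → 0ℤ ≤ᶻ Int∑.∑ (arcsAt (tail j)) drop
      total j tail≢ = subst (0ℤ ≤ᶻ_) (sym (trans (Int∑.∑-∙ (arcsAt (tail j)) _ _)
          (cong₂ _+ᶻ_ (L-* (+ t) g (tail j)) (∑ᶻ-const (arcsAt (tail j)) (-ᶻ 1ℤ)))))
        (subst (_≤ᶻ + t *ᶻ L g (tail j) +ᶻ + length (arcsAt (tail j)) *ᶻ (-ᶻ 1ℤ)) (arith (+ t))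
          (ℤ.+-mono-≤ (ℤ.*-monoˡ-≤-nonNeg (+ t) (strict j tail≢))
            (subst₂ _≤ᶻ_ (arith′ (+ t)) (arith′ (+ length (arcsAt (tail j)))) (ℤ.neg-mono-≤ (ℤ.+≤+ degree≤t)))))
        where
        arith : ∀ x → x *ᶻ 1ℤ +ᶻ x *ᶻ (-ᶻ 1ℤ) ≡ 0ℤ
        arith = solve-∀ᶻ
        arith′ : ∀ x → -ᶻ x ≡ x *ᶻ (-ᶻ 1ℤ)
        arith′ = solve-∀ᶻ
        degree≤t : length (arcsAt (tail j)) ≤ t
        degree≤t = ℕ.≤-trans (List.length-filter (λ i → tail i ≟ tail j) (allFin t)) (ℕ.≤-reflexive (List.length-tabulate id))
      ĥ = proj₁ (shiftToℕ h)
      p̂ = proj₁ (shiftToℕ prefix)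
      Ch = proj₁ (proj₂ (shiftToℕ h))
      Cp = proj₁ (proj₂ (shiftToℕ prefix))
      ĥ≡ = proj₂ (proj₂ (shiftToℕ h))
      p̂≡ = proj₂ (proj₂ (shiftToℕ prefix))
      prefix≤ : ∀ j → tail j ≢ root → prefix (turn j) ≤ᶻ prefix j +ᶻ drop j
      prefix≤ j tail≢ with prefix-turn j
      ... | inj₁ eq = ℤ.≤-reflexive eq
      ... | inj₂ (eq , all) = subst₂ _≤ᶻ_ (sym eq) all (total j tail≢)
      decay : ∀ j → tail j ≢ root → ĥ (head j) + p̂ (turn j) + 1 ≤ ĥ (tail j) + p̂ j
      decay j tail≢ = ℤ.drop‿+≤+ (subst₂ _≤ᶻ_
        (sym (cong (_+ᶻ 1ℤ) (cong₂ _+ᶻ_ (proj₁ (ĥ≡ (head j))) (proj₁ (p̂≡ (turn j))))))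
        (trans (arith (h (head j)) (h (tail j)) (prefix j) Ch Cp) (sym (cong₂ _+ᶻ_ (proj₁ (ĥ≡ (tail j))) (proj₁ (p̂≡ j)))))
        (ℤ.+-monoˡ-≤ 1ℤ (ℤ.+-monoʳ-≤ (h (head j) +ᶻ Ch) (ℤ.+-monoˡ-≤ Cp (prefix≤ j tail≢)))))
        where
        arith : ∀ a b p x y → ((a +ᶻ x) +ᶻ ((p +ᶻ ((b -ᶻ a) +ᶻ -ᶻ 1ℤ)) +ᶻ y)) +ᶻ 1ℤ ≡ (b +ᶻ x) +ᶻ (p +ᶻ y)
        arith = solve-∀ᶻ

  energy : Energy
  energy = let g , positive = strictlySuperharmonic strict in toEnergy g positive
    where
    strict : ∀ j → StrictAt (tail j)
    -- At the root strictness is vacuous, so the zero function starts the propagation from heads to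
    -- tails.
    strict j = reachBackwards StrictAt strictAt-tail {i₀} {j}
      ((λ _ → 0ℤ) , (λ {v} _ → ∑ᶻ-nonneg (arcsAt v) (λ _ _ → ℤ.≤-refl)) , λ root≢root → contradiction refl root≢root)

  -- The head of `j` is the tail of `τ j`, and `τ` permutes the arcs of a hub. So moving one chip
  -- along each of these arcs leaves the configuration of chips as it was.
  arcsOn-∑ : ∀ {c ℓ} (M : CommutativeMonoid c ℓ) (φ : Fin n → CommutativeMonoid.Carrier M) v →
             let open CommutativeMonoid M
                 open ListSum M in
             ∑ (arcsOn v) (φ ∘ head) ≈ ∑ (arcsOn v) (φ ∘ tail)
  arcsOn-∑ M φ v = ≈-trans (∑-cong (arcsOn v) (λ j _ → reflexive (cong φ (sym (tail-τ j)))))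
      (∑-fibre-bijection τ τ⁻¹ τ⁻¹∘τ τ∘τ⁻¹ hub hub hub-τ (φ ∘ tail) v)
    where
    open CommutativeMonoid M using (reflexive) renaming (trans to ≈-trans)
    open ListSum M

  arcsOn-tails : ∀ c → AllPairs (λ i j → tail i ≢ tail j) (arcsOn c)
  arcsOn-tails c = go (arcsOn-unique c) λ i∈ j∈ eq → simple eq (trans (arcsOn-hub i∈) (sym (arcsOn-hub j∈)))
    where
    go : ∀ {l} → Unique l → (∀ {i j} → i ∈ l → j ∈ l → tail i ≡ tail j → i ≡ j) → AllPairs (λ i j → tail i ≢ tail j) l
    go [] inj = []
    go (x∉ ∷ u) inj = All.tabulate (λ j∈ eq → All.lookup x∉ j∈ (inj (here refl) (there j∈) eq)) ∷ go u (λ i∈ j∈ → inj (there i∈) (there j∈))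

  turnAt : Rotor → Fin t → Rotor
  turnAt f j = f [ tail j ]≔ turn j

  turnAll : Rotor → List (Fin t) → Rotor
  turnAll f []       = f
  turnAll f (j ∷ js) = turnAll (turnAt f j) js

  -- Cycle popping, restricted to hubs. A hub without arcs would be full vacuously; the first
  -- component excludes it, so that every pop costs energy.
  Poppable : Rotor → Fin n → Set
  Poppable f c = (∃[ j ] hub j ≡ c) × Unrooted c × Full f c

  poppable? : ∀ f c → Dec (Poppable f c)
  poppable? f c = any? (λ j → hub j ≟ c) ×-dec (All.all? (λ j → ¬? (tail j ≟ root)) (arcsOn c) ×-dec All.all? (λ j → lookup f (tail j) ≟ j) (arcsOn c))

  Reduced : Rotor → Set
  Reduced f = Admissible f × (∀ c → ¬ Poppable f c)

  ArcsBalance : ∀ {c ℓ} (𝔾 : AbelianGroup c ℓ) → (Fin n → AbelianGroup.Carrier 𝔾) → Set ℓ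
  ArcsBalance 𝔾 e = ∀ j → ∑ (arcsAt (tail j)) (λ i → e (tail i) ∙ e (head i) ⁻¹) ≈ ε
    where
    open AbelianGroup 𝔾
    open ListSum commutativeMonoid

  module InGroup (energy : Energy) {c ℓ} (𝔾 : AbelianGroup c ℓ) (e : Fin n → AbelianGroup.Carrier 𝔾)
    (e-root : Trivial 𝔾 (e root)) (relation : ArcsBalance 𝔾 e) where

    open AbelianGroup 𝔾 renaming (refl to ≈-refl; sym to ≈-sym; trans to ≈-trans)
    open ListSum commutativeMonoid
    open Energy energy
    open import Algebra.Properties.Group group using (∙-cancelʳ)
    open import Relation.Binary.Reasoning.Setoid setoid
    open import Algebra.Properties.CommutativeSemigroup commutativeSemigroup

    open Prefix commutativeMonoid (λ j → e (tail j) ∙ e (head j) ⁻¹) renaming (prefix to θ; prefix-turn to θ-turn)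

    Θ : Rotor → Carrier
    Θ f = ∑ (allFin n) (λ v → θ (lookup f v))

    Φ : Rotor → ℕ
    Φ f = Nat∑.∑ (allFin n) (λ v → p̂ (lookup f v))

    -- The chip's class changes by the opposite of what `θ` gains in the turn; at the wrap, what `θ`
    -- forgets is trivial by `relation`.
    θ-step : ∀ j → e (head j) ∙ θ (turn j) ≈ e (tail j) ∙ θ j
    θ-step j = ≈-trans (∙-congˡ step) (begin
      e (head j) ∙ (θ j ∙ (e (tail j) ∙ e (head j) ⁻¹))
        ≈⟨ x∙yz≈xz∙y (e (head j)) (θ j) _ ⟩
      (e (head j) ∙ (e (tail j) ∙ e (head j) ⁻¹)) ∙ θ j
        ≈⟨ ∙-congʳ (≈-trans (x∙yz≈y∙xz (e (head j)) (e (tail j)) (e (head j) ⁻¹)) (≈-trans (∙-congˡ (inverseʳ _)) (identityʳ _))) ⟩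
      e (tail j) ∙ θ j ∎)
      where
      step : θ (turn j) ≈ θ j ∙ (e (tail j) ∙ e (head j) ⁻¹)
      step with θ-turn j
      ... | inj₁ eq = eq
      ... | inj₂ (eq , all) = ≈-trans (reflexive eq) (≈-trans (≈-sym (relation j)) all)

    Θ-turnAt : ∀ f j → lookup f (tail j) ≡ j → e (head j) ∙ Θ (turnAt f j) ≈ e (tail j) ∙ Θ f
    Θ-turnAt f j cur = ∙-cancelʳ (θ j) _ _ (begin
      (e (head j) ∙ Θ (turnAt f j)) ∙ θ j
        ≈⟨ assoc _ _ _ ⟩
      e (head j) ∙ (Θ (turnAt f j) ∙ θ j)
        ≈⟨ ∙-congˡ (∙-congˡ (reflexive (cong θ (sym cur)))) ⟩
      e (head j) ∙ (Θ (turnAt f j) ∙ θ (lookup f (tail j)))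
        ≈⟨ ∙-congˡ (Update.∑-update commutativeMonoid θ f (tail j) (turn j)) ⟩
      e (head j) ∙ (Θ f ∙ θ (turn j))
        ≈⟨ x∙yz≈xz∙y _ _ _ ⟩
      (e (head j) ∙ θ (turn j)) ∙ Θ f
        ≈⟨ ∙-congʳ (θ-step j) ⟩
      (e (tail j) ∙ θ j) ∙ Θ f
        ≈⟨ xy∙z≈xz∙y _ _ _ ⟩
      (e (tail j) ∙ Θ f) ∙ θ j ∎)

    Φ-turnAt : ∀ f j → lookup f (tail j) ≡ j → tail j ≢ root → ĥ (head j) + Φ (turnAt f j) + 1 ≤ ĥ (tail j) + Φ f
    Φ-turnAt f j cur tail≢ = ℕ.+-cancelʳ-≤ (p̂ j) _ _ (subst₂ _≤_
      (sym (trans (shuffle (ĥ (head j)) (Φ (turnAt f j)) (p̂ j))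
        (trans (cong (λ x → ĥ (head j) + 1 + x) (trans (cong (λ i → Φ (turnAt f j) + p̂ i) (sym cur)) (Update.∑-update ℕ.+-0-commutativeMonoid p̂ f (tail j) (turn j))))
          (shuffle₂ (ĥ (head j)) (Φ f) (p̂ (turn j))))))
      (shuffle₃ (ĥ (tail j)) (p̂ j) (Φ f))
      (ℕ.+-monoˡ-≤ (Φ f) (decay j tail≢)))
      where
      shuffle : ∀ a b d → a + b + 1 + d ≡ a + 1 + (b + d)
      shuffle = solve-∀
      shuffle₂ : ∀ a b d → a + 1 + (b + d) ≡ a + d + 1 + b
      shuffle₂ = solve-∀
      shuffle₃ : ∀ a b d → a + b + d ≡ a + d + b
      shuffle₃ = solve-∀

    admissible-turnAt : ∀ f j → tail j ≢ root → Admissible f → Admissible (turnAt f j)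
    admissible-turnAt f j tail≢ adm v with v ≟ tail j
    ... | yes refl = subst₂ _∈_ (sym (lookup∘updateAt (tail j) f)) (sym (choices-active j tail≢)) (proj₁ (proj₂ (successor j)))
    ... | no v≢    = subst (_∈ choices v) (sym (lookup∘updateAt′ v (tail j) v≢ f)) (adm v)

    -- One chip is lent to every tail on the list and moves along its arc. Distinct tails keep the
    -- rotors of the remaining arcs in place.
    turnAll-spec : ∀ f js → AllPairs (λ i j → tail i ≢ tail j) js → All (λ j → lookup f (tail j) ≡ j) js → All (λ j → tail j ≢ root) js →
      Admissible f →
      Admissible (turnAll f js)
      × ∑ js (e ∘ head) ∙ Θ (turnAll f js) ≈ ∑ js (e ∘ tail) ∙ Θ f
      × Nat∑.∑ js (ĥ ∘ head) + Φ (turnAll f js) + length js ≤ Nat∑.∑ js (ĥ ∘ tail) + Φ f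
    turnAll-spec f [] [] [] [] adm = adm , ≈-refl , ℕ.≤-reflexive (ℕ.+-identityʳ _)
    turnAll-spec f (j ∷ js) (j∉ ∷ dist) (cur ∷ curs) (r ∷ rs) adm =
      let adm′ , eq , le = turnAll-spec (turnAt f j) js dist
            (All.zipWith (λ (tail≢ , c) → trans (lookup∘updateAt′ _ (tail j) (tail≢ ∘ sym) f) c) (j∉ , curs)) rs (admissible-turnAt f j r adm)
      in adm′
       , (begin
           (e (head j) ∙ ∑ js (e ∘ head)) ∙ Θ (turnAll (turnAt f j) js)  ≈⟨ assoc _ _ _ ⟩
           e (head j) ∙ (∑ js (e ∘ head) ∙ Θ (turnAll (turnAt f j) js))  ≈⟨ ∙-congˡ eq ⟩
           e (head j) ∙ (∑ js (e ∘ tail) ∙ Θ (turnAt f j))               ≈⟨ x∙yz≈y∙xz _ _ _ ⟩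
           ∑ js (e ∘ tail) ∙ (e (head j) ∙ Θ (turnAt f j))               ≈⟨ ∙-congˡ (Θ-turnAt f j cur) ⟩
           ∑ js (e ∘ tail) ∙ (e (tail j) ∙ Θ f)                          ≈⟨ x∙yz≈yx∙z _ _ _ ⟩
           (e (tail j) ∙ ∑ js (e ∘ tail)) ∙ Θ f                          ∎)
       , subst₂ _≤_ (shuffle (ĥ (head j)) (Nat∑.∑ js (ĥ ∘ head)) (Φ (turnAll (turnAt f j) js)) (length js))
           (shuffle₂ (ĥ (tail j)) (Nat∑.∑ js (ĥ ∘ tail)) (Φ f))
           (ℕ.≤-trans (ℕ.+-monoʳ-≤ (ĥ (head j) + 1) le)
             (subst (_≤ Nat∑.∑ js (ĥ ∘ tail) + (ĥ (tail j) + Φ f)) (shuffle₃ (ĥ (head j)) (Nat∑.∑ js (ĥ ∘ tail)) (Φ (turnAt f j)))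
               (ℕ.+-monoʳ-≤ (Nat∑.∑ js (ĥ ∘ tail)) (Φ-turnAt f j cur r))))
      where
      shuffle : ∀ a b d k → a + 1 + (b + d + k) ≡ a + b + d + suc k
      shuffle = solve-∀
      shuffle₂ : ∀ a b d → b + (a + d) ≡ a + b + d
      shuffle₂ = solve-∀
      shuffle₃ : ∀ a b d → b + (a + d + 1) ≡ a + 1 + (b + d)
      shuffle₃ = solve-∀

    -- On a hub the lent chips end up where chips were lent (`arcsOn-∑`), so they cancel from the
    -- class and from the energy. Every arc has cost one unit, and there is at least one arc.
    pop : ∀ f c → Poppable f c → Admissible f →
          Admissible (turnAll f (arcsOn c)) × Θ (turnAll f (arcsOn c)) ≈ Θ f × suc (Φ (turnAll f (arcsOn c))) ≤ Φ f
    pop f c ((j , hub≡) , unrooted , full) adm =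
      let adm′ , eq , le = turnAll-spec f (arcsOn c) (arcsOn-tails c) full unrooted adm
      in adm′
       , ∙-cancelˡ (∑ (arcsOn c) (e ∘ tail)) _ _ (≈-trans (∙-congʳ (≈-sym (arcsOn-∑ commutativeMonoid e c))) eq)
       , ℕ.+-cancelˡ-≤ (Nat∑.∑ (arcsOn c) (ĥ ∘ tail)) _ _ (ℕ.≤-trans
           (ℕ.≤-trans (ℕ.≤-reflexive (trans (ℕ.+-suc _ _) (sym (ℕ.+-comm _ 1)))) (ℕ.+-monoʳ-≤ _ (nonempty (subst (λ c → j ∈ arcsOn c) hub≡ (∈-arcsOn j)))))
           (subst (λ s → s + Φ (turnAll f (arcsOn c)) + length (arcsOn c) ≤ Nat∑.∑ (arcsOn c) (ĥ ∘ tail) + Φ f) (arcsOn-∑ ℕ.+-0-commutativeMonoid ĥ c) le))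
      where
      open import Algebra.Properties.Group group using (∙-cancelˡ)
      nonempty : ∀ {A : Set} {l : List A} {j} → j ∈ l → 1 ≤ length l
      nonempty {l = _ ∷ _} _ = s≤s z≤n

    -- `N` bounds the total energy. The first chip moves until the root, whose class is trivial,
    -- absorbs it; once all chips are gone, full hubs are popped until none is left.
    route : ∀ N chips f → All (λ v → ∃[ j ] tail j ≡ v) chips → Admissible f → Nat∑.∑ chips ĥ + Φ f ≤ N →
            ∃[ f′ ] Reduced f′ × ∑ chips e ∙ Θ f ≈ Θ f′
    route N [] f [] adm le with any? (poppable? f)
    ... | no none = f , (adm , λ c p → none (c , p)) , identityˡ _
    route zero [] f [] adm le | yes (c , p) = contradiction (ℕ.≤-trans (proj₂ (proj₂ (pop f c p adm))) le) λ ()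
    route (suc N) [] f [] adm le | yes (c , p) =
      let adm′ , eq , lt = pop f c p adm
          f′ , red , eq′ = route N [] (turnAll f (arcsOn c)) [] adm′ (ℕ.≤-pred (ℕ.≤-trans lt le))
      in f′ , red , ≈-trans (∙-congˡ (≈-sym eq)) eq′
    route zero (v ∷ chips) f _ adm le = contradiction (ℕ.≤-trans (ℕ.≤-trans (ĥ≥1 v) (ℕ.≤-trans (ℕ.m≤m+n _ _) (ℕ.m≤m+n _ _))) le) λ ()
    route (suc N) (v ∷ chips) f ((i , refl) ∷ tails) adm le with tail i ≟ root
    ... | yes v≡root =
      let f′ , red , eq = route N chips f tails adm (ℕ.≤-pred (ℕ.≤-trans (ℕ.+-monoˡ-≤ (Φ f) (ℕ.+-monoˡ-≤ (Nat∑.∑ chips ĥ) (ĥ≥1 v))) le))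
      in f′ , red , ≈-trans (∙-congʳ (≈-trans (∙-congʳ (≈-trans (reflexive (cong e v≡root)) e-root)) (identityˡ _))) eq
    ... | no v≢root =
      let f′ , red , eq = route N (head j ∷ chips) (turnAt f j) ((τ j , tail-τ j) ∷ tails) (admissible-turnAt f j j≢root adm)
            (ℕ.≤-pred (ℕ.≤-trans (subst₂ _≤_ (shuffle (ĥ (head j)) (Φ (turnAt f j)) (Nat∑.∑ chips ĥ))
               (shuffle₂ (ĥ (tail j)) (Φ f) (Nat∑.∑ chips ĥ)) (ℕ.+-monoˡ-≤ (Nat∑.∑ chips ĥ) (Φ-turnAt f j cur j≢root)))
               (subst (λ v → ĥ v + Nat∑.∑ chips ĥ + Φ f ≤ suc N) (sym tail-j) le)))
      in f′ , red , (begin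
           (e (tail i) ∙ ∑ chips e) ∙ Θ f           ≈⟨ ∙-congʳ (∙-congʳ (reflexive (cong e (sym tail-j)))) ⟩
           (e (tail j) ∙ ∑ chips e) ∙ Θ f           ≈⟨ xy∙z≈xz∙y _ _ _ ⟩
           (e (tail j) ∙ Θ f) ∙ ∑ chips e           ≈⟨ ∙-congʳ (Θ-turnAt f j cur) ⟨
           (e (head j) ∙ Θ (turnAt f j)) ∙ ∑ chips e ≈⟨ xy∙z≈xz∙y _ _ _ ⟩
           (e (head j) ∙ ∑ chips e) ∙ Θ (turnAt f j) ≈⟨ eq ⟩
           Θ f′ ∎)
      where
      -- Away from the root, admissibility makes the rotor at a tail one of the vertex's own arcs
      -- and not the dummy.
      j = lookup f (tail i)
      tail-j : tail j ≡ tail i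
      tail-j = arcsAt-tail (subst (j ∈_) (choices-active i v≢root) (adm (tail i)))
      j≢root : tail j ≢ root
      j≢root eq = v≢root (trans (sym tail-j) eq)
      cur : lookup f (tail j) ≡ j
      cur = cong (lookup f) tail-j
      shuffle : ∀ a b d → a + b + 1 + d ≡ suc (a + d + b)
      shuffle = solve-∀
      shuffle₂ : ∀ a b d → a + b + d ≡ a + d + b
      shuffle₂ = solve-∀

-- Rotor configurations without a full hub

module Prod∑ = ListSum ℕ.*-1-commutativeMonoid
∏ = Prod∑.∑

∏-mono : ∀ {A : Set} (l : List A) {f g : A → ℕ} → (∀ x → x ∈ l → f x ≤ g x) → ∏ l f ≤ ∏ l g
∏-mono []      f≤g = ℕ.≤-refl
∏-mono (x ∷ l) f≤g = ℕ.*-mono-≤ (f≤g x (here refl)) (∏-mono l (λ y y∈ → f≤g y (there y∈)))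

lookup-injective : ∀ {A : Set} {xs : List A} → Unique xs → ∀ {i j} → List.lookup xs i ≡ List.lookup xs j → i ≡ j
lookup-injective (x∉ ∷ u) {zero}  {zero}  eq = refl
lookup-injective (x∉ ∷ u) {zero}  {suc j} eq = contradiction eq (All.lookup x∉ (∈-lookup j))
lookup-injective (x∉ ∷ u) {suc i} {zero}  eq = contradiction (sym eq) (All.lookup x∉ (∈-lookup i))
lookup-injective (x∉ ∷ u) {suc i} {suc j} eq = cong suc (lookup-injective u eq)

index-injective : ∀ {A : Set} {ys : List A} {x y} (x∈ : x ∈ ys) (y∈ : y ∈ ys) → index x∈ ≡ index y∈ → x ≡ y
index-injective {ys = ys} x∈ y∈ eq = trans (lookup-index x∈) (trans (cong (List.lookup ys) eq) (sym (lookup-index y∈)))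

injection⇒length≤ : ∀ {A B : Set} {xs : List A} {ys : List B} (g : A → B) → Unique xs → (∀ {x} → x ∈ xs → g x ∈ ys) →
                    (∀ {x y} → g x ≡ g y → x ∈ xs → y ∈ xs → x ≡ y) → length xs ≤ length ys
injection⇒length≤ {xs = xs} g u into inj = injective⇒≤ {f = λ i → index (into (∈-lookup {xs = xs} i))}
  λ {i} {j} eq → lookup-injective u (inj (index-injective (into (∈-lookup i)) (into (∈-lookup j)) eq) (∈-lookup i) (∈-lookup j))

length-cartesianProductWith : ∀ {A B C : Set} (f : A → B → C) xs ys → length (cartesianProductWith f xs ys) ≡ length xs * length ys
length-cartesianProductWith f []       ys = refl
length-cartesianProductWith f (x ∷ xs) ys = trans (List.length-++ (List.map (f x) ys))
  (cong₂ _+_ (List.length-map (f x) ys) (length-cartesianProductWith f xs ys))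

sections : ∀ {A : Set} n → (Fin n → List A) → List (Vec A n)
sections zero    E = [] ∷ []
sections (suc n) E = cartesianProductWith _∷_ (E zero) (sections n (E ∘ suc))

∈-sections⁺ : ∀ {A : Set} {n} {E : Fin n → List A} (f : Vec A n) → (∀ v → lookup f v ∈ E v) → f ∈ sections n E
∈-sections⁺ []      f∈ = here refl
∈-sections⁺ (x ∷ f) f∈ = ∈-cartesianProductWith⁺ _∷_ (f∈ zero) (∈-sections⁺ f (f∈ ∘ suc))

∈-sections⁻ : ∀ {A : Set} {n} {E : Fin n → List A} {f : Vec A n} → f ∈ sections n E → ∀ v → lookup f v ∈ E v
∈-sections⁻ {n = suc n} {E} f∈ v with ∈-cartesianProductWith⁻ _∷_ (E zero) (sections n (E ∘ suc)) f∈
∈-sections⁻ f∈ zero    | x , f , x∈ , f∈′ , refl = x∈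
∈-sections⁻ f∈ (suc v) | x , f , x∈ , f∈′ , refl = ∈-sections⁻ f∈′ v

sections-unique : ∀ {A : Set} n {E : Fin n → List A} → (∀ v → Unique (E v)) → Unique (sections n E)
sections-unique zero    u = [] ∷ []
sections-unique (suc n) u = cartesianProductWith⁺ _∷_ (λ { refl → refl , refl }) (u zero) (sections-unique n (u ∘ suc))

∏-tabulate : ∀ {A : Set} {n} (g : Fin n → A) (φ : A → ℕ) → ∏ (List.tabulate g) φ ≡ ∏ (allFin n) (φ ∘ g)
∏-tabulate {n = zero}  g φ = refl
∏-tabulate {n = suc n} g φ = cong (φ (g zero) *_) (trans (∏-tabulate (g ∘ suc) φ) (sym (∏-tabulate {n = n} suc (φ ∘ g))))

length-sections : ∀ {A : Set} n (E : Fin n → List A) → length (sections n E) ≡ ∏ (allFin n) (length ∘ E)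
length-sections zero    E = refl
length-sections (suc n) E = trans (length-cartesianProductWith _∷_ (E zero) (sections n (E ∘ suc)))
  (cong (length (E zero) *_) (trans (length-sections n (E ∘ suc)) (sym (∏-tabulate suc (length ∘ E)))))

filter-split : ∀ {A : Set} {P Q : A → Set} (P? : Decidable P) (Q? : Decidable Q) (l : List A) →
  length (filter (λ x → ¬? (P? x) ×-dec Q? x) l) + length (filter (λ x → P? x ×-dec Q? x) l) ≡ length (filter Q? l)
filter-split P? Q? [] = refl
filter-split P? Q? (x ∷ l) with P? x | Q? x
... | yes _ | yes _ = trans (ℕ.+-suc _ _) (cong suc (filter-split P? Q? l))
... | yes _ | no _  = filter-split P? Q? l
... | no _  | yes _ = cong suc (filter-split P? Q? l)
... | no _  | no _  = filter-split P? Q? l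

module Sections {t n : ℕ} (D : HubDigraph t n) (E : Fin n → List (Fin t)) (E-unique : ∀ v → Unique (E v)) where
  open HubDigraph D

  Current : List (Fin t) → Vec (Fin t) n → Set
  Current js f = All (λ j → lookup f (tail j) ≡ j) js

  current? : ∀ js → Decidable (Current js)
  current? js f = All.all? (λ j → lookup f (tail j) ≟ j) js

  Avoids : List (Fin n) → Vec (Fin t) n → Set
  Avoids X f = All (λ c → ¬ Current (arcsOn c) f) X

  avoids? : ∀ X → Decidable (Avoids X)
  avoids? X f = All.all? (λ c → ¬? (current? (arcsOn c) f)) X

  Ω : List (Vec (Fin t) n)
  Ω = sections n E

  avoiding : List (Fin n) → ℕ
  avoiding X = length (filter (avoids? X) Ω)

  avoidingThrough : List (Fin n) → List (Fin t) → ℕ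
  avoidingThrough X js = length (filter (λ f → current? js f ×-dec avoids? X f) Ω)

  -- Pointing a rotor at `j` can fill only the hub of `j`; to the other hubs it can only take an arc
  -- away.
  avoids-redirect : ∀ X f j → All (λ c → hub j ≢ c) X → Avoids X f → Avoids X (f [ tail j ]≔ j)
  avoids-redirect X f j hub∉ av = All.zipWith (λ (hub≢ , ¬full) full → ¬full (All.tabulate λ {i} i∈ → restore i (λ i≡j → hub≢ (trans (cong hub (sym i≡j)) (arcsOn-hub i∈))) (All.lookup full i∈))) (hub∉ , av)
    where
    restore : ∀ i → i ≢ j → lookup (f [ tail j ]≔ j) (tail i) ≡ i → lookup f (tail i) ≡ i
    restore i i≢j eq with tail i ≟ tail j
    ... | yes same = contradiction (trans (sym eq) (trans (cong (lookup (f [ tail j ]≔ j)) same) (lookup∘updateAt (tail j) f))) i≢j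
    ... | no differ = trans (sym (lookup∘updateAt′ (tail i) (tail j) differ f)) eq

  -- Redirect the rotor at `tail j` to `j` and remember the old arc: writing that arc back recovers
  -- the configuration, so the map is injective.
  avoidingThrough-step : ∀ X j js → All (λ c → hub j ≢ c) X → All (λ i → tail j ≢ tail i) js → j ∈ E (tail j) →
    avoidingThrough X js ≤ length (E (tail j)) * avoidingThrough X (j ∷ js)
  avoidingThrough-step X j js hub∉ tail∉ j∈ = subst (avoidingThrough X js ≤_) (length-cartesianProductWith _,_ (E (tail j)) _)
    (injection⇒length≤ {ys = cartesianProduct (E (tail j)) (filter (λ f → current? (j ∷ js) f ×-dec avoids? X f) Ω)}
      (λ f → lookup f (tail j) , f [ tail j ]≔ j)
      (filter⁺ (λ f → current? js f ×-dec avoids? X f) (sections-unique n E-unique))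
      into
      λ {f} {g} eq _ _ → trans (sym (undo f)) (trans (cong₂ (λ x h → h [ tail j ]≔ x) (cong proj₁ eq) (cong proj₂ eq)) (undo g)))
    where
    undo : ∀ f → (f [ tail j ]≔ j) [ tail j ]≔ lookup f (tail j) ≡ f
    undo f = trans ([]≔-idempotent f (tail j)) ([]≔-lookup f (tail j))
    into : ∀ {f} → f ∈ filter (λ f → current? js f ×-dec avoids? X f) Ω →
           (lookup f (tail j) , f [ tail j ]≔ j) ∈ cartesianProduct (E (tail j)) (filter (λ f → current? (j ∷ js) f ×-dec avoids? X f) Ω)
    into {f} f∈ with ∈-filter⁻ (λ f → current? js f ×-dec avoids? X f) {xs = Ω} f∈
    ... | f∈Ω , cur , av = ∈-cartesianProduct⁺ (∈-sections⁻ f∈Ω (tail j)) (∈-filter⁺ (λ f → current? (j ∷ js) f ×-dec avoids? X f)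
          (∈-sections⁺ _ redirected)
          ((lookup∘updateAt (tail j) f ∷ All.zipWith (λ (tail≢ , c) → trans (lookup∘updateAt′ _ (tail j) (tail≢ ∘ sym) f) c) (tail∉ , cur))
          , avoids-redirect X f j hub∉ av))
      where
      redirected : ∀ v → lookup (f [ tail j ]≔ j) v ∈ E v
      redirected v with v ≟ tail j
      ... | yes refl = subst (_∈ E (tail j)) (sym (lookup∘updateAt (tail j) f)) j∈
      ... | no v≢    = subst (_∈ E v) (sym (lookup∘updateAt′ v (tail j) v≢ f)) (∈-sections⁻ f∈Ω v)

  -- For a uniformly random choice: given that all hubs of `X` are avoided, the arcs `js` are all
  -- chosen with at least their unconditional probability.
  avoidingThrough-all : ∀ X js → AllPairs (λ i j → tail i ≢ tail j) js → All (λ j → All (λ c → hub j ≢ c) X × j ∈ E (tail j)) js →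
    avoiding X ≤ ∏ js (λ j → length (E (tail j))) * avoidingThrough X js
  avoidingThrough-all X [] [] [] = ℕ.≤-reflexive (trans (cong length (List.filter-≐ (avoids? X) (λ f → current? [] f ×-dec avoids? X f) ((λ av → [] , av) , proj₂) Ω)) (sym (ℕ.*-identityˡ _)))
  avoidingThrough-all X (j ∷ js) (j∉ ∷ dist) ((hub∉ , j∈) ∷ rest) = begin
    avoiding X
      ≤⟨ avoidingThrough-all X js dist rest ⟩
    ∏ js (λ j → length (E (tail j))) * avoidingThrough X js
      ≤⟨ ℕ.*-monoʳ-≤ (∏ js (λ j → length (E (tail j)))) (avoidingThrough-step X j js hub∉ j∉ j∈) ⟩
    ∏ js (λ j → length (E (tail j))) * (length (E (tail j)) * avoidingThrough X (j ∷ js))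
      ≡⟨ arith (∏ js (λ j → length (E (tail j)))) (length (E (tail j))) _ ⟩
    length (E (tail j)) * ∏ js (λ j → length (E (tail j))) * avoidingThrough X (j ∷ js) ∎
    where
    open ℕ.≤-Reasoning
    arith : ∀ a b c → a * (b * c) ≡ b * a * c
    arith = solve-∀

  -- If all its arcs are eligible, the reciprocal of the probability that a uniformly random choice
  -- fills `c`.
  weight : Fin n → ℕ
  weight c = ∏ (arcsOn c) (λ j → length (E (tail j)))

  -- The events "every arc on c is chosen" are negatively correlated: given one
  -- of them, all the others become less likely.
  avoiding-∷ : ∀ c X → All (c ≢_) X → AllPairs (λ i j → tail i ≢ tail j) (arcsOn c) → All (λ j → j ∈ E (tail j)) (arcsOn c) →
    avoiding (c ∷ X) * weight c ≤ avoiding X * (weight c ∸ 1)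
  avoiding-∷ c X c∉ dist chosen = subst (avoiding (c ∷ X) * weight c ≤_) (sym (ℕ.*-distribˡ-∸ (avoiding X) (weight c) 1))
    (ℕ.m+n≤o⇒m≤o∸n (avoiding (c ∷ X) * weight c) (begin
      avoiding (c ∷ X) * weight c + avoiding X * 1
        ≤⟨ ℕ.+-monoʳ-≤ (avoiding (c ∷ X) * weight c) (ℕ.≤-trans (ℕ.≤-reflexive (ℕ.*-identityʳ _)) through) ⟩
      avoiding (c ∷ X) * weight c + weight c * avoidingThrough X (arcsOn c)
        ≡⟨ cong₂ _+_ (cong (_* weight c) avoiding-split) (ℕ.*-comm (weight c) _) ⟩
      length (filter (λ f → ¬? (current? (arcsOn c) f) ×-dec avoids? X f) Ω) * weight c + avoidingThrough X (arcsOn c) * weight c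
        ≡⟨ ℕ.*-distribʳ-+ (weight c) (length (filter (λ f → ¬? (current? (arcsOn c) f) ×-dec avoids? X f) Ω)) _ ⟨
      (length (filter (λ f → ¬? (current? (arcsOn c) f) ×-dec avoids? X f) Ω) + avoidingThrough X (arcsOn c)) * weight c
        ≡⟨ cong (_* weight c) (filter-split (current? (arcsOn c)) (avoids? X) Ω) ⟩
      avoiding X * weight c ∎))
    where
    open ℕ.≤-Reasoning
    through : avoiding X ≤ weight c * avoidingThrough X (arcsOn c)
    through = avoidingThrough-all X (arcsOn c) dist
      (All.tabulate λ j∈ → All.map (λ c≢ hub≡ → c≢ (trans (sym (arcsOn-hub j∈)) hub≡)) c∉ , All.lookup chosen j∈)
    avoiding-split : avoiding (c ∷ X) ≡ length (filter (λ f → ¬? (current? (arcsOn c) f) ×-dec avoids? X f) Ω)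
    avoiding-split = cong length (List.filter-≐ (avoids? (c ∷ X)) (λ f → ¬? (current? (arcsOn c) f) ×-dec avoids? X f)
      ((λ { (p ∷ q) → p , q }) , λ (p , q) → p ∷ q) Ω)

  avoiding-∏ : ∀ X → Unique X → All (λ c → AllPairs (λ i j → tail i ≢ tail j) (arcsOn c) × All (λ j → j ∈ E (tail j)) (arcsOn c)) X →
    avoiding X * ∏ X weight ≤ ∏ (allFin n) (length ∘ E) * ∏ X (λ c → weight c ∸ 1)
  avoiding-∏ [] [] [] = ℕ.*-monoˡ-≤ 1 (ℕ.≤-trans (List.length-filter (avoids? []) Ω) (ℕ.≤-reflexive (length-sections n E)))
  avoiding-∏ (c ∷ X) (c∉ ∷ u) ((dist , chosen) ∷ rest) = begin
    avoiding (c ∷ X) * (weight c * ∏ X weight)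
      ≡⟨ ℕ.*-assoc (avoiding (c ∷ X)) (weight c) _ ⟨
    avoiding (c ∷ X) * weight c * ∏ X weight
      ≤⟨ ℕ.*-monoˡ-≤ (∏ X weight) (avoiding-∷ c X c∉ dist chosen) ⟩
    avoiding X * (weight c ∸ 1) * ∏ X weight
      ≡⟨ arith (avoiding X) (weight c ∸ 1) (∏ X weight) ⟩
    avoiding X * ∏ X weight * (weight c ∸ 1)
      ≤⟨ ℕ.*-monoˡ-≤ (weight c ∸ 1) (avoiding-∏ X u rest) ⟩
    ∏ (allFin n) (length ∘ E) * ∏ X (λ c → weight c ∸ 1) * (weight c ∸ 1)
      ≡⟨ arith′ (∏ (allFin n) (length ∘ E)) (∏ X (λ c → weight c ∸ 1)) (weight c ∸ 1) ⟩
    ∏ (allFin n) (length ∘ E) * ((weight c ∸ 1) * ∏ X (λ c → weight c ∸ 1)) ∎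
    where
    open ℕ.≤-Reasoning
    arith : ∀ a b c → a * b * c ≡ a * c * b
    arith = solve-∀
    arith′ : ∀ a b c → a * b * c ≡ a * (c * b)
    arith′ = solve-∀

-- Numerical estimates

below : ∀ {P : ℕ → Set} k → (∀ (i : Fin k) → P (toℕ i)) → ∀ m → m < k → P m
below {P} k h m m<k = subst P (toℕ-fromℕ< m<k) (h (fromℕ< m<k))

-- x (1 − x)²⁶ is largest at x = 1/27, and 27²⁷/26²⁶ > 71; here x = 1/p.
reciprocal-bound : ∀ p → (p ∸ 1) ^ 26 * 71 ≤ p ^ 26 * p
reciprocal-bound p with p <? 71
... | no ≮71  = ℕ.*-mono-≤ (ℕ.^-monoˡ-≤ 26 (ℕ.m∸n≤m p 1)) (ℕ.≮⇒≥ ≮71)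
... | yes <71 = below {λ p → (p ∸ 1) ^ 26 * 71 ≤ p ^ 26 * p} 71 (from-yes (all? λ (i : Fin 71) → (toℕ i ∸ 1) ^ 26 * 71 ≤? toℕ i ^ 26 * toℕ i)) p <71

-- The two sides differ by about 0.2 percent at d = 3 and 1.4 percent at d = 4, the degrees that
-- matter; 14 and 17000 come from there.
small-degree : ∀ d → d < 11 → d ^ 26 * d ^ d ≤ 14 * 17000 ^ d
small-degree = below 11 (from-yes (all? λ (i : Fin 11) → toℕ i ^ 26 * toℕ i ^ toℕ i ≤? 14 * 17000 ^ toℕ i))

^-distrib-* : ∀ k a b → (a * b) ^ k ≡ a ^ k * b ^ k
^-distrib-* zero    a b = refl
^-distrib-* (suc k) a b = trans (cong (a * b *_) (^-distrib-* k a b)) (arith a b (a ^ k) (b ^ k))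
  where
  arith : ∀ a b x y → a * b * (x * y) ≡ a * x * (b * y)
  arith = solve-∀

-- From d to d + 1 the left side grows by the factor (1 + 1/d)^q · H, which is at most (v/u)^q · H
-- and so at most B.
growth-step : ∀ q H A B u v .{{_ : NonZero u}} d → u * suc d ≤ v * d → v ^ q * H ≤ u ^ q * B →
              d ^ q * H ^ d ≤ A * B ^ d → suc d ^ q * H ^ suc d ≤ A * B ^ suc d
growth-step q H A B u v d base ratio ih = ℕ.*-cancelˡ-≤ (u ^ q) {{ℕ.m^n≢0 u q}} (begin
  u ^ q * (suc d ^ q * (H * H ^ d))
    ≡⟨ ℕ.*-assoc (u ^ q) (suc d ^ q) _ ⟨
  u ^ q * suc d ^ q * (H * H ^ d)
    ≤⟨ ℕ.*-monoˡ-≤ (H * H ^ d) growth ⟩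
  v ^ q * d ^ q * (H * H ^ d)
    ≡⟨ arith₂ (v ^ q) (d ^ q) H (H ^ d) ⟩
  v ^ q * H * (d ^ q * H ^ d)
    ≤⟨ ℕ.*-mono-≤ ratio ih ⟩
  u ^ q * B * (A * B ^ d)
    ≡⟨ arith₃ (u ^ q) B A (B ^ d) ⟩
  u ^ q * (A * (B * B ^ d)) ∎)
  where
  open ℕ.≤-Reasoning
  arith₂ : ∀ a b c x → a * b * (c * x) ≡ a * c * (b * x)
  arith₂ = solve-∀
  arith₃ : ∀ a b c x → a * b * (c * x) ≡ a * (c * (b * x))
  arith₃ = solve-∀
  growth : u ^ q * suc d ^ q ≤ v ^ q * d ^ q
  growth = subst₂ _≤_ (^-distrib-* q u (suc d)) (^-distrib-* q v d) (ℕ.^-monoˡ-≤ q base)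

-- The inequality fails at d = 10, whence the threshold 11. From there on 1 + 1/d ≤ 12/11.
large-degree : ∀ {d} → 11 ≤′ d → d ^ 26 * 71 ^ d ≤ 14 * 17000 ^ d
large-degree ≤′-refl = from-yes (11 ^ 26 * 71 ^ 11 ≤? 14 * 17000 ^ 11)
large-degree (≤′-step {d} 11≤d) = growth-step 26 71 14 17000 11 12 d
  (subst (_≤ 12 * d) (sym (ℕ.*-suc 11 d)) (ℕ.+-monoˡ-≤ (11 * d) (ℕ.≤′⇒≤ 11≤d)))
  (from-yes (12 ^ 26 * 71 ≤? 11 ^ 26 * 17000)) (large-degree 11≤d)

-- Bounding the number of reduced rotors by a product over vertices

∏-^ : ∀ {A : Set} (l : List A) (g : A → ℕ) q → ∏ l (λ x → g x ^ q) ≡ ∏ l g ^ q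
∏-^ []      g q = sym (ℕ.^-zeroˡ q)
∏-^ (x ∷ l) g q = trans (cong (g x ^ q *_) (∏-^ l g q)) (sym (^-distrib-* q (g x) (∏ l g)))

∏-const : ∀ {A : Set} (l : List A) c → ∏ l (λ _ → c) ≡ c ^ length l
∏-const []      c = refl
∏-const (x ∷ l) c = cong (c *_) (∏-const l c)

∏-positive : ∀ {A : Set} (l : List A) {g : A → ℕ} → (∀ x → x ∈ l → 1 ≤ g x) → 1 ≤ ∏ l g
∏-positive l 1≤g = subst (_≤ ∏ l _) (Prod∑.∑-ε l) (∏-mono l 1≤g)

∏-factor : ∀ {A : Set} {l : List A} {g : A → ℕ} {x} → x ∈ l → (∀ y → y ∈ l → 1 ≤ g y) → g x ≤ ∏ l g
∏-factor {l = x ∷ l} {g} (here refl) 1≤g = subst (_≤ g x * ∏ l g) (ℕ.*-identityʳ (g x)) (ℕ.*-monoʳ-≤ (g x) (∏-positive l (λ y y∈ → 1≤g y (there y∈))))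
∏-factor {l = y ∷ l} {g} {x} (there x∈) 1≤g = subst (_≤ g y * ∏ l g) (ℕ.*-identityˡ (g x)) (ℕ.*-mono-≤ (1≤g y (here refl)) (∏-factor x∈ (λ z z∈ → 1≤g z (there z∈))))

∈⇒length : ∀ {A : Set} {l : List A} {x} → x ∈ l → 1 ≤ length l
∈⇒length {l = _ ∷ _} _ = s≤s z≤n

-- Its product over all vertices is `x` to the size of the image of `f`.
support : ∀ {t n} → (Fin t → Fin n) → ℕ → Fin n → ℕ
support f x v = if does (any? (λ j → f j ≟ v)) then x else 1

support-on : ∀ {t n} (f : Fin t → Fin n) x j → support f x (f j) ≡ x
support-on f x j with any? (λ i → f i ≟ f j)
... | yes _   = refl
... | no none = contradiction (j , refl) none

support-off : ∀ {t n} (f : Fin t → Fin n) x {v} → (∀ j → f j ≢ v) → support f x v ≡ 1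
support-off f x {v} off with any? (λ i → f i ≟ v)
... | yes (j , eq) = contradiction eq (off j)
... | no _ = refl

-- A hub of weight p saves (1 - 1/p)^q ≤ p/H. As p is a product over the vertices of the hub, the
-- saving separates: a vertex with d arcs has d choices, raised to the power q, and carries one more
-- factor for each arc. `A` and `B` bound the result by A · B^d.
module _ (q H A B K : ℕ) (1≤H : 1 ≤ H) (1≤A : 1 ≤ A)
  (reciprocal : ∀ p → (p ∸ 1) ^ q * H ≤ p ^ q * p)
  (small : ∀ d → d < K → d ^ q * d ^ d ≤ A * B ^ d)
  (large : ∀ d → K ≤ d → d ^ q * H ^ d ≤ A * B ^ d)
  (rooted : ∀ d → H ^ d ≤ A * B ^ d)
  {t n : ℕ} (D : HubDigraph t n) (i₀ : Fin t) where

  open HubDigraph D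
  open Rotors D i₀

  choices-unique : ∀ v → Unique (choices v)
  choices-unique v with v ≟ root
  ... | yes _ = [] ∷ []
  ... | no _  = orElse-unique (arcsAt-unique v)
    where
    orElse-unique : ∀ {A : Set} {l : List A} {i} → Unique l → Unique (orElse l i)
    orElse-unique {l = []}    u = [] ∷ []
    orElse-unique {l = _ ∷ _} u = u

  open Sections D choices choices-unique

  degree : Fin n → ℕ
  degree v = length (arcsAt v)

  Big : Fin n → Set
  Big v = v ≡ root ⊎ K ≤ degree v

  abstract
   big? : ∀ v → Dec (Big v)
   big? v = (v ≟ root) ⊎-dec (K ≤? degree v)

  Light : Fin n → Set
  Light c = (∃[ j ] hub j ≡ c) × All (λ j → ¬ Big (tail j)) (arcsOn c)

  abstract
   light? : ∀ c → Dec (Light c)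
   light? c = any? (λ j → hub j ≟ c) ×-dec All.all? (λ j → ¬? (big? (tail j))) (arcsOn c)

  lightHubs : List (Fin n)
  lightHubs = filter light? (allFin n)

  -- The factor that a vertex carries for each of its arcs. For small vertices it is the degree, so
  -- that a light hub collects its `weight`; a big vertex carries `H`, which pays for a hub whose
  -- saving is given up.
  γ : Fin n → ℕ
  γ v = if does (big? v) then H else degree v

  γ-big : ∀ {v} → Big v → γ v ≡ H
  γ-big {v} b with big? v
  ... | yes _ = refl
  ... | no ¬b = contradiction b ¬b

  γ-small : ∀ {v} → ¬ Big v → γ v ≡ degree v
  γ-small {v} ¬b with big? v
  ... | yes b = contradiction b ¬b
  ... | no _  = refl

  1≤γ : ∀ j → 1 ≤ γ (tail j)
  1≤γ j with big? (tail j)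
  ... | yes _ = 1≤H
  ... | no _  = ∈⇒length (∈-arcsAt j)

  choices-root : length (choices root) ≡ 1
  choices-root with root ≟ root
  ... | yes _  = refl
  ... | no r≢r = contradiction refl r≢r

  choices-isolated : ∀ {v} → arcsAt v ≡ [] → length (choices v) ≡ 1
  choices-isolated {v} empty with v ≟ root
  ... | yes _ = refl
  ... | no _  = cong (λ l → length (orElse l i₀)) empty

  choices-degree : ∀ j → ¬ Big (tail j) → length (choices (tail j)) ≡ γ (tail j)
  choices-degree j ¬b = trans (cong length (choices-active j (¬b ∘ inj₁))) (sym (γ-small ¬b))

  hubFactor : Fin n → ℕ
  hubFactor c = ∏ (arcsOn c) (γ ∘ tail)

  -- A light hub uses `reciprocal` at its weight. Any other hub with arcs has a big vertex, whose
  -- single factor `H` is enough because the remaining factors are at least 1.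
  hub-estimate : ∀ c → (if does (light? c) then weight c ∸ 1 else 1) ^ q * support hub H c
                         ≤ (if does (light? c) then weight c else 1) ^ q * hubFactor c
  hub-estimate c with light? c
  ... | yes ((j , refl) , ¬big) = subst₂ _≤_
          (cong ((weight c ∸ 1) ^ q *_) (sym (support-on hub H j)))
          (cong (weight c ^ q *_) (Prod∑.∑-cong (arcsOn c) (λ i i∈ → choices-degree i (All.lookup ¬big i∈))))
          (reciprocal (weight c))
  ... | no ¬light = ℕ.*-monoʳ-≤ (1 ^ q) support≤
    where
    support≤ : support hub H c ≤ hubFactor c
    support≤ with any? (λ j → hub j ≟ c)
    ... | no _  = ∏-positive (arcsOn c) (λ j _ → 1≤γ j)
    ... | yes e with find (All.¬All⇒Any¬ (λ j → ¬? (big? (tail j))) (arcsOn c) (λ all → ¬light (e , all)))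
    ...   | j , j∈ , ¬¬big = subst (_≤ hubFactor c) (γ-big (decidable-stable (big? (tail j)) ¬¬big)) (∏-factor j∈ (λ i _ → 1≤γ i))

  -- The root has a single choice, so `rooted` suffices there; a high degree pays `H` per arc, a low
  -- one pays itself per arc. A vertex without arcs gives 1 on the left.
  tail-estimate : ∀ v → length (choices v) ^ q * γ v ^ degree v ≤ support tail A v * B ^ degree v
  tail-estimate v = go (arcsAt v) refl
   where
   Goal : Set
   Goal = length (choices v) ^ q * γ v ^ degree v ≤ support tail A v * B ^ degree v
   positive : 1 ≤ support tail A v
   positive with does (any? (λ j → tail j ≟ v))
   ... | true  = 1≤A
   ... | false = ℕ.≤-refl
   go : ∀ l → arcsAt v ≡ l → Goal
   go [] eq = subst₂ (λ k d → k ^ q * γ v ^ d ≤ support tail A v * B ^ d) (sym (choices-isolated eq)) (sym (cong length eq))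
                (subst (_≤ support tail A v * 1) (sym (cong (_* 1) (ℕ.^-zeroˡ q))) (ℕ.*-monoˡ-≤ 1 positive))
   go (j ∷ js) eq = subst (λ s → length (choices v) ^ q * γ v ^ degree v ≤ s * B ^ degree v) (sym on) (cases (v ≟ root) (K ≤? degree v))
    where
    j∈ : j ∈ arcsAt v
    j∈ = subst (j ∈_) (sym eq) (here refl)
    tail≡ : tail j ≡ v
    tail≡ = arcsAt-tail j∈
    on : support tail A v ≡ A
    on = subst (λ u → support tail A u ≡ A) tail≡ (support-on tail A j)
    choices≡ : v ≢ root → length (choices v) ≡ degree v
    choices≡ v≢root = cong length (subst (λ u → choices u ≡ arcsAt u) tail≡ (choices-active j (v≢root ∘ trans (sym tail≡))))
    cases : Dec (v ≡ root) → Dec (K ≤ degree v) → length (choices v) ^ q * γ v ^ degree v ≤ A * B ^ degree v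
    cases (yes refl) _ = subst (_≤ A * B ^ degree v)
      (sym (trans (cong₂ (λ k g → k ^ q * g ^ degree v) choices-root (γ-big {v} (inj₁ refl)))
                  (trans (cong (_* H ^ degree v) (ℕ.^-zeroˡ q)) (ℕ.*-identityˡ _)))) (rooted (degree v))
    cases (no v≢root) (yes K≤) = subst (_≤ A * B ^ degree v)
      (sym (cong₂ (λ k g → k ^ q * g ^ degree v) (choices≡ v≢root) (γ-big {v} (inj₂ K≤)))) (large (degree v) K≤)
    cases (no v≢root) (no K≰) = subst (_≤ A * B ^ degree v)
      (sym (cong₂ (λ k g → k ^ q * g ^ degree v) (choices≡ v≢root) (γ-small {v} λ { (inj₁ r) → v≢root r ; (inj₂ k) → K≰ k })))
      (small (degree v) (ℕ.≰⇒> K≰))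

  ∏-arcsAt : ∀ (g : Fin n → ℕ) → ∏ (allFin n) (λ v → ∏ (arcsAt v) (g ∘ tail)) ≡ ∏ (allFin n) (λ v → g v ^ degree v)
  ∏-arcsAt g = Prod∑.∑-cong (allFin n) λ v _ →
    trans (Prod∑.∑-cong (arcsAt v) (λ j j∈ → cong g (arcsAt-tail j∈))) (∏-const (arcsAt v) (g v))

  -- Every arc has one hub and one tail; the product over all arcs is grouped by the one and then by
  -- the other.
  hubFactor-total : ∏ (allFin n) hubFactor ≡ ∏ (allFin n) (λ v → γ v ^ degree v)
  hubFactor-total = trans (sym (Prod∑.∑-fibres hub (allFin t) (γ ∘ tail)))
    (trans (Prod∑.∑-fibres tail (allFin t) (γ ∘ tail)) (∏-arcsAt γ))

  degree-total : ∏ (allFin n) (λ v → B ^ degree v) ≡ B ^ t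
  degree-total = trans (sym (∏-arcsAt (λ _ → B))) (trans (sym (Prod∑.∑-fibres tail (allFin t) (λ _ → B)))
    (trans (∏-const (allFin t) B) (cong (λ k → B ^ k) (List.length-tabulate {n = t} id))))

  light-∏ : ∏ lightHubs weight ≢ 0
  light-∏ eq = contradiction (subst (1 ≤_) eq (∏-positive lightHubs λ c c∈ → ∏-positive (arcsOn c) λ j j∈ →
      subst (1 ≤_) (sym (choices-degree j (All.lookup (proj₂ (proj₂ (∈-filter⁻ light? {xs = allFin n} c∈))) j∈))) (1≤γ j))) λ ()

  light-avoiding : avoiding lightHubs * ∏ lightHubs weight ≤ ∏ (allFin n) (length ∘ choices) * ∏ lightHubs (λ c → weight c ∸ 1)
  light-avoiding = avoiding-∏ lightHubs (filter⁺ light? (allFin⁺ n)) (All.tabulate λ {c} c∈ → arcsOn-tails c ,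
    All.tabulate λ {j} j∈ → subst (j ∈_) (sym (choices-active j (All.lookup (proj₂ (proj₂ (∈-filter⁻ light? {xs = allFin n} c∈))) j∈ ∘ inj₁))) (∈-arcsAt j))

  avoiding-bound : avoiding lightHubs ^ q * ∏ (allFin n) (support hub H) ≤ ∏ (allFin n) (support tail A) * B ^ t
  avoiding-bound = ℕ.*-cancelˡ-≤ (W ^ q) {{ℕ.m^n≢0 W q {{≢-nonZero light-∏}}}} (begin
    W ^ q * (N ^ q * ∏ (allFin n) (support hub H))
      ≡⟨ trans (arith (W ^ q) (N ^ q) _) (cong (_* ∏ (allFin n) (support hub H)) (sym (^-distrib-* q N W))) ⟩
    (N * W) ^ q * ∏ (allFin n) (support hub H)
      ≤⟨ ℕ.*-monoˡ-≤ (∏ (allFin n) (support hub H)) (ℕ.^-monoˡ-≤ q light-avoiding) ⟩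
    (Ω# * W⁻) ^ q * ∏ (allFin n) (support hub H)
      ≡⟨ trans (cong (_* ∏ (allFin n) (support hub H)) (^-distrib-* q Ω# W⁻)) (ℕ.*-assoc (Ω# ^ q) _ _) ⟩
    Ω# ^ q * (W⁻ ^ q * ∏ (allFin n) (support hub H))
      ≤⟨ ℕ.*-monoʳ-≤ (Ω# ^ q) hubs ⟩
    Ω# ^ q * (W ^ q * ∏ (allFin n) (λ v → γ v ^ degree v))
      ≡⟨ arith₂ (Ω# ^ q) (W ^ q) _ ⟩
    W ^ q * (Ω# ^ q * ∏ (allFin n) (λ v → γ v ^ degree v))
      ≤⟨ ℕ.*-monoʳ-≤ (W ^ q) tails ⟩
    W ^ q * (∏ (allFin n) (support tail A) * B ^ t) ∎)
    where
    open ℕ.≤-Reasoning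
    N = avoiding lightHubs
    W = ∏ lightHubs weight
    W⁻ = ∏ lightHubs (λ c → weight c ∸ 1)
    Ω# = ∏ (allFin n) (length ∘ choices)
    arith : ∀ a b c → a * (b * c) ≡ b * a * c
    arith = solve-∀
    arith₂ : ∀ a b c → a * (b * c) ≡ b * (a * c)
    arith₂ = solve-∀
    merge : ∀ (g h : Fin n → ℕ) → ∏ (allFin n) (λ c → g c ^ q * h c) ≡ ∏ (allFin n) g ^ q * ∏ (allFin n) h
    merge g h = trans (Prod∑.∑-∙ (allFin n) (λ c → g c ^ q) h) (cong (_* ∏ (allFin n) h) (∏-^ (allFin n) g q))
    filtered : ∀ (g : Fin n → ℕ) → ∏ (allFin n) (λ c → if does (light? c) then g c else 1) ≡ ∏ lightHubs g
    filtered g = sym (Prod∑.∑-filter light? (allFin n) g)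
    hubs : W⁻ ^ q * ∏ (allFin n) (support hub H) ≤ W ^ q * ∏ (allFin n) (λ v → γ v ^ degree v)
    hubs = subst₂ _≤_
      (trans (merge _ _) (cong (λ w → w ^ q * ∏ (allFin n) (support hub H)) (filtered (λ c → weight c ∸ 1))))
      (trans (merge _ _) (cong₂ (λ w x → w ^ q * x) (filtered weight) hubFactor-total))
      (∏-mono (allFin n) (λ c _ → hub-estimate c))
    tails : Ω# ^ q * ∏ (allFin n) (λ v → γ v ^ degree v) ≤ ∏ (allFin n) (support tail A) * B ^ t
    tails = subst₂ _≤_ (merge _ _) (trans (Prod∑.∑-∙ (allFin n) _ _) (cong (∏ (allFin n) (support tail A) *_) degree-total))
      (∏-mono (allFin n) (λ v _ → tail-estimate v))

  -- The tails on a light hub differ from the root, so a full light hub would be poppable. Reduced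
  -- rotors therefore avoid all light hubs.
  reduced-bound : ∀ {m} (f : Fin m → Rotor) → (∀ i → Reduced (f i)) → (∀ {i j} → f i ≡ f j → i ≡ j) →
                  m ^ q * ∏ (allFin n) (support hub H) ≤ ∏ (allFin n) (support tail A) * B ^ t
  reduced-bound {m} f reduced inj = ℕ.≤-trans (ℕ.*-monoˡ-≤ _ (ℕ.^-monoˡ-≤ q m≤)) avoiding-bound
    where
    avoids : ∀ i → f i ∈ filter (avoids? lightHubs) Ω
    avoids i = ∈-filter⁺ (avoids? lightHubs) (∈-sections⁺ (f i) (proj₁ (reduced i)))
      (All.tabulate λ {c} c∈ full → let (e , ¬big) = proj₂ (∈-filter⁻ light? {xs = allFin n} c∈) in
        proj₂ (reduced i) c (e , All.map (λ ¬b → ¬b ∘ inj₁) ¬big , full))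
    m≤ : m ≤ avoiding lightHubs
    m≤ = injective⇒≤ {f = λ i → index (avoids i)} (λ {i} {j} eq → inj (index-injective (avoids i) (avoids j) eq))

-- Integer vectors modulo the faces

open Int∑ using () renaming (∑ to ∑ᶻ)

record IsSubgroup {n : ℕ} (S : (Fin n → ℤ) → Set) : Set where
  field
    S-ext : ∀ {x y} → (∀ v → x v ≡ y v) → S x → S y
    S-0   : S (λ _ → 0ℤ)
    S-+   : ∀ {x y} → S x → S y → S (λ v → x v +ᶻ y v)
    S-neg : ∀ {x} → S x → S (λ v → -ᶻ x v)

quotient : ∀ {n} {S : (Fin n → ℤ) → Set} → IsSubgroup S → AbelianGroup _ _
quotient {n} {S} isSubgroup = record
  { Carrier = Fin n → ℤ
  ; _≈_ = λ x y → S (λ v → x v -ᶻ y v)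
  ; _∙_ = λ x y v → x v +ᶻ y v
  ; ε = λ _ → 0ℤ
  ; _⁻¹ = λ x v → -ᶻ x v
  ; isAbelianGroup = record
    { isGroup = record
      { isMonoid = record
        { isSemigroup = record
          { isMagma = record
            { isEquivalence = record
              { refl  = λ {x} → pointwise {x} {x} (λ v → refl)
              ; sym   = λ {x} {y} p → S-ext (λ v → arith₁ (x v) (y v)) (S-neg p)
              ; trans = λ {x} {y} {z} p q → S-ext (λ v → arith₂ (x v) (y v) (z v)) (S-+ p q)
              }
            ; ∙-cong = λ {x} {y} {u} {v} p q → S-ext (λ w → arith₃ (x w) (y w) (u w) (v w)) (S-+ p q)
            }
          ; assoc = λ x y z → pointwise (λ v → ℤ.+-assoc (x v) (y v) (z v))
          }
        ; identity = (λ x → pointwise (λ v → ℤ.+-identityˡ (x v))) , (λ x → pointwise (λ v → ℤ.+-identityʳ (x v)))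
        }
      ; inverse = (λ x → pointwise (λ v → ℤ.+-inverseˡ (x v))) , (λ x → pointwise (λ v → ℤ.+-inverseʳ (x v)))
      ; ⁻¹-cong = λ {x} {y} p → S-ext (λ v → arith₄ (x v) (y v)) (S-neg p)
      }
    ; comm = λ x y → pointwise (λ v → ℤ.+-comm (x v) (y v))
    }
  }
  where
  open IsSubgroup isSubgroup
  pointwise : ∀ {x y : Fin n → ℤ} → (∀ v → x v ≡ y v) → S (λ v → x v -ᶻ y v)
  pointwise {x} {y} eq = S-ext (λ v → sym (ℤ.i≡j⇒i-j≡0 (eq v))) S-0
  arith₁ : ∀ x y → -ᶻ (x -ᶻ y) ≡ y -ᶻ x
  arith₁ = solve-∀ᶻ
  arith₂ : ∀ x y z → (x -ᶻ y) +ᶻ (y -ᶻ z) ≡ x -ᶻ z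
  arith₂ = solve-∀ᶻ
  arith₃ : ∀ x y u v → (x -ᶻ y) +ᶻ (u -ᶻ v) ≡ (x +ᶻ u) -ᶻ (y +ᶻ v)
  arith₃ = solve-∀ᶻ
  arith₄ : ∀ x y → -ᶻ (x -ᶻ y) ≡ -ᶻ x -ᶻ -ᶻ y
  arith₄ = solve-∀ᶻ

sumFin-∑ : ∀ {t} (f : Fin t → ℤ) → sumFin t f ≡ ∑ᶻ (allFin t) f
sumFin-∑ f = go id f
  where
  go : ∀ {k t} (g : Fin k → Fin t) (f : Fin t → ℤ) → sumFin k (f ∘ g) ≡ ∑ᶻ (tabulate g) f
  go {zero}  g f = refl
  go {suc k} g f = cong (f (g zero) +ᶻ_) (go (g ∘ suc) f)

∑-ind : ∀ {n} (φ : Fin n → ℤ) a → ∑ᶻ (allFin n) (λ v → φ v *ᶻ ind v a) ≡ φ a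
∑-ind {n} φ a = trans (Int∑.∑-cong (allFin n) (λ v _ → flag v)) (Int∑.∑-point a φ)
  where
  flag : ∀ v → φ v *ᶻ ind v a ≡ (if does (a ≟ v) then φ v else 0ℤ)
  flag v with v ≟ a | a ≟ v
  ... | yes _    | yes _    = ℤ.*-identityʳ (φ v)
  ... | no _     | no _     = ℤ.*-zeroʳ (φ v)
  ... | yes refl | no ≢     = contradiction refl ≢
  ... | no ≢     | yes refl = contradiction refl ≢

module Relations {t n : ℕ} (white : Fin t → Face n) where

  Span : (Fin n → ℤ) → Set
  Span x = Σ (Fin t → ℤ) λ c → ∀ v → x v ≡ sumFin t (λ i → c i *ᶻ occ v (white i))

  combination : (c : Fin t → ℤ) → ∀ v → sumFin t (λ i → c i *ᶻ occ v (white i)) ≡ ∑ᶻ (allFin t) (λ i → c i *ᶻ occ v (white i))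
  combination c v = sumFin-∑ (λ i → c i *ᶻ occ v (white i))

  combination-0 : ∀ v → 0ℤ ≡ sumFin t (λ i → 0ℤ *ᶻ occ v (white i))
  combination-0 v = sym (trans (combination (λ _ → 0ℤ) v) (trans (Int∑.∑-cong (allFin t) (λ i _ → ℤ.*-zeroˡ (occ v (white i)))) (Int∑.∑-ε (allFin t))))

  module Extended (p q : Fin n) where

    -- The relations of A_W with two vertices killed. The coefficients `a` and `b` stay visible so
    -- that homomorphisms to ℤ can later show them to be zero.
    Span⁺ : (Fin n → ℤ) → Set
    Span⁺ x = Σ ℤ λ a → Σ ℤ λ b → Span (λ v → x v -ᶻ (a *ᶻ ind v p +ᶻ b *ᶻ ind v q))

    isSubgroup : IsSubgroup Span⁺
    isSubgroup = record
      { S-ext = λ x≡y (a , b , c , eq) → a , b , c , λ v → trans (cong (_-ᶻ (a *ᶻ ind v p +ᶻ b *ᶻ ind v q)) (sym (x≡y v))) (eq v)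
      ; S-0 = 0ℤ , 0ℤ , (λ _ → 0ℤ) , combination-0
      ; S-+ = λ {x} {y} (a , b , c , eq) (a′ , b′ , c′ , eq′) → a +ᶻ a′ , b +ᶻ b′ , (λ i → c i +ᶻ c′ i) , λ v →
          trans (arith (x v) (y v) a a′ b b′ (ind v p) (ind v q))
          (trans (cong₂ _+ᶻ_ (trans (eq v) (combination c v)) (trans (eq′ v) (combination c′ v)))
          (trans (sym (Int∑.∑-∙ (allFin t) (λ i → c i *ᶻ occ v (white i)) (λ i → c′ i *ᶻ occ v (white i))))
          (trans (Int∑.∑-cong (allFin t) (λ i _ → sym (ℤ.*-distribʳ-+ (occ v (white i)) (c i) (c′ i)))) (sym (combination (λ i → c i +ᶻ c′ i) v)))))
      ; S-neg = λ {x} (a , b , c , eq) → -ᶻ a , -ᶻ b , (λ i → -ᶻ c i) , λ v →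
          trans (arith′ (x v) a b (ind v p) (ind v q))
          (trans (cong -ᶻ_ (trans (eq v) (combination c v)))
          (trans (negate (allFin t) (λ i → c i *ᶻ occ v (white i)))
          (trans (Int∑.∑-cong (allFin t) (λ i _ → ℤ.neg-distribˡ-* (c i) (occ v (white i)))) (sym (combination (λ i → -ᶻ c i) v)))))
      }
      where
      arith : ∀ x y a a′ b b′ p q → (x +ᶻ y) -ᶻ ((a +ᶻ a′) *ᶻ p +ᶻ (b +ᶻ b′) *ᶻ q)
                ≡ (x -ᶻ (a *ᶻ p +ᶻ b *ᶻ q)) +ᶻ (y -ᶻ (a′ *ᶻ p +ᶻ b′ *ᶻ q))
      arith = solve-∀ᶻ
      arith′ : ∀ x a b p q → -ᶻ x -ᶻ (-ᶻ a *ᶻ p +ᶻ -ᶻ b *ᶻ q) ≡ -ᶻ (x -ᶻ (a *ᶻ p +ᶻ b *ᶻ q))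
      arith′ = solve-∀ᶻ
      negate : ∀ {A : Set} (l : List A) (f : A → ℤ) → -ᶻ ∑ᶻ l f ≡ ∑ᶻ l (λ i → -ᶻ f i)
      negate []      f = refl
      negate (i ∷ l) f = trans (ℤ.neg-distrib-+ (f i) _) (cong (-ᶻ f i +ᶻ_) (negate l f))

    span⇒span⁺ : ∀ {x} → Span x → Span⁺ x
    span⇒span⁺ {x} (c , eq) = 0ℤ , 0ℤ , c , λ v → trans (arith (x v) (ind v p) (ind v q)) (eq v)
      where
      arith : ∀ x p q → x -ᶻ (0ℤ *ᶻ p +ᶻ 0ℤ *ᶻ q) ≡ x
      arith = solve-∀ᶻ

    face∈ : ∀ i → Span⁺ (λ v → occ v (white i))
    face∈ i = span⇒span⁺ (δ , λ v → sym (trans (combination δ v)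
        (trans (Int∑.∑-cong (allFin t) (λ i′ _ → flag (does (i ≟ i′)) (occ v (white i′)))) (Int∑.∑-point i (λ i′ → occ v (white i′))))))
      where
      δ : Fin t → ℤ
      δ i′ = if does (i ≟ i′) then 1ℤ else 0ℤ
      flag : ∀ b x → (if b then 1ℤ else 0ℤ) *ᶻ x ≡ (if b then x else 0ℤ)
      flag true  x = ℤ.*-identityˡ x
      flag false x = ℤ.*-zeroˡ x

    p∈ : Span⁺ (λ v → ind v p)
    p∈ = 1ℤ , 0ℤ , (λ _ → 0ℤ) , λ v → trans (arith (ind v p) (ind v q)) (combination-0 v)
      where
      arith : ∀ x y → x -ᶻ (1ℤ *ᶻ x +ᶻ 0ℤ *ᶻ y) ≡ 0ℤ
      arith = solve-∀ᶻ

    q∈ : Span⁺ (λ v → ind v q)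
    q∈ = 0ℤ , 1ℤ , (λ _ → 0ℤ) , λ v → trans (arith (ind v p) (ind v q)) (combination-0 v)
      where
      arith : ∀ x y → y -ᶻ (0ℤ *ᶻ x +ᶻ 1ℤ *ᶻ y) ≡ 0ℤ
      arith = solve-∀ᶻ

  -- A labelling with zero sum on every white face is a homomorphism from A_W to ℤ, hence trivial on
  -- torsion.
  module Functional (φ : Fin n → ℤ) (φ-white : ∀ i → FaceSum.faceSum ℤ.+-0-commutativeMonoid φ (white i) ≡ 0ℤ) where

    ⟨φ,_⟩ : (Fin n → ℤ) → ℤ
    ⟨φ, x ⟩ = ∑ᶻ (allFin n) (λ v → φ v *ᶻ x v)

    φ-+ : ∀ x y → ⟨φ, (λ v → x v +ᶻ y v) ⟩ ≡ ⟨φ, x ⟩ +ᶻ ⟨φ, y ⟩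
    φ-+ x y = trans (Int∑.∑-cong (allFin n) (λ v _ → ℤ.*-distribˡ-+ (φ v) (x v) (y v))) (Int∑.∑-∙ (allFin n) _ _)

    φ-* : ∀ k x → ⟨φ, (λ v → k *ᶻ x v) ⟩ ≡ k *ᶻ ⟨φ, x ⟩
    φ-* k x = trans (Int∑.∑-cong (allFin n) (λ v _ → arith (φ v) k (x v))) (∑ᶻ-* (allFin n) k _)
      where
      arith : ∀ a b c → a *ᶻ (b *ᶻ c) ≡ b *ᶻ (a *ᶻ c)
      arith = solve-∀ᶻ

    φ-cong : ∀ {x y} → (∀ v → x v ≡ y v) → ⟨φ, x ⟩ ≡ ⟨φ, y ⟩
    φ-cong eq = Int∑.∑-cong (allFin n) (λ v _ → cong (φ v *ᶻ_) (eq v))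

    φ-face : ∀ i → ⟨φ, (λ v → occ v (white i)) ⟩ ≡ 0ℤ
    φ-face i = trans (φ-+ (λ v → ind v a +ᶻ ind v b) (λ v → ind v c))
      (trans (cong₂ _+ᶻ_ (trans (φ-+ (λ v → ind v a) (λ v → ind v b)) (cong₂ _+ᶻ_ (∑-ind φ a) (∑-ind φ b))) (∑-ind φ c))
      (trans (ℤ.+-assoc (φ a) (φ b) (φ c)) (φ-white i)))
      where
      a = proj₁ (white i)
      b = proj₁ (proj₂ (white i))
      c = proj₂ (proj₂ (white i))

    φ-span : ∀ {x} → Span x → ⟨φ, x ⟩ ≡ 0ℤ
    φ-span {x} (c , eq) = begin
      ∑ᶻ (allFin n) (λ v → φ v *ᶻ x v)
        ≡⟨ Int∑.∑-cong (allFin n) (λ v _ → trans (cong (φ v *ᶻ_) (trans (eq v) (combination c v)))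
             (trans (sym (∑ᶻ-* (allFin t) (φ v) (λ i → c i *ᶻ occ v (white i)))) (Int∑.∑-cong (allFin t) (λ i _ → arith (φ v) (c i) (occ v (white i)))))) ⟩
      ∑ᶻ (allFin n) (λ v → ∑ᶻ (allFin t) (λ i → c i *ᶻ (φ v *ᶻ occ v (white i))))
        ≡⟨ Int∑.∑-swap (allFin n) (allFin t) _ ⟩
      ∑ᶻ (allFin t) (λ i → ∑ᶻ (allFin n) (λ v → c i *ᶻ (φ v *ᶻ occ v (white i))))
        ≡⟨ Int∑.∑-cong (allFin t) (λ i _ → trans (∑ᶻ-* (allFin n) (c i) _) (trans (cong (c i *ᶻ_) (φ-face i)) (ℤ.*-zeroʳ (c i)))) ⟩
      ∑ᶻ (allFin t) (λ _ → 0ℤ)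
        ≡⟨ Int∑.∑-ε (allFin t) ⟩
      0ℤ ∎
      where
      open ≡-Reasoning
      arith : ∀ a b c → a *ᶻ (b *ᶻ c) ≡ b *ᶻ (a *ᶻ c)
      arith = solve-∀ᶻ

    φ-torsion : ∀ {x} k → 1 ≤ k → Span (λ v → + k *ᶻ x v) → ⟨φ, x ⟩ ≡ 0ℤ
    φ-torsion {x} (suc k) _ s = ℤ.*-cancelˡ-≡ (+ suc k) ⟨φ, x ⟩ 0ℤ (trans (sym (φ-* (+ suc k) x)) (trans (φ-span s) (sym (ℤ.*-zeroʳ (+ suc k)))))

-- Classes represented by nonnegative sums of chips

module Cone {c ℓ} (𝔾 : AbelianGroup c ℓ) {n : ℕ} (e : Fin n → AbelianGroup.Carrier 𝔾) (P : Fin n → Set) where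
  open AbelianGroup 𝔾 renaming (refl to ≈-refl; sym to ≈-sym; trans to ≈-trans)
  open ListSum commutativeMonoid
  open import Algebra.Properties.AbelianGroup 𝔾 using (⁻¹-∙-comm; ⁻¹-involutive; ε⁻¹≈ε)

  -- Routing accepts only nonnegative chips. Units, unlike the cone, are closed under inverses, so
  -- relations can be solved for a vertex.
  InCone Unit : Carrier → Set ℓ
  InCone x = ∃[ l ] All P l × x ≈ ∑ l e
  Unit x = InCone x × InCone (x ⁻¹)

  cone-≈ : ∀ {x y} → x ≈ y → InCone x → InCone y
  cone-≈ x≈y (l , Pl , eq) = l , Pl , ≈-trans (≈-sym x≈y) eq

  cone-ε : InCone ε
  cone-ε = [] , [] , ≈-refl

  cone-∙ : ∀ {x y} → InCone x → InCone y → InCone (x ∙ y)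
  cone-∙ (l , Pl , eq) (k , Pk , eq′) = l ++ k , All.++⁺ Pl Pk , ≈-trans (∙-cong eq eq′) (≈-sym (∑-++ l k e))

  cone-e : ∀ {v} → P v → InCone (e v)
  cone-e Pv = _ ∷ [] , Pv ∷ [] , ≈-sym (identityʳ _)

  cone-∑ : ∀ {A : Set} (l : List A) {g : A → Carrier} → (∀ i → i ∈ l → InCone (g i)) → InCone (∑ l g)
  cone-∑ []      h = cone-ε
  cone-∑ (i ∷ l) h = cone-∙ (h i (here refl)) (cone-∑ l (λ i i∈ → h i (there i∈)))

  unit-≈ : ∀ {x y} → x ≈ y → Unit x → Unit y
  unit-≈ x≈y (p , q) = cone-≈ x≈y p , cone-≈ (⁻¹-cong x≈y) q

  unit-ε : Unit ε
  unit-ε = cone-ε , cone-≈ (≈-sym ε⁻¹≈ε) cone-ε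

  unit-∙ : ∀ {x y} → Unit x → Unit y → Unit (x ∙ y)
  unit-∙ (p , q) (p′ , q′) = cone-∙ p p′ , cone-≈ (⁻¹-∙-comm _ _) (cone-∙ q q′)

  unit-⁻¹ : ∀ {x} → Unit x → Unit (x ⁻¹)
  unit-⁻¹ (p , q) = q , cone-≈ (≈-sym (⁻¹-involutive _)) p

-- The order of the torsion subgroup

-- On the vertices of colour k, each black face gives an arc from its own
-- vertex to the opposite vertex of the white face across its l-m edge; the
-- arcs around a vertex of colour l form a directed circuit.
module Derived {t n : ℕ} (𝕋 : Trade t n) (k l m : Fin 3) (k≢l : k ≢ l) (l≢m : l ≢ m) (k≢m : k ≢ m) where
  open Trade 𝕋

  α⁻¹∘α : ∀ {x} j → α⁻¹ x (α x j) ≡ j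
  α⁻¹∘α {x} j = let (y , z , x≢y , x≢z , y≢z) = others x in
    b-unique y≢z (trans (α⁻¹-edge x≢y (α x j)) (α-edge x≢y j)) (trans (α⁻¹-edge x≢z (α x j)) (α-edge x≢z j))
    where
    others : ∀ x → ∃[ y ] ∃[ z ] x ≢ y × x ≢ z × y ≢ z
    others x = next x , next (next x) , next≢ x , next²≢ x , next≢ (next x)

  α∘α⁻¹ : ∀ {x} i → α x (α⁻¹ x i) ≡ i
  α∘α⁻¹ {x} i = let (y , z , x≢y , x≢z , y≢z) = others x in
    w-unique y≢z (trans (α-edge x≢y (α⁻¹ x i)) (α⁻¹-edge x≢y i)) (trans (α-edge x≢z (α⁻¹ x i)) (α⁻¹-edge x≢z i))
    where
    others : ∀ x → ∃[ y ] ∃[ z ] x ≢ y × x ≢ z × y ≢ z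
    others x = next x , next (next x) , next≢ x , next²≢ x , next≢ (next x)

  digraph : HubDigraph t n
  digraph = record
    { tail = b k
    ; head = λ j → w k (α k j)
    ; hub = b l
    -- Entering the white face across the l-m edge and leaving it across its k-l edge turns about
    -- the vertex of colour `l`.
    ; τ = α⁻¹ m ∘ α k
    ; τ⁻¹ = α⁻¹ k ∘ α m
    ; τ⁻¹∘τ = λ j → trans (cong (α⁻¹ k) (α∘α⁻¹ (α k j))) (α⁻¹∘α j)
    ; τ∘τ⁻¹ = λ j → trans (cong (α⁻¹ m) (α∘α⁻¹ (α m j))) (α⁻¹∘α j)
    ; tail-τ = λ j → α⁻¹-edge (≢-sym k≢m) (α k j)
    ; hub-τ = λ j → trans (α⁻¹-edge (≢-sym l≢m) (α k j)) (α-edge k≢l j)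
    ; simple = b-unique k≢l
    ; connected = λ P forwards backwards {i} {j} p →
        subst P (α-edge (≢-sym k≢l) j) (connected (P ∘ w k) (step P forwards backwards) (subst P (sym (α-edge (≢-sym k≢l) i)) p))
    }
    where
    -- Of the white faces around the black face `j`, `α k j` has the head as its vertex of colour
    -- `k`; the other two have the tail.
    step : (P : Fin n → Set) → (∀ j → P (b k j) → P (w k (α k j))) → (∀ j → P (w k (α k j)) → P (b k j)) →
           ∀ j x y → P (w k (α x j)) → P (w k (α y j))
    step P forwards backwards j x y p with x ≟ k | y ≟ k
    ... | yes refl | yes refl = p
    ... | yes refl | no y≢k   = subst P (sym (α-edge y≢k j)) (backwards j p)
    ... | no x≢k   | yes refl = forwards j (subst P (α-edge x≢k j) p)
    ... | no x≢k   | no y≢k   = subst P (trans (α-edge x≢k j) (sym (α-edge y≢k j))) p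

  open HubDigraph digraph using (arcsAt; ∈-arcsAt; arcsAt-tail; tail-τ; reachForwards; τ)

  w-distinct : ∀ {x y} → x ≢ y → ∀ i → w x i ≢ w y i
  w-distinct x≢y i eq = x≢y (trans (sym (κ-w _ i)) (trans (cong κ eq) (κ-w _ i)))

  WhiteFacesVanish : (𝔾 : AbelianGroup 0ℓ 0ℓ) → (Fin n → AbelianGroup.Carrier 𝔾) → Set
  WhiteFacesVanish 𝔾 e = ∀ i → e (w k i) ∙ (e (w l i) ∙ e (w m i)) ≈ ε
    where open AbelianGroup 𝔾

  module Chips (𝔾 : AbelianGroup 0ℓ 0ℓ) (e : Fin n → AbelianGroup.Carrier 𝔾) (i₀ : Fin t)
    (e-root : Trivial 𝔾 (e (b k i₀))) (e-hub : Trivial 𝔾 (e (b l i₀))) (white-relation : WhiteFacesVanish 𝔾 e) where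

    open AbelianGroup 𝔾 renaming (refl to ≈-refl; sym to ≈-sym; trans to ≈-trans) hiding (_-_)
    open ListSum commutativeMonoid
    open import Algebra.Properties.AbelianGroup 𝔾 using (⁻¹-∙-comm; ⁻¹-involutive; ε⁻¹≈ε; inverseˡ-unique; inverseʳ-unique; ∙-cancelʳ)
    open import Algebra.Properties.CommutativeSemigroup commutativeSemigroup
    open import Relation.Binary.Reasoning.Setoid setoid

    head-relation : ∀ j → e (w k (α k j)) ⁻¹ ≈ e (b l j) ∙ e (b m j)
    head-relation j = ≈-sym (inverseʳ-unique _ _ (≈-trans
      (∙-congˡ (∙-cong (reflexive (cong e (sym (α-edge k≢l j)))) (reflexive (cong e (sym (α-edge k≢m j))))))
      (white-relation (α k j))))

    -- By `head-relation` each term is the sum of the vertices of a black face at `v`. Crossing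
    -- edges at `v` matches these vertices, colour by colour, with those of the white faces at `v`,
    -- whose sums vanish.
    arcs-relation : ∀ v → ∑ (arcsAt v) (λ j → e (b k j) ∙ e (w k (α k j)) ⁻¹) ≈ ε
    arcs-relation v = begin
      ∑ (arcsAt v) (λ j → e (b k j) ∙ e (w k (α k j)) ⁻¹)
        ≈⟨ ∑-cong (arcsAt v) (λ j _ → ∙-congˡ (head-relation j)) ⟩
      ∑ (arcsAt v) (λ j → e (b k j) ∙ (e (b l j) ∙ e (b m j)))
        ≈⟨ ≈-trans (∑-∙ (arcsAt v) _ _) (∙-congˡ (∑-∙ (arcsAt v) _ _)) ⟩
      ∑ (arcsAt v) (e ∘ b k) ∙ (∑ (arcsAt v) (e ∘ b l) ∙ ∑ (arcsAt v) (e ∘ b m))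
        ≈⟨ ∙-cong (reindex k≢m k≢m) (∙-cong (reindex k≢m l≢m) (reindex k≢l (≢-sym l≢m))) ⟩
      ∑ faces (e ∘ w k) ∙ (∑ faces (e ∘ w l) ∙ ∑ faces (e ∘ w m))
        ≈⟨ ≈-trans (∑-∙ faces _ _) (∙-congˡ (∑-∙ faces _ _)) ⟨
      ∑ faces (λ i → e (w k i) ∙ (e (w l i) ∙ e (w m i)))
        ≈⟨ ≈-trans (∑-cong faces (λ i _ → white-relation i)) (∑-ε faces) ⟩
      ε ∎
      where
      faces : List (Fin t)
      faces = filter (λ i → w k i ≟ v) (allFin t)
      reindex : ∀ {x y} → k ≢ x → y ≢ x → ∑ (arcsAt v) (e ∘ b y) ≈ ∑ faces (e ∘ w y)
      reindex {x} {y} k≢x y≢x = ≈-trans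
        (∑-cong (arcsAt v) (λ j _ → reflexive (cong e (sym (α-edge (≢-sym y≢x) j)))))
        (∑-fibre-bijection (α x) (α⁻¹ x) α⁻¹∘α α∘α⁻¹ (b k) (w k) (α-edge (≢-sym k≢x)) (e ∘ w y) v)

    open Cone 𝔾 e (λ v → ∃[ j ] b k j ≡ v)

    cone-tail : ∀ j → InCone (e (b k j))
    cone-tail j = cone-e (j , refl)

    cone-head : ∀ j → InCone (e (w k (α k j)))
    cone-head j = subst (InCone ∘ e) (tail-τ j) (cone-tail (τ j))

    -- A relation d·v = Σ heads expresses the negative of one head through the others and −v.
    negative-head : ∀ j → InCone (e (b k j) ⁻¹) → InCone (e (w k (α k j)) ⁻¹)
    negative-head j neg = cone-≈ eq (cone-∙ (others (arcsAt (b k j)) (∈-arcsAt j))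
        (cone-∑ (arcsAt (b k j)) (λ i i∈ → subst (λ u → InCone (e u ⁻¹)) (sym (arcsAt-tail i∈)) neg)))
      where
      h : Fin t → Carrier
      h i = e (w k (α k i))
      others : ∀ l → j ∈ l → InCone (h j ⁻¹ ∙ ∑ l h)
      others (i ∷ l) (here refl) = cone-≈ (≈-sym (≈-trans (≈-sym (assoc _ _ _)) (≈-trans (∙-congʳ (inverseˡ _)) (identityˡ _)))) (cone-∑ l (λ i _ → cone-head i))
      others (i ∷ l) (there j∈)  = cone-≈ (x∙yz≈y∙xz _ _ _) (cone-∙ (cone-head i) (others l j∈))
      l₀ = arcsAt (b k j)
      eq : (h j ⁻¹ ∙ ∑ l₀ h) ∙ ∑ l₀ (λ i → e (b k i) ⁻¹) ≈ h j ⁻¹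
      eq = begin
        (h j ⁻¹ ∙ ∑ l₀ h) ∙ ∑ l₀ (λ i → e (b k i) ⁻¹)
          ≈⟨ assoc _ _ _ ⟩
        h j ⁻¹ ∙ (∑ l₀ h ∙ ∑ l₀ (λ i → e (b k i) ⁻¹))
          ≈⟨ ∙-congˡ (∑-∙ l₀ _ _) ⟨
        h j ⁻¹ ∙ ∑ l₀ (λ i → h i ∙ e (b k i) ⁻¹)
          ≈⟨ ∙-congˡ (≈-trans (∑-cong l₀ (λ i _ → ≈-trans (comm _ _) (≈-trans (∙-congˡ (≈-sym (⁻¹-involutive _))) (⁻¹-∙-comm _ _)))) (∑-⁻¹ l₀)) ⟩
        h j ⁻¹ ∙ (∑ l₀ (λ i → e (b k i) ∙ h i ⁻¹)) ⁻¹
          ≈⟨ ∙-congˡ (≈-trans (⁻¹-cong (arcs-relation (b k j))) ε⁻¹≈ε) ⟩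
        h j ⁻¹ ∙ ε
          ≈⟨ identityʳ _ ⟩
        h j ⁻¹ ∎
        where
        ∑-⁻¹ : ∀ l {g : Fin t → Carrier} → ∑ l (λ i → g i ⁻¹) ≈ (∑ l g) ⁻¹
        ∑-⁻¹ []      = ≈-sym ε⁻¹≈ε
        ∑-⁻¹ (i ∷ l) = ≈-trans (∙-congˡ (∑-⁻¹ l)) (⁻¹-∙-comm _ _)

    -- Negatives start at the root, whose class is trivial, and `negative-head` carries them along
    -- the arcs.
    unit-tail : ∀ j → Unit (e (b k j))
    unit-tail j = cone-tail j , reachForwards (λ v → InCone (e v ⁻¹)) negative-head {i₀} {j}
      (cone-≈ (≈-sym (≈-trans (⁻¹-cong e-root) ε⁻¹≈ε)) cone-ε)

    unit-head : ∀ j → Unit (e (w k (α k j)))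
    unit-head j = subst (Unit ∘ e) (tail-τ j) (unit-tail (τ j))

    white-relation′ : ∀ i → e (w l i) ∙ (e (w k i) ∙ e (w m i)) ≈ ε
    white-relation′ i = ≈-trans (x∙yz≈y∙xz _ _ _) (white-relation i)

    -- Both sides are minus the class of `b m j`, by the white faces across the k-m and l-m edges of
    -- the black face `j`.
    exchange : ∀ j → e (w l (α l j)) ∙ e (b k j) ≈ e (b l j) ∙ e (w k (α k j))
    exchange j = ≈-trans (inverseˡ-unique _ _ (≈-trans (assoc _ _ _)
        (≈-trans (∙-congˡ (∙-cong (reflexive (cong e (sym (α-edge (≢-sym k≢l) j)))) (reflexive (cong e (sym (α-edge l≢m j))))))
          (white-relation′ (α l j)))))
      (≈-sym (inverseˡ-unique _ _ (≈-trans (assoc _ _ _)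
        (≈-trans (∙-cong (reflexive (cong e (sym (α-edge k≢l j)))) (∙-congˡ (reflexive (cong e (sym (α-edge k≢m j))))))
          (white-relation′ (α k j))))))

    unit-quotient : ∀ {x y z u} → x ∙ y ≈ z ∙ u → Unit y → Unit z → Unit u → Unit x
    unit-quotient {x} {y} {z} {u} eq Uy Uz Uu = unit-≈
      (≈-trans (∙-congʳ (≈-sym eq)) (≈-trans (assoc _ _ _) (≈-trans (∙-congˡ (inverseʳ y)) (identityʳ x))))
      (unit-∙ (unit-∙ Uz Uu) (unit-⁻¹ Uy))

    -- The vertices of colour `l` on neighbouring white faces agree or, by `exchange`, differ by
    -- units of colour `k`. So units spread from the killed hub.
    unit-hub : ∀ i → Unit (e (w l i))
    unit-hub i = connected (λ i → Unit (e (w l i))) step {α k i₀} {i}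
      (subst (Unit ∘ e) (sym (α-edge k≢l i₀)) (unit-≈ (≈-sym e-hub) unit-ε))
      where
      step : ∀ j x y → Unit (e (w l (α x j))) → Unit (e (w l (α y j)))
      step j x y U with x ≟ l | y ≟ l
      ... | yes refl | yes refl = U
      ... | no x≢l   | no y≢l   = subst (Unit ∘ e) (trans (α-edge x≢l j) (sym (α-edge y≢l j))) U
      ... | no x≢l   | yes refl = unit-quotient (exchange j) (unit-tail j) (subst (Unit ∘ e) (α-edge x≢l j) U) (unit-head j)
      ... | yes refl | no y≢l   = subst (Unit ∘ e) (sym (α-edge y≢l j)) (unit-quotient (≈-sym (exchange j)) (unit-head j) U (unit-tail j))

    unit-third : ∀ i → Unit (e (w m i))
    unit-third i = unit-≈ (≈-sym (inverseʳ-unique _ _ (≈-trans (assoc _ _ _) (white-relation i))))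
      (unit-⁻¹ (unit-∙ (subst (Unit ∘ e) (trans (sym (α-edge (≢-sym k≢m) (α⁻¹ m i))) (cong (w k) (α∘α⁻¹ i))) (unit-tail (α⁻¹ m i))) (unit-hub i)))

    unit-vertex : (∀ x → x ≡ k ⊎ x ≡ l ⊎ x ≡ m) → ∀ v → Unit (e v)
    unit-vertex exhaust v with cover v | exhaust (κ v)
    ... | j , eq | inj₁ κ≡        = subst (Unit ∘ e) (trans (cong (λ x → b x j) (sym κ≡)) eq) (unit-tail j)
    ... | j , eq | inj₂ (inj₁ κ≡) = subst (Unit ∘ e) (trans (α-edge k≢l j) (trans (cong (λ x → b x j) (sym κ≡)) eq)) (unit-hub (α k j))
    ... | j , eq | inj₂ (inj₂ κ≡) = subst (Unit ∘ e) (trans (α-edge k≢m j) (trans (cong (λ x → b x j) (sym κ≡)) eq)) (unit-third (α k j))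

    open Rotors digraph i₀ using (Rotor; Reduced; Admissible; choices; choices-nonempty; energy; module InGroup)
    open InGroup energy 𝔾 e e-root (arcs-relation ∘ b k)

    private
      initial : Rotor
      initial = Vec.tabulate (proj₁ ∘ choices-nonempty)

    -- Routing always starts from the same rotor, so `f` determines the class as Θ f minus Θ
    -- `initial`: distinct classes need distinct rotors.
    Represents : Rotor → Carrier → Set
    Represents f x = Reduced f × x ∙ Θ initial ≈ Θ f

    representative : ∀ {x} → InCone x → ∃[ f ] Represents f x
    representative (chips , tails , x≈) =
      let f , reduced , eq = route _ chips initial tails initial-admissible ℕ.≤-refl in f , reduced , ≈-trans (∙-congʳ x≈) eq
      where
      initial-admissible : Admissible initial
      initial-admissible v = subst (_∈ choices v) (sym (lookup∘tabulate (proj₁ ∘ choices-nonempty) v)) (proj₂ (choices-nonempty v))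

    represents-injective : ∀ {f x y} → Represents f x → Represents f y → x ≈ y
    represents-injective (_ , p) (_ , q) = ∙-cancelʳ _ _ _ (≈-trans p (≈-sym q))

  open Relations white

  module Torsion (i₀ : Fin t) (exhaust : ∀ x → x ≡ k ⊎ x ≡ l ⊎ x ≡ m) where
    open Rotors digraph i₀

    private
      c₀ : Fin n
      c₀ = b l i₀

    open Extended root c₀

    𝔾 : AbelianGroup 0ℓ 0ℓ
    𝔾 = quotient isSubgroup

    module 𝔾 = AbelianGroup 𝔾

    e : Fin n → Fin n → ℤ
    e u v = ind v u

    fromSpan : ∀ x {y} → Span⁺ x → (∀ v → x v ≡ y v) → y 𝔾.≈ 𝔾.ε
    fromSpan x {y} x∈ x≡y = IsSubgroup.S-ext isSubgroup (λ v → trans (x≡y v) (sym (ℤ.+-identityʳ (y v)))) x∈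

    white-relation : ∀ i → e (w k i) 𝔾.∙ (e (w l i) 𝔾.∙ e (w m i)) 𝔾.≈ 𝔾.ε
    white-relation i = fromSpan (λ v → occ v (white i)) (face∈ i) λ v →
      trans (ℤ.+-assoc (ind v (proj₁ (white i))) _ _)
        (FaceSum.faceSum-permute ℤ.+-0-commutativeMonoid (ind v) (white i)
          (w-distinct k≢l i) (w-distinct l≢m i) (w-distinct k≢m i) (w∈ k i) (w∈ l i) (w∈ m i))

    open Chips 𝔾 e i₀ (fromSpan (e root) p∈ (λ v → refl)) (fromSpan (e c₀) q∈ (λ v → refl)) white-relation
    open Cone 𝔾 e (λ v → ∃[ j ] b k j ≡ v)

    unit-pointwise : ∀ {x y} → (∀ v → x v ≡ y v) → Unit x → Unit y
    unit-pointwise {x} {y} eq = unit-≈ {x} {y} (IsSubgroup.S-ext isSubgroup (λ v → sym (ℤ.i≡j⇒i-j≡0 (eq v))) (IsSubgroup.S-0 isSubgroup))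

    unit-natural : ∀ {x} → Unit x → ∀ z → Unit (λ v → + z *ᶻ x v)
    unit-natural {x} U zero    = unit-pointwise (λ v → sym (ℤ.*-zeroˡ (x v))) unit-ε
    unit-natural {x} U (suc z) = unit-pointwise (λ v → sym (ℤ.suc-* (+ z) (x v))) (unit-∙ {x} {λ v → + z *ᶻ x v} U (unit-natural {x} U z))

    unit-multiple : ∀ {x} → Unit x → ∀ z → Unit (λ v → z *ᶻ x v)
    unit-multiple {x} U (+ z)    = unit-natural {x} U z
    unit-multiple {x} U -[1+ z ] = unit-pointwise (λ v → ℤ.neg-distribˡ-* (+ suc z) (x v)) (unit-⁻¹ {λ v → + suc z *ᶻ x v} (unit-natural {x} U (suc z)))

    unit-all : ∀ x → Unit x
    unit-all x = unit-pointwise decomposition (go (allFin n))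
      where
      go : ∀ l → Unit (λ v → Int∑.∑ l (λ u → x u *ᶻ ind v u))
      go []      = unit-ε
      go (u ∷ l) = unit-∙ {λ v → x u *ᶻ ind v u} {λ v → Int∑.∑ l (λ u → x u *ᶻ ind v u)} (unit-multiple {e u} (unit-vertex exhaust u) (x u)) (go l)
      decomposition : ∀ v → Int∑.∑ (allFin n) (λ u → x u *ᶻ ind v u) ≡ x v
      decomposition v = trans (Int∑.∑-cong (allFin n) (λ u _ → flag (does (v ≟ u)) (x u))) (Int∑.∑-point v x)
        where
        flag : ∀ b z → z *ᶻ (if b then + 1 else + 0) ≡ (if b then z else 0ℤ)
        flag true  z = ℤ.*-identityʳ z
        flag false z = ℤ.*-zeroʳ z

    private
      ind-same : ∀ (x : Fin 3) → ind x x ≡ 1ℤ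
      ind-same x with x ≟ x
      ... | yes _  = refl
      ... | no x≢x = contradiction refl x≢x

      ind-other : ∀ {x y : Fin 3} → x ≢ y → ind x y ≡ 0ℤ
      ind-other {x} {y} x≢y with x ≟ y
      ... | yes x≡y = contradiction x≡y x≢y
      ... | no _    = refl

    -- Every white face has one vertex of each colour, so `φ k` and `φ l` are homomorphisms from A_W
    -- to ℤ; they detect its free part.
    φ : Fin 3 → Fin n → ℤ
    φ x v = ind (κ v) x -ᶻ ind (κ v) m

    φ-value : ∀ x {v y} {p q} → κ v ≡ y → ind y x ≡ p → ind y m ≡ q → φ x v ≡ p -ᶻ q
    φ-value x κ≡ p≡ q≡ = cong₂ _-ᶻ_ (trans (cong (λ y → ind y x) κ≡) p≡) (trans (cong (λ y → ind y m) κ≡) q≡)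

    φ-face : ∀ x i → FaceSum.faceSum ℤ.+-0-commutativeMonoid (φ x) (white i) ≡ φ x (w k i) +ᶻ (φ x (w l i) +ᶻ φ x (w m i))
    φ-face x i = FaceSum.faceSum-permute ℤ.+-0-commutativeMonoid (φ x) (white i)
      (w-distinct k≢l i) (w-distinct l≢m i) (w-distinct k≢m i) (w∈ k i) (w∈ l i) (w∈ m i)

    φk-white : ∀ i → FaceSum.faceSum ℤ.+-0-commutativeMonoid (φ k) (white i) ≡ 0ℤ
    φk-white i = trans (φ-face k i) (cong₂ _+ᶻ_ (φ-value k (κ-w k i) (ind-same k) (ind-other k≢m))
      (cong₂ _+ᶻ_ (φ-value k (κ-w l i) (ind-other (≢-sym k≢l)) (ind-other l≢m)) (φ-value k (κ-w m i) (ind-other (≢-sym k≢m)) (ind-same m))))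

    φl-white : ∀ i → FaceSum.faceSum ℤ.+-0-commutativeMonoid (φ l) (white i) ≡ 0ℤ
    φl-white i = trans (φ-face l i) (cong₂ _+ᶻ_ (φ-value l (κ-w k i) (ind-other k≢l) (ind-other k≢m))
      (cong₂ _+ᶻ_ (φ-value l (κ-w l i) (ind-same l) (ind-other l≢m)) (φ-value l (κ-w m i) (ind-other (≢-sym l≢m)) (ind-same m))))

    module Φk = Functional (φ k) φk-white
    module Φl = Functional (φ l) φl-white

    -- The pair of `φ k` and `φ l` takes the values (1, 0) at the root and (0, 1) at `c₀`, so
    -- evaluation at `x` gives a = b = 0.
    span⁺⇒span : ∀ {x} → Φk.⟨φ, x ⟩ ≡ 0ℤ → Φl.⟨φ, x ⟩ ≡ 0ℤ → Span⁺ x → Span x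
    span⁺⇒span {x} xk xl (a , b , s@(c , eq)) = c , λ v → trans
        (sym (trans (cong₂ (λ a b → x v -ᶻ (a *ᶻ ind v root +ᶻ b *ᶻ ind v c₀)) a≡0 b≡0) (arith (x v) (ind v root) (ind v c₀)))) (eq v)
      where
      arith : ∀ x p q → x -ᶻ (0ℤ *ᶻ p +ᶻ 0ℤ *ᶻ q) ≡ x
      arith = solve-∀ᶻ
      z : Fin n → ℤ
      z v = x v -ᶻ (a *ᶻ ind v root +ᶻ b *ᶻ ind v c₀)
      restore : ∀ v → z v +ᶻ (a *ᶻ ind v root +ᶻ b *ᶻ ind v c₀) ≡ x v
      restore v = arith′ (x v) (a *ᶻ ind v root +ᶻ b *ᶻ ind v c₀)
        where
        arith′ : ∀ x y → (x -ᶻ y) +ᶻ y ≡ x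
        arith′ = solve-∀ᶻ
      evaluate : ∀ φ (φ-white : ∀ i → FaceSum.faceSum ℤ.+-0-commutativeMonoid φ (white i) ≡ 0ℤ) →
                 Functional.⟨φ,_⟩ φ φ-white x ≡ 0ℤ → a *ᶻ φ root +ᶻ b *ᶻ φ c₀ ≡ 0ℤ
      evaluate φ φ-white x0 = begin
        a *ᶻ φ root +ᶻ b *ᶻ φ c₀
          ≡⟨ cong₂ _+ᶻ_ (trans (φ-* a (λ v → ind v root)) (cong (a *ᶻ_) (∑-ind φ root))) (trans (φ-* b (λ v → ind v c₀)) (cong (b *ᶻ_) (∑-ind φ c₀))) ⟨
        ⟨φ, (λ v → a *ᶻ ind v root) ⟩ +ᶻ ⟨φ, (λ v → b *ᶻ ind v c₀) ⟩
          ≡⟨ φ-+ (λ v → a *ᶻ ind v root) (λ v → b *ᶻ ind v c₀) ⟨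
        ⟨φ, (λ v → a *ᶻ ind v root +ᶻ b *ᶻ ind v c₀) ⟩
          ≡⟨ trans (cong (_+ᶻ ⟨φ, (λ v → a *ᶻ ind v root +ᶻ b *ᶻ ind v c₀) ⟩) (φ-span s)) (ℤ.+-identityˡ _) ⟨
        ⟨φ, z ⟩ +ᶻ ⟨φ, (λ v → a *ᶻ ind v root +ᶻ b *ᶻ ind v c₀) ⟩
          ≡⟨ φ-+ z (λ v → a *ᶻ ind v root +ᶻ b *ᶻ ind v c₀) ⟨
        ⟨φ, (λ v → z v +ᶻ (a *ᶻ ind v root +ᶻ b *ᶻ ind v c₀)) ⟩
          ≡⟨ trans (φ-cong restore) x0 ⟩
        0ℤ ∎
        where
        open ≡-Reasoning
        open Functional φ φ-white
      a≡0 : a ≡ 0ℤ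
      a≡0 = trans (arith″ a b) (trans (sym (cong₂ (λ p q → a *ᶻ p +ᶻ b *ᶻ q)
          (φ-value k (κ-b k i₀) (ind-same k) (ind-other k≢m)) (φ-value k (κ-b l i₀) (ind-other (≢-sym k≢l)) (ind-other l≢m))))
        (evaluate (φ k) φk-white xk))
        where
        arith″ : ∀ a b → a ≡ a *ᶻ (1ℤ -ᶻ 0ℤ) +ᶻ b *ᶻ (0ℤ -ᶻ 0ℤ)
        arith″ = solve-∀ᶻ
      b≡0 : b ≡ 0ℤ
      b≡0 = trans (arith″ a b) (trans (sym (cong₂ (λ p q → a *ᶻ p +ᶻ b *ᶻ q)
          (φ-value l (κ-b k i₀) (ind-other k≢l) (ind-other k≢m)) (φ-value l (κ-b l i₀) (ind-same l) (ind-other l≢m))))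
        (evaluate (φ l) φl-white xl))
        where
        arith″ : ∀ a b → b ≡ a *ᶻ (0ℤ -ᶻ 0ℤ) +ᶻ b *ᶻ (1ℤ -ᶻ 0ℤ)
        arith″ = solve-∀ᶻ

    difference-vanishes : ∀ φ (φ-white : ∀ i → FaceSum.faceSum ℤ.+-0-commutativeMonoid φ (white i) ≡ 0ℤ) →
      let open Functional φ φ-white in ∀ x y → ⟨φ, x ⟩ ≡ 0ℤ → ⟨φ, y ⟩ ≡ 0ℤ → ⟨φ, (λ v → x v -ᶻ y v) ⟩ ≡ 0ℤ
    difference-vanishes φ φ-white x y x0 y0 = trans (φ-cong (λ v → cong (x v +ᶻ_) (sym (ℤ.-1*i≡-i (y v)))))
        (trans (φ-+ x (λ v → -ᶻ 1ℤ *ᶻ y v)) (cong₂ _+ᶻ_ x0 (trans (φ-* (-ᶻ 1ℤ) y) (cong (-ᶻ 1ℤ *ᶻ_) y0))))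
      where open Functional φ φ-white

    TorsionElement : (Fin n → ℤ) → Set
    TorsionElement x = Σ ℕ λ s → 1 ≤ s × Span (λ v → + s *ᶻ x v)

    torsion-separated : ∀ {x y} → TorsionElement x → TorsionElement y → x 𝔾.≈ y → Span (λ v → x v -ᶻ y v)
    torsion-separated {x} {y} (s , 1≤s , sx) (r , 1≤r , ry) x≈y = span⁺⇒span
      (difference-vanishes (φ k) φk-white x y (Φk.φ-torsion s 1≤s sx) (Φk.φ-torsion r 1≤r ry))
      (difference-vanishes (φ l) φl-white x y (Φl.φ-torsion s 1≤s sx) (Φl.φ-torsion r 1≤r ry)) x≈y

    -- Every vector lies in the cone and so has a reduced rotor. Equal rotors give equal classes
    -- modulo `Span⁺`, and for torsion elements this means modulo `Span`.
    inequivalent-rotors : ∀ {M} (g : Fin M → Fin n → ℤ) → (∀ i → TorsionElement (g i)) →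
      (∀ i j → ¬ i ≡ j → ¬ Span (λ v → g i v -ᶻ g j v)) →
      Σ (Fin M → Rotor) λ f → (∀ i → Reduced (f i)) × (∀ {i j} → f i ≡ f j → i ≡ j)
    inequivalent-rotors {M} g torsion distinct = choose (λ i → representative {g i} (proj₁ (unit-all (g i))))
      where
      choose : (∀ i → ∃[ f ] Represents f (g i)) → Σ (Fin M → Rotor) λ f → (∀ i → Reduced (f i)) × (∀ {i j} → f i ≡ f j → i ≡ j)
      choose rep = (λ i → proj₁ (rep i)) , (λ i → proj₁ (proj₂ (rep i))) , λ {i} {j} eq → decidable-stable (i ≟ j) λ i≢j →
        distinct i j i≢j (torsion-separated {g i} {g j} (torsion i) (torsion j)
          (represents-injective {proj₁ (rep i)} {g i} {g j} (proj₂ (rep i)) (subst (λ h → Represents h (g j)) (sym eq) (proj₂ (rep j)))))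

-- Combining the three colours

^-cancelˡ-≤ : ∀ k {x y} → x ^ suc k ≤ y ^ suc k → x ≤ y
^-cancelˡ-≤ k {x} {y} le with x ≤? y
... | yes x≤y = x≤y
... | no x≰y  = contradiction le (ℕ.<⇒≱ (ℕ.^-monoˡ-< (suc k) (ℕ.≰⇒> x≰y)))

module Bound (q H A B K num den : ℕ) (1≤H : 1 ≤ H) (1≤A : 1 ≤ A) (A≤H : A ≤ H)
  (reciprocal : ∀ p → (p ∸ 1) ^ suc q * H ≤ p ^ suc q * p)
  (small : ∀ d → d < K → d ^ suc q * d ^ d ≤ A * B ^ d)
  (large : ∀ d → K ≤ d → d ^ suc q * H ^ d ≤ A * B ^ d)
  (rooted : ∀ d → H ^ d ≤ A * B ^ d)
  (balance : A * B ^ 3 * den ^ (suc q * 3) ≤ H * num ^ (suc q * 3))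
  where

  module _ {t n : ℕ} (𝕋 : Trade t n) (i₀ : Fin t) where
    open Trade 𝕋
    open Relations white

    supports : ℕ → Fin 3 → ℕ
    supports x k = ∏ (allFin n) (support (b k) x)

    module _ {M} (g : Fin M → Fin n → ℤ) (torsion : ∀ i → Σ ℕ λ s → 1 ≤ s × Span (λ v → ℤ.+ s ℤ.* g i v))
      (distinct : ∀ i j → ¬ i ≡ j → ¬ Span (λ v → g i v ℤ.- g j v)) where

      colour-bound : ∀ k l m → k ≢ l → l ≢ m → k ≢ m → (∀ x → x ≡ k ⊎ x ≡ l ⊎ x ≡ m) →
                     M ^ suc q * supports H l ≤ supports A k * B ^ t
      colour-bound k l m k≢l l≢m k≢m exhaust =
        let f , reduced , injective = Torsion.inequivalent-rotors i₀ exhaust g torsion distinct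
        in reduced-bound (suc q) H A B K 1≤H 1≤A reciprocal small large rooted digraph i₀ f reduced injective
        where open Derived 𝕋 k l m k≢l l≢m k≢m

      supports-product : ∀ x → supports x 0F * (supports x 1F * supports x 2F) ≡ x ^ n
      supports-product x = begin
        supports x 0F * (supports x 1F * supports x 2F)
          ≡⟨ cong (supports x 0F *_) (Prod∑.∑-∙ (allFin n) _ _) ⟨
        supports x 0F * ∏ (allFin n) (λ v → support (b 1F) x v * support (b 2F) x v)
          ≡⟨ Prod∑.∑-∙ (allFin n) _ _ ⟨
        ∏ (allFin n) (λ v → support (b 0F) x v * (support (b 1F) x v * support (b 2F) x v))
          ≡⟨ Prod∑.∑-cong (allFin n) (λ v _ → single v) ⟩
        ∏ (allFin n) (λ _ → x)
          ≡⟨ trans (∏-const (allFin n) x) (cong (λ k → x ^ k) (List.length-tabulate {n = n} id)) ⟩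
        x ^ n ∎
        where
        open ≡-Reasoning
        on : ∀ {k} v → κ v ≡ k → support (b k) x v ≡ x
        on v refl = let j , eq = cover v in subst (λ u → support (b (κ v)) x u ≡ x) eq (support-on (b (κ v)) x j)
        off : ∀ {k} v → κ v ≢ k → support (b k) x v ≡ 1
        off {k} v κ≢k = support-off (b k) x λ j eq → κ≢k (trans (cong κ (sym eq)) (κ-b k j))
        cases : ∀ v y → κ v ≡ y → support (b 0F) x v * (support (b 1F) x v * support (b 2F) x v) ≡ x
        cases v 0F eq = trans (cong₂ _*_ (on v eq) (cong₂ _*_ (off v (λ eq′ → case trans (sym eq) eq′ of λ ())) (off v (λ eq′ → case trans (sym eq) eq′ of λ ())))) (ℕ.*-identityʳ x)
        cases v 1F eq = trans (cong₂ _*_ (off v (λ eq′ → case trans (sym eq) eq′ of λ ())) (cong₂ _*_ (on v eq) (off v (λ eq′ → case trans (sym eq) eq′ of λ ()))))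
          (trans (ℕ.*-identityˡ _) (ℕ.*-identityʳ x))
        cases v 2F eq = trans (cong₂ _*_ (off v (λ eq′ → case trans (sym eq) eq′ of λ ())) (cong₂ _*_ (off v (λ eq′ → case trans (sym eq) eq′ of λ ())) (on v eq)))
          (trans (ℕ.*-identityˡ _) (ℕ.*-identityˡ x))
        single : ∀ v → support (b 0F) x v * (support (b 1F) x v * support (b 2F) x v) ≡ x
        single v = cases v (κ v) refl

      -- The sizes of the single colour classes are not controlled. Over the cyclic choices each
      -- class serves once as hubs and once as tails, so only their total n remains.
      cubed-bound : M ^ (suc q * 3) * H ^ n ≤ A ^ n * (B ^ t) ^ 3
      cubed-bound = begin
        M ^ (suc q * 3) * H ^ n
          ≡⟨ cong₂ _*_ (sym (ℕ.^-*-assoc M (suc q) 3)) (sym (supports-product H)) ⟩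
        (M ^ suc q) ^ 3 * (supports H 0F * (supports H 1F * supports H 2F))
          ≡⟨ arith (M ^ suc q) (supports H 0F) (supports H 1F) (supports H 2F) ⟩
        (M ^ suc q * supports H 1F) * ((M ^ suc q * supports H 2F) * (M ^ suc q * supports H 0F))
          ≤⟨ ℕ.*-mono-≤ (colour-bound 0F 1F 2F (λ ()) (λ ()) (λ ()) exhaust₀)
               (ℕ.*-mono-≤ (colour-bound 1F 2F 0F (λ ()) (λ ()) (λ ()) exhaust₁) (colour-bound 2F 0F 1F (λ ()) (λ ()) (λ ()) exhaust₂)) ⟩
        (supports A 0F * B ^ t) * ((supports A 1F * B ^ t) * (supports A 2F * B ^ t))
          ≡⟨ arith₂ (supports A 0F) (supports A 1F) (supports A 2F) (B ^ t) ⟩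
        supports A 0F * (supports A 1F * supports A 2F) * (B ^ t) ^ 3
          ≡⟨ cong (_* (B ^ t) ^ 3) (supports-product A) ⟩
        A ^ n * (B ^ t) ^ 3 ∎
        where
        open ℕ.≤-Reasoning
        exhaust₀ : ∀ x → x ≡ 0F ⊎ x ≡ 1F ⊎ x ≡ 2F
        exhaust₀ = λ { 0F → inj₁ refl ; 1F → inj₂ (inj₁ refl) ; 2F → inj₂ (inj₂ refl) }
        exhaust₁ : ∀ x → x ≡ 1F ⊎ x ≡ 2F ⊎ x ≡ 0F
        exhaust₁ = λ { 1F → inj₁ refl ; 2F → inj₂ (inj₁ refl) ; 0F → inj₂ (inj₂ refl) }
        exhaust₂ : ∀ x → x ≡ 2F ⊎ x ≡ 0F ⊎ x ≡ 1F
        exhaust₂ = λ { 2F → inj₁ refl ; 0F → inj₂ (inj₁ refl) ; 1F → inj₂ (inj₂ refl) }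
        arith : ∀ x h₀ h₁ h₂ → x * (x * (x * 1)) * (h₀ * (h₁ * h₂)) ≡ (x * h₁) * ((x * h₂) * (x * h₀))
        arith = solve-∀
        arith₂ : ∀ a₀ a₁ a₂ y → (a₀ * y) * ((a₁ * y) * (a₂ * y)) ≡ a₀ * (a₁ * a₂) * (y * (y * (y * 1)))
        arith₂ = solve-∀

      order-bound : n ≡ t + 2 → M * den ^ t ≤ num ^ t
      order-bound n≡ = ^-cancelˡ-≤ (suc (suc (q * 3))) (ℕ.*-cancelˡ-≤ (H ^ n) {{ℕ.m^n≢0 H n {{>-nonZero 1≤H}}}} (begin
        H ^ n * (M * den ^ t) ^ p
          ≡⟨ cong (H ^ n *_) (trans (^-distrib-* p M (den ^ t)) (cong (M ^ p *_) (swap-exponents den))) ⟩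
        H ^ n * (M ^ p * (den ^ p) ^ t)
          ≡⟨ arith (H ^ n) (M ^ p) _ ⟩
        M ^ p * H ^ n * (den ^ p) ^ t
          ≤⟨ ℕ.*-monoˡ-≤ ((den ^ p) ^ t) cubed-bound ⟩
        A ^ n * (B ^ t) ^ 3 * (den ^ p) ^ t
          ≡⟨ cong₂ (λ x y → x * y * (den ^ p) ^ t) (trans (cong (A ^_) n≡) (ℕ.^-distribˡ-+-* A t 2)) (trans (ℕ.^-*-assoc B t 3) (trans (cong (B ^_) (ℕ.*-comm t 3)) (sym (ℕ.^-*-assoc B 3 t)))) ⟩
        A ^ t * A ^ 2 * (B ^ 3) ^ t * (den ^ p) ^ t
          ≡⟨ arith₂ (A ^ t) (A ^ 2) ((B ^ 3) ^ t) ((den ^ p) ^ t) ⟩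
        A ^ 2 * (A ^ t * (B ^ 3) ^ t * (den ^ p) ^ t)
          ≡⟨ cong (A ^ 2 *_) (trans (cong (_* (den ^ p) ^ t) (sym (^-distrib-* t A (B ^ 3)))) (sym (^-distrib-* t (A * B ^ 3) (den ^ p)))) ⟩
        A ^ 2 * (A * B ^ 3 * den ^ p) ^ t
          -- The excess 2 in n = t + 2 costs A² against H², which is why A ≤ H is assumed; `balance`
          -- handles each of the t remaining factors.
          ≤⟨ ℕ.*-mono-≤ (ℕ.^-monoˡ-≤ 2 A≤H) (ℕ.^-monoˡ-≤ t balance) ⟩
        H ^ 2 * (H * num ^ p) ^ t
          ≡⟨ cong (H ^ 2 *_) (^-distrib-* t H (num ^ p)) ⟩
        H ^ 2 * (H ^ t * (num ^ p) ^ t)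
          ≡⟨ arith₃ (H ^ 2) (H ^ t) ((num ^ p) ^ t) ⟩
        H ^ t * H ^ 2 * (num ^ p) ^ t
          ≡⟨ cong₂ _*_ (trans (cong (H ^_) n≡) (ℕ.^-distribˡ-+-* H t 2)) (swap-exponents num) ⟨
        H ^ n * (num ^ t) ^ p ∎))
        where
        open ℕ.≤-Reasoning
        p = suc q * 3
        swap-exponents : ∀ x → (x ^ t) ^ p ≡ (x ^ p) ^ t
        swap-exponents x = trans (ℕ.^-*-assoc x t p) (trans (cong (x ^_) (ℕ.*-comm t p)) (sym (ℕ.^-*-assoc x p t)))
        arith : ∀ a b c → a * (b * c) ≡ b * a * c
        arith = solve-∀
        arith₂ : ∀ a b c d → a * b * c * d ≡ b * (a * c * d)
        arith₂ = solve-∀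
        arith₃ : ∀ a b c → a * (b * c) ≡ b * a * c
        arith₃ = solve-∀

theorem3p3 : Σ ℕ λ a → Σ ℕ λ b → 1 ≤ b × a ^ 5 < 6 * b ^ 5 ×
    Σ ℕ λ T → ∀ t → T ≤ t → (τ : Triangulation t) → (m : ℕ) →
    CanonicalOrder τ m → m * b ^ t ≤ a ^ t
theorem3p3 = 10 , 7 , s≤s z≤n , from-yes (10 ^ 5 <? 6 * 7 ^ 5) , 1 , bound
  where
  H^≤B^ : ∀ d → 71 ^ d ≤ 14 * 17000 ^ d
  H^≤B^ d = ℕ.≤-trans (ℕ.^-monoˡ-≤ d (from-yes (71 ≤? 17000))) (ℕ.m≤n*m (17000 ^ d) 14)
  bound : ∀ t → 1 ≤ t → (τ : Triangulation t) → (m : ℕ) → CanonicalOrder τ m → m * 7 ^ t ≤ 10 ^ t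
  bound (suc t) _ τ m (g , torsion , distinct , _) =
    -- 25 stands for the exponent 26 = `suc 25`.
    Bound.order-bound 25 71 14 17000 11 10 7 (s≤s z≤n) (s≤s z≤n) (from-yes (14 ≤? 71))
      reciprocal-bound small-degree (λ d 11≤d → large-degree (ℕ.≤⇒≤′ 11≤d)) H^≤B^
      -- The 78th root of 14 · 17000³ / 71 is about 1.4245, while 10/7 is about 1.4286.
      (from-yes (14 * 17000 ^ 3 * 7 ^ 78 ≤? 71 * 10 ^ 78))
      -- The face `zero` fixes the root and the killed hub; its existence is why t ≥ 1 is required.
      (tradeOf τ) zero g torsion distinct (Triangulation.euler τ)
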